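{- Let $\Phi=\phi_1\wedge\cdots\wedge\phi_m$ be a satisfiable extremal instance, meaning $\Pr_{\mathcal D}(\Phi)>0$. For each $k\in[m]$, the expected number of iterations of $\mathrm{PRS}(\Phi,\mathcal D)$ in which the scope of $\phi_k$ is resampled equals $q_{\{k\}}/q_\emptyset$. This holds for any rule used to choose the false clause.
   Context: Setting: For $i\in[n]$, $X_i$ takes values in a countable set $D_i$ with probability distribution $\mathcal D_i$; $\mathcal D=\prod_i\mathcal D_i$ is the product distribution. $\Phi=\phi_1\wedge\cdots\wedge\phi_m$, where clause $\phi_k$ is a Boolean function of the variables with indices in its nonempty scope $\mathrm{Scp}(\phi_k)\subseteq[n]$. $\Phi$ is extremal if for all $k\neq\ell$ with $\mathrm{Scp}(\phi_k)\cap\mathrm{Scp}(\phi_\ell)\ne\emptyset$, the formula $\phi_k\vee\phi_\ell$ is true under every assignment. Algorithm $\mathrm{PRS}(\Phi,\mathcal D)$: sample $\mathbf X$ from $\mathcal D$. While $\Phi(\mathbf X)$ is false, choose (by any rule) a clause $\phi_k$ false under the current $\mathbf X$ and resample all $X_i$, $i\in\mathrm{Scp}(\phi_k)$, independently from $\mathcal D_i$. Notation: $\Gamma$ is the dependency graph on $[m]$, with $k\sim\ell$ ($k\ne\ell$) iff $\mathrm{Scp}(\phi_k)\cap\mathrm{Scp}(\phi_\ell)\neq\emptyset$. $\mathcal I(\Gamma)$ is its set of independent sets, including $\emptyset$. $p_k=\Pr_{\mathcal D}(\neg\phi_k)$ and $p_I=\prod_{k\in I}p_k$. For $S\subseteq[m]$,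 $q_S=\sum_{I\in\mathcal I(\Gamma),\,I\supseteq S}(-1)^{|I\setminus S|}p_I$. -}

module Defs where

open import Level using (_⊔_) renaming (zero to lzero; suc to lsuc)
open import Algebra.Apartness.Bundles using (HeytingField; HeytingCommutativeRing)
open import Algebra.Bundles using (CommutativeRing; Semiring)
import Algebra.Definitions.RawSemiring as RawSemiringDefinitions
open import Data.Bool.Base using (Bool; true; false; _∨_; if_then_else_)
open import Data.Bool.ListAction using (all)
open import Data.Fin.Base using (Fin; zero; suc)
open import Data.Fin.Properties using (_≟_) renaming (all? to allF?)
open import Data.Fin.Subset using (Subset; inside; outside; _∈_; _⊆_; _∩_; _─_; ∣_∣; Nonempty; ⊤)
open import Data.Fin.Subset.Properties using (_∈?_; _⊆?_; nonempty?)
open import Data.List.Base using (List; []; _∷_; _++_; map; foldr; filter; allFin)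
open import Data.List.Relation.Unary.Unique.Propositional using (Unique)
open import Data.Nat.Base as ℕ using (ℕ; zero; suc)
open import Data.Product.Base using (_×_; _,_; proj₁; ∃-syntax; Σ-syntax)
open import Data.Sum.Base using (_⊎_)
open import Data.Unit.Base using (tt) renaming (⊤ to Unit)
open import Data.Vec.Base using ([]; _∷_)
open import Function.Base using (_∘_)
open import Function.Bundles using (_⇔_; _↣_)
open import Relation.Binary.Core using (Rel)
open import Relation.Binary.PropositionalEquality.Core using (_≡_; _≢_)
open import Relation.Binary.Structures using (IsStrictPartialOrder)
open import Relation.Nullary.Decidable.Core using (Dec; does; ¬?; _×-dec_; _→-dec_)
open import Relation.Nullary.Negation.Core using (¬_)

-- The axioms of the real numbers.  They are phrased constructively (apartness,
-- strict order, Cauchy completeness); classically they say that the structure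
-- is an Archimedean complete ordered field, which characterises the reals up to
-- isomorphism.
record RealNumbers c ℓ₁ ℓ₂ : Set (lsuc (c ⊔ ℓ₁ ⊔ ℓ₂)) where
  infix 4 _<_ _≤_ _⟶_
  infixl 7 _/_[_]

  field
    heytingField : HeytingField c ℓ₁ ℓ₂

  open HeytingField heytingField public

  commutativeRing : CommutativeRing c ℓ₁
  commutativeRing = HeytingCommutativeRing.commutativeRing heytingCommutativeRing

  open RawSemiringDefinitions (Semiring.rawSemiring (CommutativeRing.semiring commutativeRing)) public
    using (_^_) renaming (_×_ to _·_)

  field
    _<_                  : Rel Carrier ℓ₂
    isStrictPartialOrder : IsStrictPartialOrder _≈_ _<_
    #⇔<⊎>                : ∀ {x y} → x # y ⇔ (x < y ⊎ y < x)
    +-monoʳ-<            : ∀ z {x y} → x < y → z + x < z + y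
    *-positive           : ∀ {x y} → 0# < x → 0# < y → 0# < x * y

  _≤_ : Rel Carrier ℓ₂
  x ≤ y = ¬ (y < x)

  Cauchy : (ℕ → Carrier) → Set (c ⊔ ℓ₂)
  Cauchy s = ∀ ε → 0# < ε → ∃[ N ] (∀ i j → N ℕ.≤ i → N ℕ.≤ j → s i < s j + ε)

  _⟶_ : (ℕ → Carrier) → Carrier → Set (c ⊔ ℓ₂)
  s ⟶ l = ∀ ε → 0# < ε → ∃[ N ] (∀ i → N ℕ.≤ i → s i < l + ε × l < s i + ε)

  field
    archimedean : ∀ x → ∃[ n ] x < n · 1#
    complete    : ∀ s → Cauchy s → ∃[ l ] s ⟶ l

  -- `#⇒invertible y#0` provides the inverse of `y - 0#`.
  _/_[_] : ∀ x y → y # 0# → Carrier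
  x / y [ y#0 ] = x * proj₁ (#⇒invertible y#0)

  ∑ ∏ : ∀ {a} {A : Set a} → List A → (A → Carrier) → Carrier
  ∑ xs f = foldr _+_ 0# (map f xs)
  ∏ xs f = foldr _*_ 1# (map f xs)

  -- The sum of a family of non-negative numbers over an arbitrary index set:
  -- the supremum of the sums over finite sets of indices.
  HasSum : {A : Set} → (A → Carrier) → Carrier → Set (c ⊔ ℓ₂)
  HasSum f s =
    (∀ xs → Unique xs → ∑ xs f ≤ s) ×
    (∀ ε → 0# < ε → ∃[ xs ] Unique xs × s < ∑ xs f + ε)

-- `Values D S` is the product of the `D i` over `i ∈ S`.
Values : ∀ {n} → (Fin n → Set) → Subset n → Set
Values D []            = Unit
Values D (inside  ∷ S) = D zero × Values (D ∘ suc) S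
Values D (outside ∷ S) = Values (D ∘ suc) S

Assignment : ∀ {n} → (Fin n → Set) → Set
Assignment D = Values D ⊤

restrict : ∀ {n} (D : Fin n → Set) (S : Subset n) → Assignment D → Values D S
restrict D []            x       = tt
restrict D (inside  ∷ S) (a , x) = a , restrict (D ∘ suc) S x
restrict D (outside ∷ S) (a , x) = restrict (D ∘ suc) S x

overwrite : ∀ {n} (D : Fin n → Set) (S : Subset n) →
            Assignment D → Values D S → Assignment D
overwrite D []            x       v       = tt
overwrite D (inside  ∷ S) (a , x) (b , v) = b , overwrite (D ∘ suc) S x v
overwrite D (outside ∷ S) (a , x) v       = a , overwrite (D ∘ suc) S x v

subsets : ∀ m → List (Subset m)
subsets zero    = [] ∷ []
subsets (suc m) = map (outside ∷_) (subsets m) ++ map (inside ∷_) (subsets m)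

module PartialRejectionSampling {c ℓ₁ ℓ₂} (ℝ : RealNumbers c ℓ₁ ℓ₂) where
  open RealNumbers ℝ hiding (zero)

  record Distribution (A : Set) : Set (c ⊔ ℓ₂) where
    field
      pmf         : A → Carrier
      nonNegative : ∀ a → 0# ≤ pmf a
      total       : HasSum pmf 1#

  open Distribution public

  record Instance (n m : ℕ) : Set (lsuc lzero ⊔ c ⊔ ℓ₂) where
    field
      D             : Fin n → Set
      countable     : ∀ i → D i ↣ ℕ
      𝒟             : ∀ i → Distribution (D i)
      scope         : Fin m → Subset n
      scopeNonempty : ∀ k → Nonempty (scope k)
      clause        : ∀ k → Values D (scope k) → Bool

    φ : Fin m → Assignment D → Bool
    φ k x = clause k (restrict D (scope k) x)

    formula : Assignment D → Bool
    formula x = all (λ k → φ k x) (allFin m)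

  -- The probability of `v` under the product of the distributions `μ i`, `i ∈ S`.
  mass : ∀ {n} (D : Fin n → Set) → (∀ i → Distribution (D i)) →
         (S : Subset n) → Values D S → Carrier
  mass D μ []            v       = 1#
  mass D μ (inside  ∷ S) (a , v) = pmf (μ zero) a * mass (D ∘ suc) (μ ∘ suc) S v
  mass D μ (outside ∷ S) v       = mass (D ∘ suc) (μ ∘ suc) S v

  module _ {n m : ℕ} (Φ : Instance n m) where
    open Instance Φ

    -- `HasProbability A p` says that Pr_𝒟(A) = p.
    HasProbability : (Assignment D → Bool) → Carrier → Set (c ⊔ ℓ₂)
    HasProbability A p = HasSum (λ x → if A x then mass D 𝒟 ⊤ x else 0#) p

    Adjacent : Fin m → Fin m → Set
    Adjacent k l = k ≢ l × Nonempty (scope k ∩ scope l)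

    Extremal : Set
    Extremal = ∀ k l → Adjacent k l → ∀ x → φ k x ∨ φ l x ≡ true

    Independent : Subset m → Set
    Independent I = ∀ k → k ∈ I → ∀ l → l ∈ I → ¬ Adjacent k l

    adjacent? : ∀ k l → Dec (Adjacent k l)
    adjacent? k l = ¬? (k ≟ l) ×-dec nonempty? (scope k ∩ scope l)

    independent? : ∀ I → Dec (Independent I)
    independent? I =
      allF? λ k → (k ∈? I) →-dec allF? λ l → (l ∈? I) →-dec ¬? (adjacent? k l)

    q : (Fin m → Carrier) → Subset m → Carrier
    q p S =
      ∑ (filter (λ I → independent? I ×-dec (S ⊆? I)) (subsets m)) λ I →
        (- 1#) ^ ∣ I ─ S ∣ * ∏ (filter (_∈? I) (allFin m)) p

    -- What the algorithm has done during its first `t` iterations.  `resample h k v`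
    -- is an iteration that picks clause `k` and draws the new values `v` for its
    -- scope.  Once the formula holds the algorithm has stopped, and `idle` keeps the
    -- history unchanged, so that all histories can be cut off at the same time `t`.
    -- Histories that cannot occur are not excluded here; they get weight zero below.
    data History : ℕ → Set where
      start    : Assignment D → History 0
      resample : ∀ {t} → History t → (k : Fin m) → Values D (scope k) → History (suc t)
      idle     : ∀ {t} → History t → History (suc t)

    current : ∀ {t} → History t → Assignment D
    current (start x)        = x
    current (resample h k v) = overwrite D (scope k) (current h) v
    current (idle h)         = current h

    resamplings : Fin m → ∀ {t} → History t → ℕ
    resamplings k (start x)        = 0
    resamplings k (resample h l v) =
      if does (k ≟ l) then suc (resamplings k h) else resamplings k h
    resamplings k (idle h)         = resamplings k h

    -- A rule may depend on the whole history and may be randomised: `choose h k` is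
    -- the conditional probability of picking clause `k` after history `h`.
    record Rule : Set (c ⊔ ℓ₁ ⊔ ℓ₂) where
      field
        choose      : ∀ {t} → History t → Fin m → Carrier
        nonNegative : ∀ {t} (h : History t) k → 0# ≤ choose h k
        total       : ∀ {t} (h : History t) → formula (current h) ≡ false →
                      ∑ (allFin m) (choose h) ≈ 1#
        picksFalse  : ∀ {t} (h : History t) → formula (current h) ≡ false →
                      ∀ k → φ k (current h) ≡ true → choose h k ≈ 0#

    module _ (rule : Rule) where
      open Rule rule using (choose)

      -- The probability that the first `t` iterations are as described by the history.
      weight : ∀ {t} → History t → Carrier
      weight (start x)        = mass D 𝒟 ⊤ x
      weight (resample h k v) =
        if formula (current h) then 0#
        else weight h * (choose h k * mass D 𝒟 (scope k) v)
      weight (idle h)         = if formula (current h) then weight h else 0#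

      -- The expected number of iterations, over the whole run, that resample the
      -- scope of clause `k`: the limit, by monotone convergence, of the expected
      -- number of such iterations among the first `t`.
      ExpectedResamplings : Fin m → Carrier → Set (c ⊔ ℓ₂)
      ExpectedResamplings k E =
        Σ[ e ∈ (ℕ → Carrier) ]
          (∀ t → HasSum (λ (h : History t) → weight h * (resamplings k h · 1#)) (e t)) ×
          e ⟶ E

{-# OPTIONS --safe #-}
-- Let A l be the indicator of the violation of clause l, and E S f the function f
-- averaged over fresh values for the variables in S.  The idea is to find a bounded
-- potential F on assignments, the expected number of resamplings of clause k still to
-- come, that does not depend on the rule: F x = [k = l] + E (scope l) F x whenever
-- clause l is violated at x, and F x = 0 whenever x satisfies the formula.
--
-- Since A k A l = 0 for adjacent clauses, these equations follow from the single linear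
-- equation  Σ_I (-1)^|I| ∏_{l ∈ I} A l · E (⋃_{l ∈ I} scope l) F = A k ∏_{l ≠ k} (1 - A l),
-- where I ranges over all sets of clauses.  Its left-hand side is triangular with
-- respect to the averages E U, with the diagonal entry Pr (all clauses with scope ⊆ U
-- hold) ≥ Pr Φ > 0 at U, so the equation has a unique solution.  Averaging it over all
-- variables gives q_∅ · E F = q_{k}.
--
-- Under every rule, the count of resamplings of k so far plus F of the current
-- assignment has constant expectation E F.  The sum T of the potentials over all k
-- drops in expectation by 1 per iteration, so t · Pr (running at time t) is bounded,
-- and the expected value of F, which vanishes after halting, tends to 0.
module Submission where

open import Defs
import Algebra.Apartness.Properties.HeytingCommutativeRing as HCR
open import Algebra.Bundles using (CommutativeRing)
import Algebra.Solver.Ring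
open import Algebra.Solver.Ring.AlmostCommutativeRing
  using (_-Raw-AlmostCommutative⟶_; fromCommutativeRing)
open import Data.Bool.Base using (Bool; true; false; if_then_else_; not; _∧_)
open import Data.Bool.ListAction using (all)
open import Data.Bool.Properties using (∧-conicalˡ; ∧-conicalʳ)
open import Data.Empty as Empty using (⊥-elim)
open import Data.Fin.Base using (Fin; zero; suc)
import Data.Fin.Properties as Fin
open import Data.Fin.Subset
  using (Subset; inside; outside; _∈_; _∉_; _⊆_; _⊈_; _∪_; _∩_; ∁; ⊤; ⊥; Nonempty; _─_; ∣_∣;
    ⁅_⁆)
open import Data.Fin.Subset.Properties
  using (_∈?_; _⊆?_; nonempty?; ⊆-antisym; ∪-assoc; ∪-comm; p⊆p∪q; q⊆p∪q; x∈p∪q⁻; x∈p∪q⁺;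
    x∈p∩q⁺; x∈p∩q⁻; x∈∁p⇒x∉p; x∉p⇒x∈∁p; ⊆⊤; ∉⊥; ⊥⊆; drop-∷-⊆; out⊆; in⊆in; x∈⁅x⁆; x∈⁅y⁆⇒x≡y;
    ∩-comm)
open import Data.Integer.Base as ℤ using (ℤ; +_; -[1+_])
import Data.Integer.Properties as ℤ
open import Data.List.Base using (List; []; _∷_; _++_; map; deduplicate; filter; allFin; tabulate)
import Data.List.Membership.DecPropositional as DecMembership
open import Data.List.Membership.Propositional using () renaming (_∈_ to _∈ₗ_; _∉_ to _∉ₗ_)
open import Data.List.Membership.Propositional.Properties
  using (∈-map⁺; ∈-++⁺ˡ; ∈-++⁺ʳ; ∈-deduplicate⁺; ∈-allFin; ∈-filter⁺; ∈-filter⁻)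
open import Data.List.Properties using (filter-all; map-tabulate)
open import Data.List.Relation.Unary.All as All using (All; []; _∷_)
open import Data.List.Relation.Unary.All.Properties using (all-filter)
open import Data.List.Relation.Unary.AllPairs using ([]; _∷_; AllPairs)
open import Data.List.Relation.Unary.Any using (here; there)
open import Data.List.Relation.Unary.Unique.DecPropositional.Properties using (deduplicate-!)
open import Data.List.Relation.Unary.Unique.Propositional using (Unique)
import Data.List.Relation.Unary.Unique.Propositional.Properties as Unique
open import Data.Maybe.Base using (Maybe; just; nothing)
open import Data.Nat.Base as ℕ using (ℕ; zero; suc)
import Data.Nat.Properties as ℕ
open import Data.Product.Base using (_×_; _,_; proj₁; proj₂; ∃-syntax; Σ-syntax)
open import Data.Product.Properties using (≡-dec)
open import Data.Sum.Base using (_⊎_; inj₁; inj₂; [_,_]′)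
open import Data.Unit.Base using (tt) renaming (⊤ to Unit)
open import Data.Vec.Base as Vec using ([]; _∷_)
open import Function.Base using (_∘_; id)
open import Function.Bundles using (Equivalence)
open import Level using (_⊔_)
open import Relation.Binary.Definitions using (DecidableEquality)
open import Relation.Binary.PropositionalEquality as ≡ using (_≡_; _≢_)
open import Relation.Binary.Structures using (IsStrictPartialOrder)
open import Relation.Nullary.Decidable using (via-injection; dec-true; dec-false)
open import Relation.Nullary.Decidable.Core using (yes; no; Dec; does; ¬?; _×-dec_; map′)
open import Relation.Nullary.Negation.Core using (¬_; contradiction)
open import Relation.Unary using (Pred; Decidable)

-- Termination is not known in advance, so `F` cannot be defined as an expected count; solving a
-- linear equation produces it before any run is considered. Multiplying that equation by `A l`
-- leaves only sets `I` of clauses far from `l`, with `F - E (scope l) F` in place of `F`, because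
-- the terms for `I` and `I ∪ {l}` differ just by a sign and one more average. The operator of these
-- far clauses commutes with `A l` and is triangular as well, hence injective; cancelling it gives
-- the local equation at `l`. This is why inversion is proved for every list of clauses. The value
-- sets may be infinite and the reals are constructive, so suprema, maxima and sign tests cannot be
-- taken freely. Expectations are therefore functionals on functions that carry an explicit bound,
-- obtained as Cauchy limits of finite sums whose error is proportional to the missing mass. This
-- admits signed functions, whereas `HasSum` fits non-negative ones; `Represents` connects the two
-- views. Signed functions are essential: `F` comes with a bound but without a sign.

module RingSolver {c ℓ} (R : CommutativeRing c ℓ) where
  open CommutativeRing R
  open import Algebra.Properties.Ring ring
  open import Algebra.Properties.AbelianGroup +-abelianGroup using (⁻¹-∙-comm)
  open import Algebra.Properties.Semiring.Mult.TCOptimised semiring renaming (_×_ to _·_)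
  open import Relation.Binary.Reasoning.Setoid setoid

  -- Equality in the ring is undecidable, so the solver normalises over ℤ, where cancelling
  -- coefficients are recognised. The optimised multiple makes the images of 0 and 1 definitionally
  -- `0#` and `1#`, which lets `con` match literals in goals.
  fromℤ : ℤ → Carrier
  fromℤ (+ n)    = n · 1#
  fromℤ -[1+ n ] = - (suc n · 1#)

  fromℤ-⊖ : ∀ m n → fromℤ (m ℤ.⊖ n) ≈ m · 1# - n · 1#
  fromℤ-⊖ m zero = sym (trans (+-congˡ -0#≈0#) (+-identityʳ _))
  fromℤ-⊖ zero (suc n) = sym (+-identityˡ _)
  fromℤ-⊖ (suc m) (suc n) = begin
    fromℤ (suc m ℤ.⊖ suc n)         ≡⟨ ≡.cong fromℤ (ℤ.[1+m]⊖[1+n]≡m⊖n m n) ⟩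
    fromℤ (m ℤ.⊖ n)                 ≈⟨ fromℤ-⊖ m n ⟩
    m · 1# - n · 1#                 ≈⟨ +-congʳ (+-identityʳ _) ⟨
    m · 1# + 0# - n · 1#            ≈⟨ +-congʳ (+-congˡ (-‿inverseʳ 1#)) ⟨
    m · 1# + (1# - 1#) - n · 1#     ≈⟨ +-congʳ (+-assoc _ _ _) ⟨
    m · 1# + 1# - 1# - n · 1#       ≈⟨ +-assoc _ _ _ ⟩
    m · 1# + 1# + (- 1# - n · 1#)   ≈⟨ +-cong (trans (+-comm _ _) (sym (1+× m 1#))) (trans (⁻¹-∙-comm _ _) (-‿cong (sym (1+× n 1#)))) ⟩
    suc m · 1# - suc n · 1#         ∎

  fromℤ-+ : ∀ i j → fromℤ (i ℤ.+ j) ≈ fromℤ i + fromℤ j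
  fromℤ-+ (+ m)    (+ n)    = ×-homo-+ 1# m n
  fromℤ-+ (+ m)    -[1+ n ] = fromℤ-⊖ m (suc n)
  fromℤ-+ -[1+ m ] (+ n)    = trans (fromℤ-⊖ n (suc m)) (+-comm _ _)
  fromℤ-+ -[1+ m ] -[1+ n ] = begin
    - (suc (suc (m ℕ.+ n)) · 1#)        ≡⟨ ≡.cong (λ k → - (k · 1#)) (≡.cong suc (ℕ.+-suc m n)) ⟨
    - ((suc m ℕ.+ suc n) · 1#)          ≈⟨ -‿cong (×-homo-+ 1# (suc m) (suc n)) ⟩
    - (suc m · 1# + suc n · 1#)         ≈⟨ ⁻¹-∙-comm _ _ ⟨
    - (suc m · 1#) - suc n · 1#         ∎

  fromℤ-neg : ∀ i → fromℤ (ℤ.- i) ≈ - fromℤ i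
  fromℤ-neg (+ zero)  = sym -0#≈0#
  fromℤ-neg (+ suc n) = refl
  fromℤ-neg -[1+ n ]  = sym (-‿involutive _)

  fromℤ-*⁺ : ∀ m n → fromℤ (+ m ℤ.* + n) ≈ fromℤ (+ m) * fromℤ (+ n)
  fromℤ-*⁺ m n = trans (reflexive (≡.cong fromℤ (≡.sym (ℤ.pos-* m n)))) (×1-homo-* m n)

  fromℤ-*⁺ˡ : ∀ m j → fromℤ (+ m ℤ.* j) ≈ fromℤ (+ m) * fromℤ j
  fromℤ-*⁺ˡ m (+ n)    = fromℤ-*⁺ m n
  fromℤ-*⁺ˡ m -[1+ n ] = begin
    fromℤ (+ m ℤ.* -[1+ n ])           ≡⟨ ≡.cong fromℤ (ℤ.neg-distribʳ-* (+ m) (+ suc n)) ⟨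
    fromℤ (ℤ.- (+ m ℤ.* + suc n))      ≈⟨ fromℤ-neg (+ m ℤ.* + suc n) ⟩
    - fromℤ (+ m ℤ.* + suc n)          ≈⟨ -‿cong (fromℤ-*⁺ m (suc n)) ⟩
    - (fromℤ (+ m) * fromℤ (+ suc n))  ≈⟨ -‿distribʳ-* _ _ ⟩
    fromℤ (+ m) * fromℤ -[1+ n ]       ∎

  fromℤ-* : ∀ i j → fromℤ (i ℤ.* j) ≈ fromℤ i * fromℤ j
  fromℤ-* (+ m)    j = fromℤ-*⁺ˡ m j
  fromℤ-* -[1+ m ] j = begin
    fromℤ (-[1+ m ] ℤ.* j)           ≡⟨ ≡.cong fromℤ (ℤ.neg-distribˡ-* (+ suc m) j) ⟨
    fromℤ (ℤ.- (+ suc m ℤ.* j))      ≈⟨ fromℤ-neg (+ suc m ℤ.* j) ⟩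
    - fromℤ (+ suc m ℤ.* j)          ≈⟨ -‿cong (fromℤ-*⁺ˡ (suc m) j) ⟩
    - (fromℤ (+ suc m) * fromℤ j)    ≈⟨ -‿distribˡ-* _ _ ⟩
    fromℤ -[1+ m ] * fromℤ j         ∎

  ℤ-morphism : ℤ.+-*-rawRing -Raw-AlmostCommutative⟶ fromCommutativeRing R
  ℤ-morphism = record
    { ⟦_⟧    = fromℤ
    ; +-homo = fromℤ-+
    ; *-homo = fromℤ-*
    ; -‿homo = fromℤ-neg
    ; 0-homo = refl
    ; 1-homo = refl
    }

  fromℤ≟ : ∀ i j → Maybe (fromℤ i ≈ fromℤ j)
  fromℤ≟ i j with i ℤ.≟ j
  ... | yes ≡.refl = just refl
  ... | no  _      = nothing

  open Algebra.Solver.Ring ℤ.+-*-rawRing (fromCommutativeRing R) ℤ-morphism fromℤ≟ public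
    using (solve; _:=_; _:+_; _:*_; :-_; _:-_; con)

-- Order and approximation in the constructive reals.

module OrderedField {c ℓ₁ ℓ₂} (ℝ : RealNumbers c ℓ₁ ℓ₂) where
  open RealNumbers ℝ hiding (zero)
  open RingSolver commutativeRing public
  open IsStrictPartialOrder isStrictPartialOrder public
    using () renaming (trans to <-trans; irrefl to <-irrefl; <-respˡ-≈ to <-respˡ; <-respʳ-≈ to <-respʳ)
  open HCR heytingCommutativeRing using (1#0; invertibleʳ⇒#; x-0≈x)

  abstract
    <⇒# : ∀ {x y} → x < y → x # y
    <⇒# x<y = Equivalence.from #⇔<⊎> (inj₁ x<y)

    #⇒<⊎> : ∀ {x y} → x # y → x < y ⊎ y < x
    #⇒<⊎> = Equivalence.to #⇔<⊎>

    -- The stand-in for trichotomy, inherited from cotransitivity of apartness. With `≤` defined as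
    -- a negation, mixed transitivity depends on it.
    <-cotrans : ∀ {x y} → x < y → ∀ z → x < z ⊎ z < y
    <-cotrans x<y z with #-cotrans (<⇒# x<y) z
    ... | inj₁ x#z with #⇒<⊎> x#z
    ...   | inj₁ x<z = inj₁ x<z
    ...   | inj₂ z<x = inj₂ (<-trans z<x x<y)
    <-cotrans x<y z | inj₂ z#y with #⇒<⊎> z#y
    ...   | inj₁ z<y = inj₂ z<y
    ...   | inj₂ y<z = inj₁ (<-trans x<y y<z)

    <⇒≤ : ∀ {x y} → x < y → x ≤ y
    <⇒≤ x<y y<x = <-irrefl refl (<-trans x<y y<x)

    ≤-reflexive : ∀ {x y} → x ≈ y → x ≤ y
    ≤-reflexive x≈y y<x = <-irrefl (sym x≈y) y<x

    ≤-refl : ∀ {x} → x ≤ x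
    ≤-refl = ≤-reflexive refl

    ≤-<-trans : ∀ {x y z} → x ≤ y → y < z → x < z
    ≤-<-trans {x} x≤y y<z = [ ⊥-elim ∘ x≤y , (λ x<z → x<z) ]′ (<-cotrans y<z x)

    <-≤-trans : ∀ {x y z} → x < y → y ≤ z → x < z
    <-≤-trans {z = z} x<y y≤z = [ (λ x<z → x<z) , ⊥-elim ∘ y≤z ]′ (<-cotrans x<y z)

    ≤-trans : ∀ {x y z} → x ≤ y → y ≤ z → x ≤ z
    ≤-trans x≤y y≤z z<x = y≤z (<-≤-trans z<x x≤y)

    ≤-antisym : ∀ {x y} → x ≤ y → y ≤ x → x ≈ y
    ≤-antisym x≤y y≤x = proj₁ (tight _ _) ([ y≤x , x≤y ]′ ∘ #⇒<⊎>)

    ≤-respˡ : ∀ {x y z} → x ≈ y → x ≤ z → y ≤ z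
    ≤-respˡ x≈y = ≤-trans (≤-reflexive (sym x≈y))

    ≤-respʳ : ∀ {x y z} → x ≈ y → z ≤ x → z ≤ y
    ≤-respʳ x≈y z≤x = ≤-trans z≤x (≤-reflexive x≈y)

    x<y⇒0<y-x : ∀ {x y} → x < y → 0# < y - x
    x<y⇒0<y-x {x} {y} x<y = <-respˡ (-‿inverseˡ x) (<-respʳ (+-comm (- x) y) (+-monoʳ-< (- x) x<y))

    0<y-x⇒x<y : ∀ {x y} → 0# < y - x → x < y
    0<y-x⇒x<y {x} {y} 0<d = <-respˡ (+-identityʳ x)
      (<-respʳ (solve 2 (λ x y → x :+ (y :- x) := y) refl x y) (+-monoʳ-< x 0<d))

    -- Linear inequalities are proved by writing the difference of the two sides
    -- as a sum of terms known to be non-negative.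
    by-< : ∀ {x y d} → 0# < d → y - x ≈ d → x < y
    by-< 0<d eq = 0<y-x⇒x<y (<-respʳ (sym eq) 0<d)

    x≤y⇒0≤y-x : ∀ {x y} → x ≤ y → 0# ≤ y - x
    x≤y⇒0≤y-x {x} {y} x≤y d<0 = x≤y (by-< (x<y⇒0<y-x d<0)
      (solve 2 (λ x y → x :- y := con (+ 0) :- (y :- x)) refl x y))

    by-≤ : ∀ {x y d} → 0# ≤ d → y - x ≈ d → x ≤ y
    by-≤ {x} {y} 0≤d eq y<x = 0≤d (by-< (x<y⇒0<y-x y<x)
      (trans (+-congˡ (-‿cong (sym eq))) (solve 2 (λ x y → con (+ 0) :- (y :- x) := x :- y) refl x y)))

    0<+ : ∀ {x y} → 0# < x → 0# ≤ y → 0# < x + y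
    0<+ {x} {y} 0<x 0≤y = ≤-<-trans 0≤y (by-< 0<x (solve 2 (λ x y → x :+ y :- y := x) refl x y))

    0≤+ : ∀ {x y} → 0# ≤ x → 0# ≤ y → 0# ≤ x + y
    0≤+ {x} {y} 0≤x 0≤y = ≤-trans 0≤y (by-≤ 0≤x (solve 2 (λ x y → x :+ y :- y := x) refl x y))

    +-mono-≤ : ∀ {x y u v} → x ≤ y → u ≤ v → x + u ≤ y + v
    +-mono-≤ {x} {y} {u} {v} x≤y u≤v = by-≤ (0≤+ (x≤y⇒0≤y-x x≤y) (x≤y⇒0≤y-x u≤v))
      (solve 4 (λ x y u v → y :+ v :- (x :+ u) := y :- x :+ (v :- u)) refl x y u v)

    +-mono-<-≤ : ∀ {x y u v} → x < y → u ≤ v → x + u < y + v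
    +-mono-<-≤ {x} {y} {u} {v} x<y u≤v = by-< (0<+ (x<y⇒0<y-x x<y) (x≤y⇒0≤y-x u≤v))
      (solve 4 (λ x y u v → y :+ v :- (x :+ u) := y :- x :+ (v :- u)) refl x y u v)

    +-mono-≤-< : ∀ {x y u v} → x ≤ y → u < v → x + u < y + v
    +-mono-≤-< x≤y u<v = <-respˡ (+-comm _ _) (<-respʳ (+-comm _ _) (+-mono-<-≤ u<v x≤y))

    neg-≤ : ∀ {x y} → x ≤ y → - y ≤ - x
    neg-≤ {x} {y} x≤y = by-≤ (x≤y⇒0≤y-x x≤y) (solve 2 (λ x y → :- x :- :- y := y :- x) refl x y)

    *≈1⇒#0 : ∀ {x y} → x * y ≈ 1# → x # 0#
    *≈1⇒#0 xy≈1 = invertibleʳ⇒# (_ , trans (*-congʳ (x-0≈x _)) xy≈1)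

    #0⇒inverse : ∀ {x} → x # 0# → ∃[ y ] x * y ≈ 1#
    #0⇒inverse x#0 with #⇒invertible x#0
    ... | y , _ , xy≈1 = y , trans (*-congʳ (sym (x-0≈x _))) xy≈1

    *#0⇒#0 : ∀ {x y} → x * y # 0# → x # 0#
    *#0⇒#0 xy#0 = *≈1⇒#0 (trans (sym (*-assoc _ _ _)) (proj₂ (#0⇒inverse xy#0)))

    *-negative : ∀ {x y} → 0# < x → y < 0# → x * y < 0#
    *-negative {x} {y} 0<x y<0 = by-< (*-positive 0<x (x<y⇒0<y-x y<0))
      (solve 2 (λ x y → con (+ 0) :- x :* y := x :* (con (+ 0) :- y)) refl x y)

    -- A negative product is apart from zero, hence invertible, and so are both factors. This makes
    -- the signs of `x` and `y` available, which cannot be decided outright.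
    0≤* : ∀ {x y} → 0# ≤ x → 0# ≤ y → 0# ≤ x * y
    0≤* {x} {y} 0≤x 0≤y xy<0 with #⇒<⊎> (*#0⇒#0 xy#0) | #⇒<⊎> (*#0⇒#0 yx#0)
      where
      xy#0 : x * y # 0#
      xy#0 = <⇒# xy<0
      yx#0 : y * x # 0#
      yx#0 = <⇒# (<-respˡ (*-comm x y) xy<0)
    ... | inj₁ x<0 | _        = 0≤x x<0
    ... | inj₂ _   | inj₁ y<0 = 0≤y y<0
    ... | inj₂ 0<x | inj₂ 0<y = <⇒≤ (*-positive 0<x 0<y) xy<0

    0<1 : 0# < 1#
    0<1 with #⇒<⊎> 1#0
    ... | inj₂ 0<1 = 0<1
    ... | inj₁ 1<0 = ⊥-elim (<-irrefl refl (<-trans 1<0 (<-respʳ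
          (solve 0 ((con (+ 0) :- con (+ 1)) :* (con (+ 0) :- con (+ 1)) := con (+ 1)) refl)
          (*-positive (x<y⇒0<y-x 1<0) (x<y⇒0<y-x 1<0)))))

    0<*⇒0< : ∀ {x y} → 0# < x → 0# < x * y → 0# < y
    0<*⇒0< {x} {y} 0<x 0<xy
      with #⇒<⊎> (*#0⇒#0 {y} {x} (#-sym (<⇒# (<-respʳ (*-comm x y) 0<xy))))
    ... | inj₂ 0<y = 0<y
    ... | inj₁ y<0 = ⊥-elim (<⇒≤ 0<xy (*-negative 0<x y<0))

    *-monoˡ-≤ : ∀ {x y z} → 0# ≤ z → x ≤ y → z * x ≤ z * y
    *-monoˡ-≤ {x} {y} {z} 0≤z x≤y = by-≤ (0≤* 0≤z (x≤y⇒0≤y-x x≤y))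
      (solve 3 (λ x y z → z :* y :- z :* x := z :* (y :- x)) refl x y z)

    *-monoˡ-< : ∀ {x y z} → 0# < z → x < y → z * x < z * y
    *-monoˡ-< {x} {y} {z} 0<z x<y = by-< (*-positive 0<z (x<y⇒0<y-x x<y))
      (solve 3 (λ x y z → z :* y :- z :* x := z :* (y :- x)) refl x y z)

    *-cancelˡ-< : ∀ {x y z} → 0# < z → z * x < z * y → x < y
    *-cancelˡ-< {x} {y} {z} 0<z zx<zy = 0<y-x⇒x<y (0<*⇒0< 0<z (<-respʳ
      (solve 3 (λ x y z → z :* y :- z :* x := z :* (y :- x)) refl x y z) (x<y⇒0<y-x zx<zy)))

    positive-inverse : ∀ {x} → 0# < x → ∃[ y ] 0# < y × x * y ≈ 1#
    positive-inverse 0<x with #0⇒inverse (#-sym (<⇒# 0<x))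
    ... | y , xy≈1 = y , 0<*⇒0< 0<x (<-respʳ (sym xy≈1) 0<1) , xy≈1

    ≤-by-approximation : ∀ {x y} → (∀ ε → 0# < ε → x < y + ε) → x ≤ y
    ≤-by-approximation {x} {y} approx y<x = <-irrefl
      (solve 2 (λ x y → x := y :+ (x :- y)) refl x y)
      (approx (x - y) (x<y⇒0<y-x y<x))

    n·1-mono : ∀ {m n} → m ℕ.≤ n → m · 1# ≤ n · 1#
    n·1-mono {n = zero}  ℕ.z≤n = ≤-refl
    n·1-mono {n = suc n} ℕ.z≤n = 0≤+ (<⇒≤ 0<1) (n·1-mono {n = n} ℕ.z≤n)
    n·1-mono (ℕ.s≤s m≤n) = +-mono-≤ ≤-refl (n·1-mono m≤n)

    0≤n·1 : ∀ n → 0# ≤ n · 1#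
    0≤n·1 n = n·1-mono (ℕ.z≤n {n})

    upper-bound : ∀ x → ∃[ C ] 0# < C × x < C
    upper-bound x with archimedean x
    ... | n , x<n = 1# + n · 1# , 0<+ 0<1 (0≤n·1 n) ,
          <-≤-trans x<n (by-≤ (<⇒≤ 0<1) (solve 2 (λ a b → a :+ b :- b := a) refl 1# (n · 1#)))

    0<suc : ∀ n → 0# < suc n · 1#
    0<suc n = 0<+ 0<1 (0≤n·1 n)

    inverse-< : ∀ {x y z} → 0# < x → x * y ≈ 1# → 1# < x * z → y < z
    inverse-< 0<x xy≈1 1<xz = *-cancelˡ-< 0<x (<-respˡ (sym xy≈1) 1<xz)

    archimedean-ratio : ∀ x {y} → 0# < y → ∃[ N ] (∀ n → N ℕ.≤ n → x < n · 1# * y)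
    archimedean-ratio x {y} 0<y =
      let z , 0<z , yz≈1 = positive-inverse 0<y
          N , zx<N       = archimedean (z * x)
          eq             = trans (sym (*-assoc _ _ _)) (trans (*-congʳ yz≈1) (*-identityˡ x))
      in  N , λ n N≤n → <-≤-trans (<-respˡ eq (*-monoˡ-< 0<y zx<N))
            (≤-respʳ (*-comm _ _) (*-monoˡ-≤ (<⇒≤ 0<y) (n·1-mono N≤n)))

    reciprocals-vanish : (δ : ℕ → Carrier) → (∀ n → suc n · 1# * δ n ≈ 1#) →
                         ∀ ε → 0# < ε → ∃[ N ] (∀ n → N ℕ.≤ n → δ n < ε)
    reciprocals-vanish δ inverse ε 0<ε =
      let N , large = archimedean-ratio 1# 0<ε
      in  N , λ n N≤n → inverse-< (0<suc n) (inverse n) (large (suc n) (ℕ.m≤n⇒m≤1+n N≤n))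

    -- `x` may be zero or negative, with no way to tell, so `ε` is divided by a positive `C` above
    -- `x` and not by `x`.
    scale-down : ∀ x {ε} → 0# < ε → ∃[ δ ] 0# < δ × x * δ < ε
    scale-down x {ε} 0<ε =
      let C , 0<C , x<C  = upper-bound x
          z , 0<z , Cz≈1 = positive-inverse 0<C
          0<zε           = *-positive 0<z 0<ε
          eq             = trans (sym (*-assoc _ _ _)) (trans (*-congʳ Cz≈1) (*-identityˡ ε))
      in  z * ε , 0<zε , <-respʳ eq (<-respˡ (*-comm _ _) (<-respʳ (*-comm _ _) (*-monoˡ-< 0<zε x<C)))

    half : ∀ {ε} → 0# < ε → ∃[ δ ] 0# < δ × δ + δ < ε
    half 0<ε =
      let δ , 0<δ , 2δ<ε = scale-down (1# + 1#) 0<ε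
      in  δ , 0<δ , <-respˡ (solve 1 (λ d → (con (+ 1) :+ con (+ 1)) :* d := d :+ d) refl δ) 2δ<ε

-- Suprema of finite sums over arbitrary index sets.

module Summation {c ℓ₁ ℓ₂} (ℝ : RealNumbers c ℓ₁ ℓ₂) where
  open RealNumbers ℝ hiding (zero)
  open OrderedField ℝ

  abstract
    ∑-cong-∈ : ∀ {A : Set} (xs : List A) {f g : A → Carrier} →
               (∀ {x} → x ∈ₗ xs → f x ≈ g x) → ∑ xs f ≈ ∑ xs g
    ∑-cong-∈ []       f≈g = refl
    ∑-cong-∈ (x ∷ xs) f≈g = +-cong (f≈g (here ≡.refl)) (∑-cong-∈ xs (f≈g ∘ there))

    ∑-cong : ∀ {A : Set} (xs : List A) {f g : A → Carrier} → (∀ x → f x ≈ g x) → ∑ xs f ≈ ∑ xs g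
    ∑-cong xs f≈g = ∑-cong-∈ xs (λ {x} _ → f≈g x)

    ∑-mono : ∀ {A : Set} (xs : List A) {f g : A → Carrier} → (∀ x → f x ≤ g x) → ∑ xs f ≤ ∑ xs g
    ∑-mono []       f≤g = ≤-refl
    ∑-mono (x ∷ xs) f≤g = +-mono-≤ (f≤g x) (∑-mono xs f≤g)

    ∑-0 : ∀ {A : Set} (xs : List A) → ∑ xs (λ _ → 0#) ≈ 0#
    ∑-0 []       = refl
    ∑-0 (x ∷ xs) = trans (+-identityˡ _) (∑-0 xs)

    ∑-nonNegative : ∀ {A : Set} (xs : List A) {f : A → Carrier} → (∀ x → 0# ≤ f x) → 0# ≤ ∑ xs f
    ∑-nonNegative xs 0≤f = ≤-respˡ (∑-0 xs) (∑-mono xs 0≤f)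

    ∑-+ : ∀ {A : Set} (xs : List A) (f g : A → Carrier) →
          ∑ xs (λ x → f x + g x) ≈ ∑ xs f + ∑ xs g
    ∑-+ []       f g = sym (+-identityˡ _)
    ∑-+ (x ∷ xs) f g = trans (+-congˡ (∑-+ xs f g))
      (solve 4 (λ a b c d → a :+ b :+ (c :+ d) := a :+ c :+ (b :+ d)) refl _ _ _ _)

    ∑-* : ∀ {A : Set} (xs : List A) (a : Carrier) (f : A → Carrier) →
          ∑ xs (λ x → a * f x) ≈ a * ∑ xs f
    ∑-* []       a f = sym (zeroʳ a)
    ∑-* (x ∷ xs) a f = trans (+-congˡ (∑-* xs a f)) (sym (distribˡ _ _ _))

    ∑-swap : ∀ {A B : Set} (xs : List A) (ys : List B) (f : A → B → Carrier) →
             ∑ xs (λ x → ∑ ys (f x)) ≈ ∑ ys (λ y → ∑ xs (λ x → f x y))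
    ∑-swap []       ys f = sym (∑-0 ys)
    ∑-swap (x ∷ xs) ys f = trans (+-congˡ (∑-swap xs ys f)) (sym (∑-+ ys (f x) _))

    ∑-map : ∀ {A B : Set} (g : A → B) (xs : List A) (f : B → Carrier) → ∑ (map g xs) f ≈ ∑ xs (f ∘ g)
    ∑-map g []       f = refl
    ∑-map g (x ∷ xs) f = +-congˡ (∑-map g xs f)

    HasSum-cong : ∀ {A : Set} {f g : A → Carrier} {s t} →
                  (∀ x → f x ≈ g x) → s ≈ t → HasSum f s → HasSum g t
    HasSum-cong f≈g s≈t (upper , approach) =
      (λ xs xs! → ≤-respʳ s≈t (≤-respˡ (∑-cong xs f≈g) (upper xs xs!))) ,
      (λ ε 0<ε → let xs , xs! , close = approach ε 0<ε
                 in  xs , xs! , <-respˡ s≈t (<-respʳ (+-congʳ (∑-cong xs f≈g)) close))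

    HasSum-≤ : ∀ {A : Set} {f : A → Carrier} {s t} → HasSum f s → HasSum f t → s ≤ t
    HasSum-≤ (_ , approach) (upper , _) = ≤-by-approximation λ ε 0<ε →
      let xs , xs! , close = approach ε 0<ε
      in  <-≤-trans close (+-mono-≤ (upper xs xs!) ≤-refl)

    HasSum-unique : ∀ {A : Set} {f : A → Carrier} {s t} → HasSum f s → HasSum f t → s ≈ t
    HasSum-unique p q = ≤-antisym (HasSum-≤ p q) (HasSum-≤ q p)

    HasSum-0 : ∀ {A : Set} → HasSum {A} (λ _ → 0#) 0#
    HasSum-0 = (λ xs _ → ≤-reflexive (∑-0 xs)) ,
               (λ ε 0<ε → [] , [] , <-respʳ (sym (+-identityˡ ε)) 0<ε)

    HasSum-* : ∀ {A : Set} {f : A → Carrier} {s a} → 0# ≤ a → HasSum f s → HasSum (λ x → a * f x) (a * s)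
    HasSum-* {f = f} {a = a} 0≤a (upper , approach) =
      (λ xs xs! → ≤-respˡ (sym (∑-* xs a f)) (*-monoˡ-≤ 0≤a (upper xs xs!))) ,
      (λ ε 0<ε → let δ , 0<δ , aδ<ε    = scale-down a 0<ε
                     xs , xs! , close = approach δ 0<δ
                 in  xs , xs! , ≤-<-trans (*-monoˡ-≤ 0≤a (<⇒≤ close))
                       (<-respˡ (sym (distribˡ a _ δ)) (+-mono-≤-< (≤-reflexive (sym (∑-* xs a f))) aδ<ε)))

    HasSum-singleton : ∀ {A : Set} (x : A) (f : A → Carrier) → (∀ y → y ≡ x ⊎ f y ≈ 0#) → 0# ≤ f x → HasSum f (f x)
    HasSum-singleton x f support 0≤fx = upper ,
      (λ ε 0<ε → x ∷ [] , [] ∷ [] , by-< 0<ε (solve 2 (λ a e → a :+ con (+ 0) :+ e :- a := e) refl (f x) ε))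
      where
      vanish : ∀ {xs} → All (x ≢_) xs → ∑ xs f ≈ 0#
      vanish []           = refl
      vanish {y ∷ ys} (x≢y ∷ x∉ys) with support y
      ... | inj₁ y≡x  = ⊥-elim (x≢y (≡.sym y≡x))
      ... | inj₂ fy≈0 = trans (+-cong fy≈0 (vanish x∉ys)) (+-identityˡ _)
      upper : ∀ xs → Unique xs → ∑ xs f ≤ f x
      upper []       _            = 0≤fx
      upper (y ∷ ys) (y∉ys ∷ ys!) with support y
      ... | inj₁ ≡.refl = ≤-reflexive (trans (+-congˡ (vanish y∉ys)) (+-identityʳ _))
      ... | inj₂ fy≈0   = ≤-respˡ (sym (trans (+-congʳ fy≈0) (+-identityˡ _))) (upper ys ys!)

    HasSum-image : ∀ {A B : Set} (ι : A → B) → (∀ {x y} → ι x ≡ ι y → x ≡ y) →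
                   (g : B → Carrier) → (∀ y → (∃[ x ] y ≡ ι x) ⊎ g y ≈ 0#) →
                   ∀ {s} → HasSum (g ∘ ι) s → HasSum g s
    HasSum-image {A} ι injective g support {s} (upper , approach) =
      (λ ys ys! → let xs , xs! , _ , eq = preimage ys ys! in ≤-respˡ (sym eq) (upper xs xs!)) ,
      (λ ε 0<ε → let xs , xs! , close = approach ε 0<ε
                 in  map ι xs , Unique.map⁺ injective xs! , <-respʳ (+-congʳ (sym (∑-map ι xs g))) close)
      where
      -- The inclusion of the images in `ys` is carried along to show that each newly added preimage
      -- is fresh.
      preimage : ∀ ys → Unique ys → ∃[ xs ] Unique xs × (∀ {x} → x ∈ₗ xs → ι x ∈ₗ ys) × ∑ ys g ≈ ∑ xs (g ∘ ι)
      preimage []       _            = [] , [] , (λ ()) , refl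
      preimage (y ∷ ys) (y∉ys ∷ ys!) with preimage ys ys! | support y
      ... | xs , xs! , sub , eq | inj₁ (x , ≡.refl) =
        x ∷ xs , All.tabulate (λ x′∈xs x≡x′ → All.lookup y∉ys (sub x′∈xs) (≡.cong ι x≡x′)) ∷ xs! ,
        (λ { (here ≡.refl) → here ≡.refl ; (there x′∈xs) → there (sub x′∈xs) }) , +-congˡ eq
      ... | xs , xs! , sub , eq | inj₂ gy≈0 =
        xs , xs! , there ∘ sub , trans (+-cong gy≈0 eq) (+-identityˡ _)

  module Discrete {A : Set} (_≟_ : DecidableEquality A) where
    open DecMembership _≟_ using () renaming (_∈?_ to _∈ₗ?_)

    δ : A → A → Carrier
    δ x y = if does (x ≟ y) then 1# else 0#

    -- On a duplicate-free list this is the indicator function of its members. It turns inclusions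
    -- of finite sets into pointwise comparisons of weights.
    count : List A → A → Carrier
    count xs y = ∑ xs (δ y)

    union : List A → List A → List A
    union xs ys = deduplicate _≟_ (xs ++ ys)

    abstract
      δ-≡ : ∀ {x y} → x ≡ y → δ x y ≈ 1#
      δ-≡ {x} {y} x≡y with x ≟ y
      ... | yes _  = refl
      ... | no x≢y = ⊥-elim (x≢y x≡y)

      δ-≢ : ∀ {x y} → x ≢ y → δ x y ≈ 0#
      δ-≢ {x} {y} x≢y with x ≟ y
      ... | yes x≡y = ⊥-elim (x≢y x≡y)
      ... | no _    = refl

      0≤δ : ∀ x y → 0# ≤ δ x y
      0≤δ x y with does (x ≟ y)
      ... | true  = <⇒≤ 0<1
      ... | false = ≤-refl

      count-∉ : ∀ xs {y} → y ∉ₗ xs → count xs y ≈ 0#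
      count-∉ []       _    = refl
      count-∉ (x ∷ xs) y∉ = trans (+-cong (δ-≢ (y∉ ∘ here)) (count-∉ xs (y∉ ∘ there))) (+-identityˡ _)

      count-∈ : ∀ xs {y} → Unique xs → y ∈ₗ xs → count xs y ≈ 1#
      count-∈ (x ∷ xs) (x∉xs ∷ _) (here ≡.refl) =
        trans (+-cong (δ-≡ ≡.refl) (count-∉ xs (λ y∈xs → All.lookup x∉xs y∈xs ≡.refl))) (+-identityʳ _)
      count-∈ (x ∷ xs) (x∉xs ∷ xs!) (there y∈xs) =
        trans (+-cong (δ-≢ (λ { ≡.refl → All.lookup x∉xs y∈xs ≡.refl })) (count-∈ xs xs! y∈xs)) (+-identityˡ _)

      count-01 : ∀ xs → Unique xs → ∀ y → count xs y ≈ 0# ⊎ count xs y ≈ 1#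
      count-01 xs xs! y with y ∈ₗ? xs
      ... | yes y∈xs = inj₂ (count-∈ xs xs! y∈xs)
      ... | no  y∉xs = inj₁ (count-∉ xs y∉xs)

      δ-subst : ∀ (g : A → Carrier) x y → δ x y * g x ≈ δ x y * g y
      δ-subst g x y with x ≟ y
      ... | yes ≡.refl = refl
      ... | no _       = trans (zeroˡ _) (sym (zeroˡ _))

      δ-sym : ∀ x y → δ x y ≈ δ y x
      δ-sym x y with x ≟ y
      ... | yes ≡.refl = sym (δ-≡ ≡.refl)
      ... | no x≢y     = sym (δ-≢ (x≢y ∘ ≡.sym))

      -- Exchange of the double sum of `δ` over `xs` and `zs`. It allows sums over different finite
      -- sets to be compared term by term on a common larger set.
      ∑-count : ∀ {xs zs} → Unique zs → (∀ {x} → x ∈ₗ xs → x ∈ₗ zs) → (g : A → Carrier) →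
                ∑ zs (λ z → count xs z * g z) ≈ ∑ xs g
      ∑-count {xs} {zs} zs! xs⊆zs g =
        trans (∑-cong zs (λ z → trans (*-comm _ _) (trans (sym (∑-* xs (g z) (δ z)))
                (∑-cong xs (λ x → trans (*-comm _ _) (trans (δ-subst g z x)
                  (trans (*-comm _ _) (*-congˡ (δ-sym z x)))))))))
          (trans (∑-swap zs xs (λ z x → g x * δ x z))
            (∑-cong-∈ xs (λ {x} x∈xs → trans (∑-* zs (g x) (δ x))
              (trans (*-congˡ (count-∈ zs zs! (xs⊆zs x∈xs))) (*-identityʳ _)))))

      count*≤ : ∀ xs → Unique xs → ∀ {y a} → 0# ≤ a → count xs y * a ≤ a
      count*≤ xs xs! {y} 0≤a with count-01 xs xs! y
      ... | inj₁ ≈0 = ≤-respˡ (sym (trans (*-congʳ ≈0) (zeroˡ _))) 0≤a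
      ... | inj₂ ≈1 = ≤-reflexive (trans (*-congʳ ≈1) (*-identityˡ _))

      ∑-⊆ : ∀ {xs zs} → Unique xs → Unique zs → (∀ {x} → x ∈ₗ xs → x ∈ₗ zs) →
            {g : A → Carrier} → (∀ x → 0# ≤ g x) → ∑ xs g ≤ ∑ zs g
      ∑-⊆ {xs} {zs} xs! zs! xs⊆zs {g} 0≤g =
        ≤-respˡ (∑-count zs! xs⊆zs g) (∑-mono zs (λ z → count*≤ xs xs! (0≤g z)))

      union-! : ∀ xs ys → Unique (union xs ys)
      union-! xs ys = deduplicate-! _≟_ (xs ++ ys)

      union-⊆ˡ : ∀ xs ys {x} → x ∈ₗ xs → x ∈ₗ union xs ys
      union-⊆ˡ xs ys x∈ = ∈-deduplicate⁺ _≟_ (∈-++⁺ˡ x∈)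

      union-⊆ʳ : ∀ xs ys {x} → x ∈ₗ ys → x ∈ₗ union xs ys
      union-⊆ʳ xs ys x∈ = ∈-deduplicate⁺ _≟_ (∈-++⁺ʳ xs x∈)

      -- The near-optimal finite sets of the two summands differ; their union serves both, since
      -- non-negative sums do not drop on larger sets.
      HasSum-+ : ∀ {f g : A → Carrier} {s t} → (∀ x → 0# ≤ f x) → (∀ x → 0# ≤ g x) →
                 HasSum f s → HasSum g t → HasSum (λ x → f x + g x) (s + t)
      HasSum-+ {f} {g} {s} {t} 0≤f 0≤g (upper , approach) (upper′ , approach′) =
        (λ xs xs! → ≤-respˡ (sym (∑-+ xs f g)) (+-mono-≤ (upper xs xs!) (upper′ xs xs!))) ,
        (λ ε 0<ε →
          let η , 0<η , 2η<ε    = half 0<ε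
              xs , xs! , close  = approach η 0<η
              ys , ys! , close′ = approach′ η 0<η
              zs!               = union-! xs ys
          in  union xs ys , zs! ,
              <-≤-trans
                (+-mono-<-≤ (<-≤-trans close (+-mono-≤ (∑-⊆ xs! zs! (union-⊆ˡ xs ys) 0≤f) ≤-refl))
                            (<⇒≤ (<-≤-trans close′ (+-mono-≤ (∑-⊆ ys! zs! (union-⊆ʳ xs ys) 0≤g) ≤-refl))))
                (≤-respˡ (solve 3 (λ a b e → a :+ b :+ (e :+ e) := a :+ e :+ (b :+ e)) refl _ _ η)
                  (+-mono-≤ (≤-reflexive (sym (∑-+ (union xs ys) f g))) (<⇒≤ 2η<ε))))

      HasSum-∑ : ∀ {K : Set} (ks : List K) {f : K → A → Carrier} {s : K → Carrier} →
                 (∀ k x → 0# ≤ f k x) → (∀ k → HasSum (f k) (s k)) →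
                 HasSum (λ x → ∑ ks (λ k → f k x)) (∑ ks s)
      HasSum-∑ []       0≤f sums = HasSum-0
      HasSum-∑ (k ∷ ks) 0≤f sums =
        HasSum-+ (0≤f k) (λ x → ∑-nonNegative ks (λ j → 0≤f j x)) (sums k) (HasSum-∑ ks 0≤f sums)

  module _ {A B : Set} (_≟ᴬ_ : DecidableEquality A) (_≟ᴮ_ : DecidableEquality B) (π : B → A) where
    open Discrete _≟ᴬ_
    open Discrete _≟ᴮ_ using () renaming (union to unionᴮ; union-! to unionᴮ-!; union-⊆ˡ to unionᴮ-⊆ˡ; union-⊆ʳ to unionᴮ-⊆ʳ; ∑-⊆ to ∑ᴮ-⊆)

    abstract
      -- Tonelli along `π`, with the factor `δ (π b) a` encoding a fibre in place of a subtype. From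
      -- above, finitely many `b` meet finitely many fibres; from below, finitely many fibres
      -- already nearly exhaust `t`, and each of them is nearly exhausted in turn.
      HasSum-fibres : ∀ {f : B → Carrier} {s : A → Carrier} {t} → (∀ b → 0# ≤ f b) →
                      (∀ a → HasSum (λ b → δ (π b) a * f b) (s a)) → HasSum s t → HasSum f t
      HasSum-fibres {f} {s} {t} 0≤f fibre (upper , approach) = upper-f , approach-f
        where
        0≤δf : ∀ a b → 0# ≤ δ (π b) a * f b
        0≤δf a b = 0≤* (0≤δ (π b) a) (0≤f b)

        exchange : ∀ as bs → ∑ as (λ a → ∑ bs (λ b → δ (π b) a * f b)) ≈ ∑ bs (λ b → count as (π b) * f b)
        exchange as bs = trans (∑-swap as bs (λ a b → δ (π b) a * f b))
          (∑-cong bs (λ b → trans (∑-cong as (λ a → *-comm _ _))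
            (trans (∑-* as (f b) (δ (π b))) (*-comm _ _))))

        upper-f : ∀ bs → Unique bs → ∑ bs f ≤ t
        upper-f bs bs! = ≤-trans
          (≤-reflexive (sym (trans (exchange as bs) (∑-cong-∈ bs (λ b∈bs →
            trans (*-congʳ (count-∈ as as! (∈-deduplicate⁺ _≟ᴬ_ (∈-map⁺ π b∈bs)))) (*-identityˡ _))))))
          (≤-trans (∑-mono as (λ a → proj₁ (fibre a) bs bs!)) (upper as as!))
          where
          as : List A
          as = deduplicate _≟ᴬ_ (map π bs)
          as! : Unique as
          as! = deduplicate-! _≟ᴬ_ (map π bs)

        collect : ∀ as ε → 0# < ε → ∃[ bs ] Unique bs ×
                  ∑ as s < ∑ as (λ a → ∑ bs (λ b → δ (π b) a * f b)) + ε
        collect []       ε 0<ε = [] , [] , <-respʳ (sym (+-identityˡ ε)) 0<ε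
        collect (a ∷ as) ε 0<ε =
          let η , 0<η , 2η<ε    = half 0<ε
              xs , xs! , close  = proj₂ (fibre a) η 0<η
              ys , ys! , close′ = collect as η 0<η
              zs!               = unionᴮ-! xs ys
          in  unionᴮ xs ys , zs! ,
              <-≤-trans
                (+-mono-<-≤ (<-≤-trans close (+-mono-≤ (∑ᴮ-⊆ xs! zs! (unionᴮ-⊆ˡ xs ys) (0≤δf a)) ≤-refl))
                            (<⇒≤ (<-≤-trans close′ (+-mono-≤ (∑-mono as (λ a′ → ∑ᴮ-⊆ ys! zs! (unionᴮ-⊆ʳ xs ys) (0≤δf a′))) ≤-refl))))
                (≤-respˡ (solve 3 (λ a b e → a :+ b :+ (e :+ e) := a :+ e :+ (b :+ e)) refl _ _ η)
                  (+-mono-≤ ≤-refl (<⇒≤ 2η<ε)))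

        approach-f : ∀ ε → 0# < ε → ∃[ bs ] Unique bs × t < ∑ bs f + ε
        approach-f ε 0<ε =
          let η , 0<η , 2η<ε    = half 0<ε
              as , as! , close  = approach η 0<η
              bs , bs! , close′ = collect as η 0<η
              ∑≤ = ≤-respˡ (sym (exchange as bs)) (∑-mono bs (λ b → count*≤ as as! (0≤f b)))
          in  bs , bs! , <-≤-trans close (≤-trans
                (+-mono-≤ (≤-trans (<⇒≤ close′) (+-mono-≤ ∑≤ ≤-refl)) ≤-refl)
                (≤-respˡ (sym (+-assoc _ _ _)) (+-mono-≤ ≤-refl (<⇒≤ 2η<ε))))

-- Bounded functions and expectations as positive linear functionals.

module Expectation {c ℓ₁ ℓ₂} (ℝ : RealNumbers c ℓ₁ ℓ₂) where
  open RealNumbers ℝ hiding (zero)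
  open OrderedField ℝ
  open Summation ℝ
  open PartialRejectionSampling ℝ using (Distribution; pmf; nonNegative; total)

  abstract
    0≤x+x⇒0≤x : ∀ {x} → 0# ≤ x + x → 0# ≤ x
    0≤x+x⇒0≤x {x} 0≤2x x<0 = 0≤2x (<-respʳ (+-identityˡ 0#) (+-mono-<-≤ x<0 (<⇒≤ x<0)))

    -- Twice `b * d - x * y` equals `(b - x) * (y + d) + (x + b) * (d - y)`, a sum of non-negative
    -- products. Halving replaces a case split on signs.
    product-≤ : ∀ {x y b d} → x ≤ b → - b ≤ x → y ≤ d → - d ≤ y → x * y ≤ b * d
    product-≤ {x} {y} {b} {d} x≤b -b≤x y≤d -d≤y = by-≤ (0≤x+x⇒0≤x (≤-respʳ
      (solve 4 (λ x y b d → (b :- x) :* (y :- :- d) :+ (x :- :- b) :* (d :- y)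
                            := (b :* d :- x :* y) :+ (b :* d :- x :* y)) refl x y b d)
      (0≤+ (0≤* (x≤y⇒0≤y-x x≤b) (x≤y⇒0≤y-x -d≤y)) (0≤* (x≤y⇒0≤y-x -b≤x) (x≤y⇒0≤y-x y≤d))))) refl

    -product-≤ : ∀ {x y b d} → x ≤ b → - b ≤ x → y ≤ d → - d ≤ y → - (b * d) ≤ x * y
    -product-≤ {x} {y} {b} {d} x≤b -b≤x y≤d -d≤y = ≤-respʳ
      (solve 2 (λ x y → :- (:- x :* y) := x :* y) refl x y)
      (neg-≤ (product-≤ (≤-respʳ (solve 1 (λ b → :- :- b := b) refl b) (neg-≤ -b≤x)) (neg-≤ x≤b) y≤d -d≤y))

    x-y<e⇒x<y+e : ∀ {x y e} → x - y < e → x < y + e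
    x-y<e⇒x<y+e {x} {y} {e} x-y<e = by-< (x<y⇒0<y-x x-y<e)
      (solve 3 (λ x y e → y :+ e :- x := e :- (x :- y)) refl x y e)

    -- Made for a limit `e`, a term `y` of its sequence and an arbitrary partial sum `x`; `w` and
    -- `v` are the tail errors of `y` and `x`.
    limit-below : ∀ {e x y v w h ε} → e < y + h → y - x ≤ w + v → w ≤ h → h + h ≤ ε → e - x < v + ε
    limit-below {e} {x} {y} {v} {w} {h} {ε} p q r t =
      by-< (0<+ (x<y⇒0<y-x p) (0≤+ (x≤y⇒0≤y-x q) (0≤+ (x≤y⇒0≤y-x r) (x≤y⇒0≤y-x t))))
        (solve 7 (λ e x y v w h E → v :+ E :- (e :- x)
          := y :+ h :- e :+ ((w :+ v :- (y :- x)) :+ ((h :- w) :+ (E :- (h :+ h))))) refl e x y v w h ε)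

    limit-above : ∀ {e x y v w h ε} → y < e + h → x - y ≤ v + w → w ≤ h → h + h ≤ ε → x - e < v + ε
    limit-above {e} {x} {y} {v} {w} {h} {ε} p q r t =
      by-< (0<+ (x<y⇒0<y-x p) (0≤+ (x≤y⇒0≤y-x q) (0≤+ (x≤y⇒0≤y-x r) (x≤y⇒0≤y-x t))))
        (solve 7 (λ e x y v w h E → v :+ E :- (x :- e)
          := e :+ h :- y :+ ((v :+ w :- (x :- y)) :+ ((h :- w) :+ (E :- (h :+ h))))) refl e x y v w h ε)

    triangle : ∀ {x y z a b} → x - y ≤ a → y - z ≤ b → x - z ≤ a + b
    triangle {x} {y} {z} p q = ≤-respˡ
      (solve 3 (λ x y z → x :- y :+ (y :- z) := x :- z) refl x y z) (+-mono-≤ p q)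

    +-difference : ∀ {x y s t a b} → x - s ≤ a → y - t ≤ b → x + y - (s + t) ≤ a + b
    +-difference {x} {y} {s} {t} p q = ≤-respˡ
      (solve 4 (λ x y s t → x :- s :+ (y :- t) := x :+ y :- (s :+ t)) refl x y s t) (+-mono-≤ p q)

    *-difference : ∀ {z k x y a} → z ≤ k → - k ≤ z → x - y ≤ a → y - x ≤ a → z * x - z * y ≤ k * a
    *-difference {z} {k} {x} {y} p q r t = ≤-respˡ
      (solve 3 (λ z x y → z :* (x :- y) := z :* x :- z :* y) refl z x y)
      (product-≤ p q r (≤-respʳ (solve 2 (λ x y → :- (y :- x) := x :- y) refl x y) (neg-≤ t)))

    +-error : ∀ {x y k b w} → x - y ≤ b * w → b ≤ k → 0# ≤ w → x ≤ y + k * w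
    +-error {x} {y} {k} {b} {w} p q r = by-≤ (0≤+ (x≤y⇒0≤y-x p) (0≤* (x≤y⇒0≤y-x q) r))
      (solve 5 (λ x y k b w → y :+ k :* w :- x := (b :* w :- (x :- y)) :+ (k :- b) :* w) refl x y k b w)

    error-+ : ∀ {x y e} → x ≤ y + e → x - y ≤ e
    error-+ {x} {y} {e} p = by-≤ (x≤y⇒0≤y-x p)
      (solve 3 (λ x y e → e :- (x :- y) := y :+ e :- x) refl x y e)

    absolute-bound : ∀ x → ∃[ b ] 0# ≤ b × x ≤ b × - b ≤ x
    absolute-bound x =
      let b , 0<b , x<b   = upper-bound x
          d , 0<d , -x<d = upper-bound (- x)
      in  b + d , 0≤+ (<⇒≤ 0<b) (<⇒≤ 0<d) ,
          by-≤ (0≤+ (x≤y⇒0≤y-x (<⇒≤ x<b)) (<⇒≤ 0<d)) (solve 3 (λ x b d → b :+ d :- x := b :- x :+ d) refl x b d) ,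
          by-≤ (0≤+ (x≤y⇒0≤y-x (<⇒≤ -x<d)) (<⇒≤ 0<b)) (solve 3 (λ x b d → x :- :- (b :+ d) := d :- :- x :+ b) refl x b d)

  -- The bound is data because it controls the tails of infinite sums, and a least one could not be
  -- computed.
  record Bounded (A : Set) : Set (c ⊔ ℓ₂) where
    field
      at      : A → Carrier
      bound   : Carrier
      0≤bound : 0# ≤ bound
      upper   : ∀ a → at a ≤ bound
      lower   : ∀ a → - bound ≤ at a

  open Bounded public

  module _ {A : Set} where

    infixl 6 _+ᵇ_
    infixl 7 _*ᵇ_
    infix 8 -ᵇ_

    constᵇ : Carrier → Bounded A
    constᵇ x = let b , 0≤b , x≤b , -b≤x = absolute-bound x in record
      { at = λ _ → x ; bound = b ; 0≤bound = 0≤b ; upper = λ _ → x≤b ; lower = λ _ → -b≤x }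

    _+ᵇ_ : Bounded A → Bounded A → Bounded A
    f +ᵇ g = record
      { at      = λ a → at f a + at g a
      ; bound   = bound f + bound g
      ; 0≤bound = 0≤+ (0≤bound f) (0≤bound g)
      ; upper   = λ a → +-mono-≤ (upper f a) (upper g a)
      ; lower   = λ a → ≤-respˡ (solve 2 (λ x y → :- x :+ :- y := :- (x :+ y)) refl _ _)
                          (+-mono-≤ (lower f a) (lower g a))
      }

    _*ᵇ_ : Bounded A → Bounded A → Bounded A
    f *ᵇ g = record
      { at      = λ a → at f a * at g a
      ; bound   = bound f * bound g
      ; 0≤bound = 0≤* (0≤bound f) (0≤bound g)
      ; upper   = λ a → product-≤ (upper f a) (lower f a) (upper g a) (lower g a)
      ; lower   = λ a → -product-≤ (upper f a) (lower f a) (upper g a) (lower g a)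
      }

    -ᵇ_ : Bounded A → Bounded A
    -ᵇ f = record
      { at      = λ a → - at f a
      ; bound   = bound f
      ; 0≤bound = 0≤bound f
      ; upper   = λ a → ≤-respʳ (solve 1 (λ x → :- :- x := x) refl _) (neg-≤ (lower f a))
      ; lower   = λ a → neg-≤ (upper f a)
      }

    indicator : (A → Bool) → Bounded A
    indicator P = record
      { at      = λ a → if P a then 1# else 0#
      ; bound   = 1#
      ; 0≤bound = <⇒≤ 0<1
      ; upper   = λ a → upper-01 (P a)
      ; lower   = λ a → lower-01 (P a)
      }
      where
      upper-01 : ∀ b → (if b then 1# else 0#) ≤ 1#
      upper-01 true  = ≤-refl
      upper-01 false = <⇒≤ 0<1
      lower-01 : ∀ b → - 1# ≤ (if b then 1# else 0#)
      lower-01 true  = by-≤ (0≤+ (<⇒≤ 0<1) (<⇒≤ 0<1)) (solve 1 (λ x → x :- :- x := x :+ x) refl 1#)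
      lower-01 false = by-≤ (<⇒≤ 0<1) (solve 1 (λ x → con (+ 0) :- :- x := x) refl 1#)

  _∘ᵇ_ : ∀ {A B : Set} → Bounded B → (A → B) → Bounded A
  f ∘ᵇ g = record
    { at = at f ∘ g ; bound = bound f ; 0≤bound = 0≤bound f ; upper = upper f ∘ g ; lower = lower f ∘ g }

  -- The laws quantify over h because functions that agree pointwise may carry
  -- different bounds.
  record Mean (A : Set) : Set (c ⊔ ℓ₁ ⊔ ℓ₂) where
    field
      E      : Bounded A → Carrier
      E-mono : ∀ f g → (∀ a → at f a ≤ at g a) → E f ≤ E g
      E-+    : ∀ f g h → (∀ a → at h a ≈ at f a + at g a) → E h ≈ E f + E g
      E-*    : ∀ x f h → (∀ a → at h a ≈ x * at f a) → E h ≈ x * E f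
      E-1    : ∀ h → (∀ a → at h a ≈ 1#) → E h ≈ 1#

    E-cong : ∀ f g → (∀ a → at f a ≈ at g a) → E f ≈ E g
    E-cong f g f≈g = ≤-antisym (E-mono f g (≤-reflexive ∘ f≈g)) (E-mono g f (≤-reflexive ∘ sym ∘ f≈g))

    E-const : ∀ x h → (∀ a → at h a ≈ x) → E h ≈ x
    E-const x h h≈x = trans (E-* x (constᵇ 1#) h (λ a → trans (h≈x a) (sym (*-identityʳ x))))
      (trans (*-congˡ (E-1 (constᵇ 1#) (λ _ → refl))) (*-identityʳ x))

    E-upper : ∀ f {x} → (∀ a → at f a ≤ x) → E f ≤ x
    E-upper f {x} f≤x = ≤-respʳ (E-const x (constᵇ x) (λ _ → refl)) (E-mono f (constᵇ x) f≤x)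

    E-lower : ∀ f {x} → (∀ a → x ≤ at f a) → x ≤ E f
    E-lower f {x} x≤f = ≤-respˡ (E-const x (constᵇ x) (λ _ → refl)) (E-mono (constᵇ x) f x≤f)

  open Mean public

  marginal : ∀ {A B : Set} → (A → Mean B) → Bounded B → Bounded A
  marginal K f = record
    { at      = λ a → E (K a) f
    ; bound   = bound f
    ; 0≤bound = 0≤bound f
    ; upper   = λ a → E-upper (K a) f (upper f)
    ; lower   = λ a → E-lower (K a) f (lower f)
    }

  dirac : ∀ {A : Set} → A → Mean A
  dirac a = record
    { E      = λ f → at f a
    ; E-mono = λ f g f≤g → f≤g a
    ; E-+    = λ f g h eq → eq a
    ; E-*    = λ x f h eq → eq a
    ; E-1    = λ h eq → eq a
    }

  pushforward : ∀ {A B : Set} → (A → B) → Mean A → Mean B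
  pushforward t M = record
    { E      = λ f → E M (f ∘ᵇ t)
    ; E-mono = λ f g f≤g → E-mono M (f ∘ᵇ t) (g ∘ᵇ t) (f≤g ∘ t)
    ; E-+    = λ f g h eq → E-+ M (f ∘ᵇ t) (g ∘ᵇ t) (h ∘ᵇ t) (eq ∘ t)
    ; E-*    = λ x f h eq → E-* M x (f ∘ᵇ t) (h ∘ᵇ t) (eq ∘ t)
    ; E-1    = λ h eq → E-1 M (h ∘ᵇ t) (eq ∘ t)
    }

  bind : ∀ {A B : Set} → Mean A → (A → Mean B) → Mean B
  bind M K = record
    { E      = λ f → E M (marginal K f)
    ; E-mono = λ f g f≤g → E-mono M (marginal K f) (marginal K g) (λ a → E-mono (K a) f g f≤g)
    ; E-+    = λ f g h eq → E-+ M (marginal K f) (marginal K g) (marginal K h) (λ a → E-+ (K a) f g h eq)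
    ; E-*    = λ x f h eq → E-* M x (marginal K f) (marginal K h) (λ a → E-* (K a) x f h eq)
    ; E-1    = λ h eq → E-1 M (marginal K h) (λ a → E-1 (K a) h eq)
    }

  mixture : ∀ {A K : Set} (ks : List K) (p : K → Carrier) → (∀ k → 0# ≤ p k) → ∑ ks p ≈ 1# →
            (K → Mean A) → Mean A
  mixture ks p 0≤p total M = record
    { E      = λ f → ∑ ks (λ k → p k * E (M k) f)
    ; E-mono = λ f g f≤g → ∑-mono ks (λ k → *-monoˡ-≤ (0≤p k) (E-mono (M k) f g f≤g))
    ; E-+    = λ f g h eq → trans (∑-cong ks (λ k → trans (*-congˡ (E-+ (M k) f g h eq)) (distribˡ _ _ _)))
                 (∑-+ ks _ _)
    ; E-*    = λ x f h eq → trans (∑-cong ks (λ k → trans (*-congˡ (E-* (M k) x f h eq))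
                 (solve 3 (λ a b c → a :* (b :* c) := b :* (a :* c)) refl _ _ _))) (∑-* ks x _)
    ; E-1    = λ h eq → trans (∑-cong ks (λ k → trans (*-congˡ (E-1 (M k) h eq)) (*-identityʳ _))) total
    }

  -- The bridge from functionals to the sums in the theorem. It is restricted to non-negative
  -- functions because `HasSum` is a supremum of finite sums.
  Represents : ∀ {A : Set} → (A → Carrier) → Mean A → Set (c ⊔ ℓ₂)
  Represents w M = ∀ f → (∀ a → 0# ≤ at f a) → HasSum (λ a → w a * at f a) (E M f)

  abstract
    -- A mean applies only to functions that carry a bound, so the linear combination is returned as
    -- such a function `G` together with its values.
    E-∑ : ∀ {A B : Set} (M : Mean B) (xs : List A) (w : A → Carrier) (F : A → Bounded B) →
          Σ[ G ∈ Bounded B ] (∀ b → at G b ≈ ∑ xs (λ a → w a * at (F a) b)) ×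
                             E M G ≈ ∑ xs (λ a → w a * E M (F a))
    E-∑ M []       w F = constᵇ 0# , (λ _ → refl) , E-const M 0# (constᵇ 0#) (λ _ → refl)
    E-∑ M (x ∷ xs) w F =
      let G , eq , EG = E-∑ M xs w F
          H = constᵇ (w x) *ᵇ F x
      in  H +ᵇ G , (λ b → +-congˡ (eq b)) ,
          trans (E-+ M H G (H +ᵇ G) (λ _ → refl)) (+-cong (E-* M (w x) (F x) H (λ _ → refl)) EG)

  module FiniteSums {A : Set} (_≟_ : DecidableEquality A) (μ : Distribution A) where
    open Discrete _≟_

    W : List A → Carrier
    W xs = ∑ xs (pmf μ)

    S : List A → (A → Carrier) → Carrier
    S xs f = ∑ xs (λ a → pmf μ a * f a)

    abstract
      0≤1-W : ∀ xs → Unique xs → 0# ≤ 1# - W xs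
      0≤1-W xs xs! = x≤y⇒0≤y-x (proj₁ (total μ) xs xs!)

      -- The n-th set misses mass below `1 / (n + 1)`. The sets need not be nested, since
      -- `S-difference` compares arbitrary finite sets.
      exhaustion : Σ[ s ∈ (ℕ → List A) ] (∀ n → Unique (s n)) ×
                   (∀ ε → 0# < ε → ∃[ N ] (∀ n → N ℕ.≤ n → 1# - W (s n) < ε))
      exhaustion = (λ n → proj₁ (near n)) , (λ n → proj₁ (proj₂ (near n))) , small
        where
        reciprocal : ∀ n → ∃[ y ] 0# < y × suc n · 1# * y ≈ 1#
        reciprocal n = positive-inverse (0<suc n)
        near : ∀ n → ∃[ xs ] Unique xs × 1# < W xs + proj₁ (reciprocal n)
        near n = proj₂ (total μ) _ (proj₁ (proj₂ (reciprocal n)))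
        small : ∀ ε → 0# < ε → ∃[ N ] (∀ n → N ℕ.≤ n → 1# - W (proj₁ (near n)) < ε)
        small ε 0<ε =
          let N , vanish = reciprocals-vanish (λ n → proj₁ (reciprocal n)) (λ n → proj₂ (proj₂ (reciprocal n))) ε 0<ε
          in  N , λ n N≤n → <-trans (by-< (x<y⇒0<y-x (proj₂ (proj₂ (near n))))
                (solve 3 (λ o w y → y :- (o :- w) := w :+ y :- o) refl 1# (W (proj₁ (near n))) (proj₁ (reciprocal n)))) (vanish n N≤n)

      nearly-total : ∀ x ε → 0# < ε → ∃[ xs ] Unique xs × x * (1# - W xs) < ε
      nearly-total x ε 0<ε =
        let b , 0<b , x<b = upper-bound x
            η , 0<η , bη<ε = scale-down b 0<ε
            xs , xs! , close = proj₂ (total μ) η 0<η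
        in  xs , xs! , ≤-<-trans
              (≤-respˡ (*-comm _ _) (≤-respʳ (*-comm _ _) (*-monoˡ-≤ (0≤1-W xs xs!) (<⇒≤ x<b))))
              (≤-<-trans (*-monoˡ-≤ (<⇒≤ 0<b) (<⇒≤ (by-< (x<y⇒0<y-x close)
                (solve 3 (λ o w y → y :- (o :- w) := w :+ y :- o) refl 1# _ _)))) bη<ε)

      -- Finite sets can miss arbitrarily little mass, so an error proportional to the missing mass
      -- `1# - W xs` disappears.
      squeeze : ∀ {x y} z → (∀ xs → Unique xs → x - y ≤ z * (1# - W xs)) → x ≤ y
      squeeze {x} {y} z close = ≤-by-approximation λ ε 0<ε →
        let xs , xs! , small = nearly-total z ε 0<ε
        in  x-y<e⇒x<y+e (≤-<-trans (close xs xs!) small)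

      -- A point of the union lies in both lists, where its contributions cancel, or misses one of
      -- them, where it costs at most `b` times its mass. `slack` is the pointwise room in this
      -- estimate; the factorisation in `shape` shows it non-negative without splitting on
      -- membership, and `W zs` is at most 1.
      S-difference : ∀ f xs ys → Unique xs → Unique ys →
                     S xs (at f) - S ys (at f) ≤ bound f * (1# - W xs) + bound f * (1# - W ys)
      S-difference f xs ys xs! ys! = ≤-trans
        (by-≤ (≤-respʳ total-slack (∑-nonNegative zs slack≥0)) refl)
        (+-mono-≤ (*-monoˡ-≤ (0≤bound f) (+-mono-≤ (proj₁ (total μ) zs zs!) ≤-refl))
                  (*-monoˡ-≤ (0≤bound f) (+-mono-≤ (proj₁ (total μ) zs zs!) ≤-refl)))
        where
        b : Carrier
        b = bound f
        zs : List A
        zs = union xs ys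
        zs! : Unique zs
        zs! = union-! xs ys
        slack : A → Carrier
        slack z = b * (pmf μ z - count xs z * pmf μ z) + b * (pmf μ z - count ys z * pmf μ z)
                  - (count xs z * (pmf μ z * at f z) - count ys z * (pmf μ z * at f z))
        shape : ∀ w v i j → b * (w - i * w) + b * (w - j * w) - (i * (w * v) - j * (w * v))
                ≈ w * ((b - v) * (1# - j) + (b - - v) * (1# - i) + (b * 0#) )
        shape = solve 5 (λ b w v i j → b :* (w :- i :* w) :+ b :* (w :- j :* w) :- (i :* (w :* v) :- j :* (w :* v))
                 := w :* ((b :- v) :* (con (+ 1) :- j) :+ (b :- :- v) :* (con (+ 1) :- i) :+ b :* con (+ 0))) refl b
        0≤1-count : ∀ us → Unique us → ∀ z → 0# ≤ 1# - count us z
        0≤1-count us us! z = x≤y⇒0≤y-x (≤-respˡ (*-identityʳ _) (count*≤ us us! (<⇒≤ 0<1)))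
        slack≥0 : ∀ z → 0# ≤ slack z
        slack≥0 z = ≤-respʳ (sym (shape (pmf μ z) (at f z) (count xs z) (count ys z)))
          (0≤* (nonNegative μ z) (0≤+ (0≤+
            (0≤* (x≤y⇒0≤y-x (upper f z)) (0≤1-count ys ys! z))
            (0≤* (x≤y⇒0≤y-x (≤-respʳ (solve 1 (λ x → :- :- x := x) refl b) (neg-≤ (lower f z)))) (0≤1-count xs xs! z)))
            (≤-reflexive (sym (zeroʳ b)))))
        total-slack : ∑ zs slack ≈ b * (W zs - W xs) + b * (W zs - W ys) - (S xs (at f) - S ys (at f))
        total-slack = trans
          (trans (∑-cong zs (λ z → solve 6 (λ b w cx cy wx wy →
              b :* (w :- cx) :+ b :* (w :- cy) :- (wx :- wy)
              := b :* w :+ b :* w :+ (:- b :* cx :+ :- b :* cy :+ (con (+ 0) :- con (+ 1)) :* wx :+ wy))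
              refl b _ _ _ _ _))
            (trans (∑-+ zs _ _) (+-cong (∑-+ zs _ _)
              (trans (∑-+ zs _ _) (+-congʳ (trans (∑-+ zs _ _) (+-congʳ (∑-+ zs _ _))))))))
          (trans
            (+-cong (+-cong (∑-* zs b _) (∑-* zs b _))
              (+-cong (+-cong (+-cong (trans (∑-* zs _ _) (*-congˡ (∑-count zs! (union-⊆ˡ xs ys) (pmf μ))))
                                      (trans (∑-* zs _ _) (*-congˡ (∑-count zs! (union-⊆ʳ xs ys) (pmf μ)))))
                              (trans (∑-* zs _ _) (*-congˡ (∑-count zs! (union-⊆ˡ xs ys) (λ z → pmf μ z * at f z)))))
                      (∑-count zs! (union-⊆ʳ xs ys) (λ z → pmf μ z * at f z))))
            (solve 6 (λ b w cx cy wx wy →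
              b :* w :+ b :* w :+ (:- b :* cx :+ :- b :* cy :+ (con (+ 0) :- con (+ 1)) :* wx :+ wy)
              := b :* (w :- cx) :+ b :* (w :- cy) :- (wx :- wy))
              refl b _ _ _ _ _))

  module Limit {A : Set} (_≟_ : DecidableEquality A) (μ : Distribution A) where
    open FiniteSums _≟_ μ

    abstract
      -- The estimate is stated for every finite set, not only for those of the exhaustion. It thus
      -- determines `e` independently of the chosen sequence, and the later laws start from it
      -- alone.
      expectation : ∀ f → ∃[ e ] (∀ xs → Unique xs →
        e - S xs (at f) ≤ bound f * (1# - W xs) × S xs (at f) - e ≤ bound f * (1# - W xs))
      expectation f = e , λ xs xs! → below xs xs! , above xs xs!
        where
        b : Carrier
        b = bound f
        s : ℕ → List A
        s = proj₁ exhaustion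
        s! : ∀ n → Unique (s n)
        s! = proj₁ (proj₂ exhaustion)
        s-exhausts : ∀ ε → 0# < ε → ∃[ N ] (∀ n → N ℕ.≤ n → 1# - W (s n) < ε)
        s-exhausts = proj₂ (proj₂ exhaustion)
        slack-small : ∀ ε → 0# < ε → ∃[ N ] (∀ n → N ℕ.≤ n → b * (1# - W (s n)) < ε)
        slack-small ε 0<ε =
          let η , 0<η , bη<ε = scale-down b 0<ε
              N , small = s-exhausts η 0<η
          in  N , λ n N≤n → ≤-<-trans (*-monoˡ-≤ (0≤bound f) (<⇒≤ (small n N≤n))) bη<ε
        cauchy : Cauchy (λ n → S (s n) (at f))
        cauchy ε 0<ε =
          let η , 0<η , 2η<ε = half 0<ε
              N , small = slack-small η 0<η
          in  N , λ i j N≤i N≤j → x-y<e⇒x<y+e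
                (≤-<-trans (S-difference f (s i) (s j) (s! i) (s! j))
                  (<-trans (+-mono-<-≤ (small i N≤i) (<⇒≤ (small j N≤j))) 2η<ε))
        limit : ∃[ l ] (λ n → S (s n) (at f)) ⟶ l
        limit = complete (λ n → S (s n) (at f)) cauchy
        e : Carrier
        e = proj₁ limit
        converges : (λ n → S (s n) (at f)) ⟶ e
        converges = proj₂ limit
        approximant : ∀ ε → 0# < ε → ∃[ n ] (S (s n) (at f) < e + ε × e < S (s n) (at f) + ε) ×
                      b * (1# - W (s n)) < ε
        approximant ε 0<ε =
          let M , near  = converges ε 0<ε
              N , small = slack-small ε 0<ε
          in  M ℕ.+ N , near _ (ℕ.m≤m+n M N) , small _ (ℕ.m≤n+m N M)
        below : ∀ xs → Unique xs → e - S xs (at f) ≤ b * (1# - W xs)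
        below xs xs! = ≤-by-approximation λ ε 0<ε →
          let η , 0<η , 2η<ε = half 0<ε
              n , (_ , e<) , small = approximant η 0<η
          in  limit-below e< (S-difference f (s n) xs (s! n) xs!) (<⇒≤ small) (<⇒≤ 2η<ε)
        above : ∀ xs → Unique xs → S xs (at f) - e ≤ b * (1# - W xs)
        above xs xs! = ≤-by-approximation λ ε 0<ε →
          let η , 0<η , 2η<ε = half 0<ε
              n , (<e , _) , small = approximant η 0<η
          in  limit-above <e (S-difference f xs (s n) xs! (s! n)) (<⇒≤ small) (<⇒≤ 2η<ε)

      𝔼 : Bounded A → Carrier
      𝔼 f = proj₁ (expectation f)

      𝔼-S : ∀ f xs → Unique xs → 𝔼 f - S xs (at f) ≤ bound f * (1# - W xs)
      𝔼-S f xs xs! = proj₁ (proj₂ (expectation f) xs xs!)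

      S-𝔼 : ∀ f xs → Unique xs → S xs (at f) - 𝔼 f ≤ bound f * (1# - W xs)
      S-𝔼 f xs xs! = proj₂ (proj₂ (expectation f) xs xs!)

  module Discretely {A : Set} (_≟_ : DecidableEquality A) (μ : Distribution A) where
    open Discrete _≟_
    open FiniteSums _≟_ μ
    open Limit _≟_ μ

    abstract
      S-mono : ∀ xs {f g : A → Carrier} → (∀ a → f a ≤ g a) → S xs f ≤ S xs g
      S-mono xs f≤g = ∑-mono xs (λ a → *-monoˡ-≤ (nonNegative μ a) (f≤g a))

      S-+ : ∀ xs {f g h : A → Carrier} → (∀ a → h a ≈ f a + g a) → S xs h ≈ S xs f + S xs g
      S-+ xs eq = trans (∑-cong xs (λ a → trans (*-congˡ (eq a)) (distribˡ _ _ _))) (∑-+ xs _ _)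

      S-* : ∀ xs x {f h : A → Carrier} → (∀ a → h a ≈ x * f a) → S xs h ≈ x * S xs f
      S-* xs x eq = trans (∑-cong xs (λ a → trans (*-congˡ (eq a))
        (solve 3 (λ a b c → a :* (b :* c) := b :* (a :* c)) refl _ _ _))) (∑-* xs x _)

      squeeze-+ : ∀ {x y} a b → (∀ xs → Unique xs → x - y ≤ a * (1# - W xs) + b * (1# - W xs)) → x ≤ y
      squeeze-+ a b close = squeeze (a + b) (λ xs xs! → ≤-respʳ (sym (distribʳ _ a b)) (close xs xs!))

      -- The pattern of all the laws here: replace each expectation by a sum over the same finite
      -- set, where the law is finite algebra, and squeeze out the error proportional to the missing
      -- mass.
      𝔼-mono : ∀ f g → (∀ a → at f a ≤ at g a) → 𝔼 f ≤ 𝔼 g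
      𝔼-mono f g f≤g = squeeze-+ (bound f) (bound g) λ xs xs! →
        triangle (𝔼-S′ xs xs!) (S-𝔼 g xs xs!)
        where
        𝔼-S′ : ∀ xs → Unique xs → 𝔼 f - S xs (at g) ≤ bound f * (1# - W xs)
        𝔼-S′ xs xs! = ≤-trans (+-mono-≤ ≤-refl (neg-≤ (S-mono xs f≤g))) (𝔼-S f xs xs!)

      𝔼-+ : ∀ f g h → (∀ a → at h a ≈ at f a + at g a) → 𝔼 h ≈ 𝔼 f + 𝔼 g
      𝔼-+ f g h eq = ≤-antisym
        (squeeze-+ (bound h) (bound f + bound g) λ xs xs! →
          triangle (𝔼-S h xs xs!) (≤-respˡ (+-congʳ (sym (S-+ xs eq)))
            (≤-respʳ (sym (distribʳ _ _ _)) (+-difference (S-𝔼 f xs xs!) (S-𝔼 g xs xs!)))))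
        (squeeze-+ (bound f + bound g) (bound h) λ xs xs! →
          triangle (≤-respˡ (+-congˡ (-‿cong (sym (S-+ xs eq))))
            (≤-respʳ (sym (distribʳ _ _ _)) (+-difference (𝔼-S f xs xs!) (𝔼-S g xs xs!)))) (S-𝔼 h xs xs!))

      𝔼-* : ∀ x f h → (∀ a → at h a ≈ x * at f a) → 𝔼 h ≈ x * 𝔼 f
      𝔼-* x f h eq =
        let k , _ , x≤k , -k≤x = absolute-bound x
        in ≤-antisym
        (squeeze-+ (bound h) (k * bound f) λ xs xs! →
          triangle (𝔼-S h xs xs!) (≤-respˡ (+-congʳ (sym (S-* xs x eq)))
            (≤-respʳ (sym (*-assoc _ _ _)) (*-difference x≤k -k≤x (S-𝔼 f xs xs!) (𝔼-S f xs xs!)))))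
        (squeeze-+ (k * bound f) (bound h) λ xs xs! →
          triangle (≤-respˡ (+-congˡ (-‿cong (sym (S-* xs x eq))))
            (≤-respʳ (sym (*-assoc _ _ _)) (*-difference x≤k -k≤x (𝔼-S f xs xs!) (S-𝔼 f xs xs!)))) (S-𝔼 h xs xs!))

      𝔼-1 : ∀ h → (∀ a → at h a ≈ 1#) → 𝔼 h ≈ 1#
      𝔼-1 h eq = ≤-antisym
        (squeeze (bound h) λ xs xs! → ≤-trans (+-mono-≤ ≤-refl (neg-≤ (S≤1 xs xs!))) (𝔼-S h xs xs!))
        (squeeze-+ 1# (bound h) λ xs xs! →
          triangle (≤-reflexive (trans (+-congˡ (-‿cong (S≈W xs))) (sym (*-identityˡ _)))) (S-𝔼 h xs xs!))
        where
        S≈W : ∀ xs → S xs (at h) ≈ W xs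
        S≈W xs = ∑-cong xs (λ a → trans (*-congˡ (eq a)) (*-identityʳ _))
        S≤1 : ∀ xs → Unique xs → S xs (at h) ≤ 1#
        S≤1 xs xs! = ≤-respˡ (sym (S≈W xs)) (proj₁ (total μ) xs xs!)

    mean : Mean A
    mean = record { E = 𝔼 ; E-mono = 𝔼-mono ; E-+ = 𝔼-+ ; E-* = 𝔼-* ; E-1 = 𝔼-1 }

    abstract
      -- For `f` non-negative, a partial sum is at most the one on a larger set that misses little
      -- mass, and the latter is close to `𝔼 f`.
      mean-represents : Represents (pmf μ) mean
      mean-represents f 0≤f = upper-S , approach
        where
        upper-S : ∀ xs → Unique xs → S xs (at f) ≤ 𝔼 f
        upper-S xs xs! = ≤-by-approximation λ ε 0<ε →
          let ys , ys! , small = nearly-total (bound f) ε 0<ε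
              zs   = union xs ys
              zs!  = union-! xs ys
              S≤S  = ∑-⊆ xs! zs! (union-⊆ˡ xs ys) (λ a → 0≤* (nonNegative μ a) (0≤f a))
              W≤W  = ∑-⊆ ys! zs! (union-⊆ʳ xs ys) (nonNegative μ)
          in  x-y<e⇒x<y+e (≤-<-trans (+-mono-≤ S≤S ≤-refl) (≤-<-trans (S-𝔼 f zs zs!)
                (≤-<-trans (*-monoˡ-≤ (0≤bound f) (+-mono-≤ ≤-refl (neg-≤ W≤W))) small)))

        approach : ∀ ε → 0# < ε → ∃[ xs ] Unique xs × 𝔼 f < S xs (at f) + ε
        approach ε 0<ε =
          let xs , xs! , small = nearly-total (bound f) ε 0<ε
          in  xs , xs! , x-y<e⇒x<y+e (≤-<-trans (𝔼-S f xs xs!) small)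

      -- Finite sums over `A` commute with `M` by linearity. The uniform bound `k` makes the
      -- truncation error independent of `b`, so it passes through `E M`.
      fubini : ∀ {B : Set} (M : Mean B) (f : A → Bounded B) (g : B → Bounded A) →
               (∀ a b → at (f a) b ≈ at (g b) a) → (Ef : Bounded A) (Eg : Bounded B) →
               (∀ a → at Ef a ≈ E M (f a)) → (∀ b → at Eg b ≈ 𝔼 (g b)) →
               (k : Carrier) → (∀ b → bound (g b) ≤ k) → 𝔼 Ef ≈ E M Eg
      fubini {B} M f g f≈g Ef Eg Ef≈ Eg≈ k ≤k = ≤-antisym
        (squeeze-+ (bound Ef) k λ xs xs! →
          triangle (𝔼-S Ef xs xs!) (≤-respˡ (+-congʳ (sym (SEf≈EG xs)))
            (E-close (G xs) Eg _ (λ b → +-error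
              (≤-respˡ (+-cong (sym (G≈S xs b)) (-‿cong (sym (Eg≈ b)))) (S-𝔼 (g b) xs xs!)) (≤k b) (0≤1-W xs xs!)))))
        (squeeze-+ k (bound Ef) λ xs xs! →
          triangle (≤-respˡ (+-congˡ (-‿cong (sym (SEf≈EG xs))))
            (E-close Eg (G xs) _ (λ b → +-error
              (≤-respˡ (+-cong (sym (Eg≈ b)) (-‿cong (sym (G≈S xs b)))) (𝔼-S (g b) xs xs!)) (≤k b) (0≤1-W xs xs!))))
            (S-𝔼 Ef xs xs!))
        where
        G : List A → Bounded B
        G xs = proj₁ (E-∑ M xs (pmf μ) f)
        G≈S : ∀ xs b → at (G xs) b ≈ S xs (at (g b))
        G≈S xs b = trans (proj₁ (proj₂ (E-∑ M xs (pmf μ) f)) b) (∑-cong xs (λ a → *-congˡ (f≈g a b)))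
        SEf≈EG : ∀ xs → S xs (at Ef) ≈ E M (G xs)
        SEf≈EG xs = trans (∑-cong xs (λ a → *-congˡ (Ef≈ a))) (sym (proj₂ (proj₂ (E-∑ M xs (pmf μ) f))))
        E-close : ∀ (u v : Bounded B) e → (∀ b → at u b ≤ at v b + e) → E M u - E M v ≤ e
        E-close u v e close = error-+ (≤-respʳ
          (trans (E-+ M v (constᵇ e) (v +ᵇ constᵇ e) (λ _ → refl)) (+-congˡ (E-const M e (constᵇ e) (λ _ → refl))))
          (E-mono M u (v +ᵇ constᵇ e) close))

-- Finite sets of variables and downward induction on them.

Disjoint : ∀ {n} → Subset n → Subset n → Set
Disjoint S T = ∀ {i} → i ∈ S → i ∉ T

module SubsetLemmas {n : ℕ} where

  ∪-absorb : {S U : Subset n} → S ⊆ U → U ∪ S ≡ U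
  ∪-absorb {S} {U} S⊆U = ⊆-antisym (λ i∈ → [ id , S⊆U ]′ (x∈p∪q⁻ U S i∈)) (p⊆p∪q S)

  ∪-complement : (U : Subset n) → U ∪ ∁ U ≡ ⊤
  ∪-complement U = ⊆-antisym ⊆⊤ (λ {i} _ → x∈p∪q⁺ (split i))
    where
    split : ∀ i → i ∈ U ⊎ i ∈ ∁ U
    split i with i ∈? U
    ... | yes i∈U = inj₁ i∈U
    ... | no  i∉U = inj₂ (x∉p⇒x∈∁p i∉U)

  ∩-split : (U S : Subset n) → (U ∩ S) ∪ (U ∩ ∁ S) ≡ U
  ∩-split U S = ⊆-antisym
    (λ i∈ → [ proj₁ ∘ x∈p∩q⁻ U S , proj₁ ∘ x∈p∩q⁻ U (∁ S) ]′ (x∈p∪q⁻ (U ∩ S) (U ∩ ∁ S) i∈))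
    (λ {i} i∈U → x∈p∪q⁺ (split i i∈U))
    where
    split : ∀ i → i ∈ U → i ∈ U ∩ S ⊎ i ∈ U ∩ ∁ S
    split i i∈U with i ∈? S
    ... | yes i∈S = inj₁ (x∈p∩q⁺ (i∈U , i∈S))
    ... | no  i∉S = inj₂ (x∈p∩q⁺ (i∈U , x∉p⇒x∈∁p i∉S))

  ∪-least : {S T U : Subset n} → S ⊆ U → T ⊆ U → S ∪ T ⊆ U
  ∪-least {S} {T} S⊆U T⊆U i∈ = [ S⊆U , T⊆U ]′ (x∈p∪q⁻ S T i∈)

  Disjoint-∪ : {V S T : Subset n} → Disjoint V S → Disjoint V T → Disjoint V (S ∪ T)
  Disjoint-∪ {V} {S} {T} dS dT i∈V i∈ = [ dS i∈V , dT i∈V ]′ (x∈p∪q⁻ S T i∈)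

  Disjoint-sym : {S T : Subset n} → Disjoint S T → Disjoint T S
  Disjoint-sym d i∈T i∈S = d i∈S i∈T

open SubsetLemmas

-- The subsets enter K one at a time, each after all of its proper supersets.
superset-first : ∀ {n p} (P : (Subset n → Set) → Set p) →
  (∀ K K′ → (∀ U → K U → K′ U) → P K → P K′) →
  (∀ K U → (∀ V → U ⊆ V → V ⊈ U → K V) → P (λ V → K V ⊎ V ≡ U) → P K) →
  P (λ _ → Unit) → P (λ V → V ≢ V)
superset-first {zero} P mono step all =
  step _ [] (λ { [] _ V⊈U → λ _ → V⊈U id }) (mono _ _ (λ { [] _ → inj₂ ≡.refl }) all)
superset-first {suc n} P mono step all =
  mono (K₁ (λ V → V ≢ V)) (λ V → V ≢ V)
    (λ { (inside ∷ _) V≢V _ → V≢V ≡.refl ; (outside ∷ _) V≢V _ → V≢V ≡.refl })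
    (superset-first (λ K → P (K₁ K)) mono₁ step₁
      (mono (K₂ (λ V → V ≢ V)) (K₁ (λ _ → Unit)) (λ { (inside ∷ _) _ → tt ; (outside ∷ _) V≢V → V≢V })
        (superset-first (λ K → P (K₂ K)) mono₂ step₂
          (mono (λ _ → Unit) (K₂ (λ _ → Unit)) (λ { (inside ∷ _) _ → tt ; (outside ∷ _) _ → tt }) all))))
  where
  -- Two phases: under `K₁` the sets containing the first element enter, and under `K₂` these are
  -- all present while the remaining ones enter. `V ≢ V` encodes the empty predicate.
  K₁ K₂ : (Subset n → Set) → Subset (suc n) → Set
  K₁ K (inside  ∷ V) = K V
  K₁ K (outside ∷ V) = V ≢ V
  K₂ K (inside  ∷ V) = Unit
  K₂ K (outside ∷ V) = K V
  mono₁ : ∀ K K′ → (∀ U → K U → K′ U) → P (K₁ K) → P (K₁ K′)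
  mono₁ K K′ sub = mono (K₁ K) (K₁ K′) (λ { (inside ∷ V) → sub V ; (outside ∷ _) → id })
  mono₂ : ∀ K K′ → (∀ U → K U → K′ U) → P (K₂ K) → P (K₂ K′)
  mono₂ K K′ sub = mono (K₂ K) (K₂ K′) (λ { (inside ∷ _) → id ; (outside ∷ V) → sub V })
  step₁ : ∀ K U → (∀ V → U ⊆ V → V ⊈ U → K V) → P (K₁ (λ V → K V ⊎ V ≡ U)) → P (K₁ K)
  step₁ K U above p = step (K₁ K) (inside ∷ U)
    (λ { (inside ∷ V) U⊆V V⊈U → above V (drop-∷-⊆ U⊆V) (V⊈U ∘ in⊆in)
       ; (outside ∷ V) U⊆V V⊈U → contradiction (U⊆V Vec.here) λ() })
    (mono (K₁ (λ V → K V ⊎ V ≡ U)) (λ V → K₁ K V ⊎ V ≡ inside ∷ U)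
      (λ { (inside ∷ _) (inj₁ k) → inj₁ k ; (inside ∷ _) (inj₂ ≡.refl) → inj₂ ≡.refl
         ; (outside ∷ _) k → inj₁ k }) p)
  step₂ : ∀ K U → (∀ V → U ⊆ V → V ⊈ U → K V) → P (K₂ (λ V → K V ⊎ V ≡ U)) → P (K₂ K)
  step₂ K U above p = step (K₂ K) (outside ∷ U)
    (λ { (inside ∷ V) _ _ → tt
       ; (outside ∷ V) U⊆V V⊈U → above V (drop-∷-⊆ U⊆V) (V⊈U ∘ out⊆) })
    (mono (K₂ (λ V → K V ⊎ V ≡ U)) (λ V → K₂ K V ⊎ V ≡ outside ∷ U)
      (λ { (inside ∷ _) k → inj₁ k
         ; (outside ∷ _) (inj₁ k) → inj₁ k ; (outside ∷ _) (inj₂ ≡.refl) → inj₂ ≡.refl }) p)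

-- Averaging operators on a commutative ring.

record Averaging {c ℓ} (𝓑 : CommutativeRing c ℓ) (n : ℕ) : Set (c ⊔ ℓ) where
  open CommutativeRing 𝓑
  field
    E      : Subset n → Carrier → Carrier
    E-cong : ∀ S {f g} → f ≈ g → E S f ≈ E S g
    E-+    : ∀ S f g → E S (f + g) ≈ E S f + E S g
    E-∪    : ∀ S T f → E S (E T f) ≈ E (S ∪ T) f
    E-⊥    : ∀ f → E ⊥ f ≈ f
    -- Taking out what is known: an element fixed by `E S` does not depend on the variables in `S`
    -- and acts as a scalar for `E S`.
    E-pull : ∀ S {f} g → E S f ≈ f → E S (f * g) ≈ f * E S g
    E-1    : ∀ S → E S 1# ≈ 1#

module AveragingProperties {c ℓ} (𝓑 : CommutativeRing c ℓ) {n} (avg : Averaging 𝓑 n) where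
  open CommutativeRing 𝓑
  open RingSolver 𝓑
  open Averaging avg

  -- Dependence on the variables in `S` only, expressed through averages because ring elements have
  -- no arguments.
  Local : Subset n → Carrier → Set ℓ
  Local S f = ∀ V → Disjoint V S → E V f ≈ f

  E-0 : ∀ S → E S 0# ≈ 0#
  E-0 S = begin
    E S 0#                      ≈⟨ solve 1 (λ x → x := x :+ x :- x) refl (E S 0#) ⟩
    E S 0# + E S 0# - E S 0#    ≈⟨ +-congʳ (E-+ S 0# 0#) ⟨
    E S (0# + 0#) - E S 0#      ≈⟨ +-congʳ (E-cong S (+-identityˡ 0#)) ⟩
    E S 0# - E S 0#             ≈⟨ -‿inverseʳ _ ⟩
    0#                          ∎
    where open import Relation.Binary.Reasoning.Setoid setoid

  E-neg : ∀ S f → E S (- f) ≈ - E S f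
  E-neg S f = begin
    E S (- f)                        ≈⟨ solve 2 (λ x y → x := x :+ y :- y) refl (E S (- f)) (E S f) ⟩
    E S (- f) + E S f - E S f        ≈⟨ +-congʳ (E-+ S (- f) f) ⟨
    E S (- f + f) - E S f            ≈⟨ +-congʳ (trans (E-cong S (-‿inverseˡ f)) (E-0 S)) ⟩
    0# - E S f                       ≈⟨ +-identityˡ _ ⟩
    - E S f                          ∎
    where open import Relation.Binary.Reasoning.Setoid setoid

  E-minus : ∀ S f g → E S (f - g) ≈ E S f - E S g
  E-minus S f g = trans (E-+ S f (- g)) (+-congˡ (E-neg S g))

  E-≡ : ∀ {S T} f → S ≡ T → E S f ≈ E T f
  E-≡ f ≡.refl = refl

  E-absorb : ∀ {S U} f → S ⊆ U → E U (E S f) ≈ E U f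
  E-absorb f S⊆U = trans (E-∪ _ _ f) (E-≡ f (∪-absorb S⊆U))

  E-absorb′ : ∀ {S U} f → S ⊆ U → E S (E U f) ≈ E U f
  E-absorb′ {S} {U} f S⊆U = trans (E-∪ _ _ f) (E-≡ f (≡.trans (∪-comm S U) (∪-absorb S⊆U)))

  E-idem : ∀ S f → E S (E S f) ≈ E S f
  E-idem S f = E-absorb f id

  Local-1 : ∀ S → Local S 1#
  Local-1 S V _ = E-1 V

  Local-* : ∀ {S f g} → Local S f → Local S g → Local S (f * g)
  Local-* f-loc g-loc V d = trans (E-pull V _ (f-loc V d)) (*-congˡ (g-loc V d))

  Local-⊆ : ∀ {S T f} → S ⊆ T → Local S f → Local T f
  Local-⊆ S⊆T f-loc V d = f-loc V (λ i∈V i∈S → d i∈V (S⊆T i∈S))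

  E-local : ∀ {S U} f → Local S f → S ⊆ U → E U f ≈ E ⊤ f
  E-local {S} {U} f f-loc S⊆U = begin
    E U f              ≈⟨ E-cong U (f-loc (∁ U) (λ i∈∁U i∈S → x∈∁p⇒x∉p i∈∁U (S⊆U i∈S))) ⟨
    E U (E (∁ U) f)    ≈⟨ E-∪ U (∁ U) f ⟩
    E (U ∪ ∁ U) f      ≈⟨ E-≡ f (∪-complement U) ⟩
    E ⊤ f              ∎
    where open import Relation.Binary.Reasoning.Setoid setoid

  E-⊤-invariant : ∀ U f → E U (E ⊤ f) ≈ E ⊤ f
  E-⊤-invariant U f = E-absorb′ f ⊆⊤

  -- `f` depends only on `S` and `g` only on the complement. Averaging `U` in two stages, `E O`
  -- takes out `f` and `E I` then takes out `E O g`.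
  E-independent : ∀ {S} U {f g} → Local S f → E S g ≈ g → E U (f * g) ≈ E U f * E U g
  E-independent {S} U {f} {g} f-loc g-inv = begin
    E U (f * g)              ≈⟨ E-split (f * g) ⟨
    E I (E O (f * g))        ≈⟨ E-cong I (E-pull O g f-O) ⟩
    E I (f * E O g)          ≈⟨ E-cong I (*-comm _ _) ⟩
    E I (E O g * f)          ≈⟨ E-pull I f g-I ⟩
    E O g * E I f            ≈⟨ *-comm _ _ ⟩
    E I f * E O g            ≈⟨ *-cong (E-cong I f-O) g-I ⟨
    E I (E O f) * E I (E O g)  ≈⟨ *-cong (E-split f) (E-split g) ⟩
    E U f * E U g            ∎
    where
    open import Relation.Binary.Reasoning.Setoid setoid
    I O : Subset n
    I = U ∩ S
    O = U ∩ ∁ S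
    E-split : ∀ h → E I (E O h) ≈ E U h
    E-split h = trans (E-∪ I O h) (E-≡ h (∩-split U S))
    f-O : E O f ≈ f
    f-O = f-loc O (λ i∈O → x∈∁p⇒x∉p (proj₂ (x∈p∩q⁻ U (∁ S) i∈O)))
    I⊆S : I ⊆ S
    I⊆S i∈I = proj₂ (x∈p∩q⁻ U S i∈I)
    g-I : E I (E O g) ≈ E O g
    g-I = begin
      E I (E O g)              ≈⟨ E-∪ I O g ⟩
      E (I ∪ O) g              ≈⟨ E-≡ g (∪-comm I O) ⟩
      E (O ∪ I) g              ≈⟨ E-∪ O I g ⟨
      E O (E I g)              ≈⟨ E-cong O (E-cong I g-inv) ⟨
      E O (E I (E S g))        ≈⟨ E-cong O (E-absorb′ g I⊆S) ⟩
      E O (E S g)              ≈⟨ E-cong O g-inv ⟩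
      E O g                    ∎

-- The clause operator, its inversion and the potential.

record Clauses {c ℓ} (𝓑 : CommutativeRing c ℓ) {n} (avg : Averaging 𝓑 n) (m : ℕ) : Set (c ⊔ ℓ) where
  open CommutativeRing 𝓑 hiding (zero)
  open AveragingProperties 𝓑 avg using (Local)
  field
    A          : Fin m → Carrier
    scope      : Fin m → Subset n
    A-local    : ∀ l → Local (scope l) (A l)
    A-idem     : ∀ l → A l * A l ≈ A l
    -- Extremality: two adjacent clauses are never violated together.
    A-adjacent : ∀ k l → k ≢ l → Nonempty (scope k ∩ scope l) → A k * A l ≈ 0#

module ClauseOperator {c ℓ} (𝓑 : CommutativeRing c ℓ) {n} (avg : Averaging 𝓑 n) {m : ℕ} (clauses : Clauses 𝓑 avg m) where
  open CommutativeRing 𝓑 hiding (zero)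
  open RingSolver 𝓑
  open Averaging avg
  open AveragingProperties 𝓑 avg
  open Clauses clauses

  Far : Fin m → Fin m → Set
  Far l j = l ≢ j × ¬ Nonempty (scope l ∩ scope j)

  -- Abstract so that `with far? l j` reduces the filter in `others`.
  abstract
    far? : ∀ l j → Dec (Far l j)
    far? l j = ¬? (l Fin.≟ j) ×-dec ¬? (nonempty? (scope l ∩ scope j))

  Far⇒Disjoint : ∀ {l j} → Far l j → Disjoint (scope l) (scope j)
  Far⇒Disjoint (_ , empty) i∈l i∈j = empty (_ , x∈p∩q⁺ (i∈l , i∈j))

  ¬Far⇒A*A≈0 : ∀ {l j} → l ≢ j → ¬ Far l j → A l * A j ≈ 0#
  ¬Far⇒A*A≈0 {l} {j} l≢j ¬far with nonempty? (scope l ∩ scope j)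
  ... | yes meet  = A-adjacent l j l≢j meet
  ... | no  empty = ⊥-elim (¬far (l≢j , empty))

  others : Fin m → List (Fin m) → List (Fin m)
  others l = filter (far? l)

  inside-of : Subset n → List (Fin m) → List (Fin m)
  inside-of U = filter (λ l → scope l ⊆? U)

  none : List (Fin m) → Carrier
  none []       = 1#
  none (l ∷ ls) = (1# - A l) * none ls

  -- The alternating sum over the subsets I of the given clauses of
  -- a · ∏_{l ∈ I} A l · E (S ∪ ⋃_{l ∈ I} scope l) f.
  L : List (Fin m) → Carrier → Subset n → Carrier → Carrier
  L []       a S f = a * E S f
  L (l ∷ ls) a S f = L ls a S f - L ls (a * A l) (S ∪ scope l) f

  L-cong : ∀ ls {a b} S {f g} → a ≈ b → f ≈ g → L ls a S f ≈ L ls b S g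
  L-cong []       S a≈b f≈g = *-cong a≈b (E-cong S f≈g)
  L-cong (l ∷ ls) S a≈b f≈g = +-cong (L-cong ls S a≈b f≈g) (-‿cong (L-cong ls _ (*-congʳ a≈b) f≈g))

  L-minus : ∀ ls a S f g → L ls a S (f - g) ≈ L ls a S f - L ls a S g
  L-minus []       a S f g = trans (*-congˡ (E-minus S f g)) (solve 3 (λ a x y → a :* (x :- y) := a :* x :- a :* y) refl a _ _)
  L-minus (l ∷ ls) a S f g = trans (+-cong (L-minus ls a S f g) (-‿cong (L-minus ls _ _ f g)))
    (solve 4 (λ x y z w → x :- y :- (z :- w) := x :- z :- (y :- w)) refl _ _ _ _)

  L-factor : ∀ ls b a S f → L ls (b * a) S f ≈ b * L ls a S f
  L-factor []       b a S f = *-assoc b a _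
  L-factor (l ∷ ls) b a S f = trans (+-cong (L-factor ls b a S f)
      (-‿cong (trans (L-cong ls _ (*-assoc b a (A l)) refl) (L-factor ls b (a * A l) _ f))))
    (solve 3 (λ b x y → b :* x :- b :* y := b :* (x :- y)) refl b _ _)

  L-vanish : ∀ ls {a} S f → a ≈ 0# → L ls a S f ≈ 0#
  L-vanish ls {a} S f a≈0 = trans (L-cong ls S (trans a≈0 (sym (zeroˡ 1#))) refl)
    (trans (L-factor ls 0# 1# S f) (zeroˡ _))

  L-scalar : ∀ ls a S r f → (∀ U → E U r ≈ r) → L ls a S (r * f) ≈ r * L ls a S f
  L-scalar []       a S r f inv = trans (*-congˡ (E-pull S f (inv S))) (solve 3 (λ a r x → a :* (r :* x) := r :* (a :* x)) refl a r _)
  L-scalar (l ∷ ls) a S r f inv = trans (+-cong (L-scalar ls a S r f inv) (-‿cong (L-scalar ls _ _ r f inv)))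
    (solve 3 (λ b x y → b :* x :- b :* y := b :* (x :- y)) refl r _ _)

  L-shift : ∀ ls a S T f → L ls a (S ∪ T) f ≈ L ls a S (E T f)
  L-shift []       a S T f = *-congˡ (sym (E-∪ S T f))
  L-shift (l ∷ ls) a S T f = +-cong (L-shift ls a S T f)
    (-‿cong (trans (reflexive (≡.cong (λ V → L ls (a * A l) V f) swap)) (L-shift ls (a * A l) (S ∪ scope l) T f)))
    where
    swap : (S ∪ T) ∪ scope l ≡ (S ∪ scope l) ∪ T
    swap = ≡.trans (∪-assoc S T _) (≡.trans (≡.cong (S ∪_) (∪-comm T _)) (≡.sym (∪-assoc S _ T)))

  -- All averages of `1#` disappear, and the alternating sum becomes the expanded product of the
  -- factors `1# - A l`.
  L-1 : ∀ ls a S → L ls a S 1# ≈ a * none ls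
  L-1 []       a S = *-congˡ (E-1 S)
  L-1 (l ∷ ls) a S = trans (+-cong (L-1 ls a S) (-‿cong (L-1 ls (a * A l) _)))
    (solve 3 (λ a x y → a :* y :- a :* x :* y := a :* ((con (+ 1) :- x) :* y)) refl a (A l) (none ls))

  -- Only the empty set of clauses survives multiplication by `b`. This will be used where no clause
  -- is violated, with `b = none ls`.
  L-outside : ∀ ls b a S f → (∀ {l} → l ∈ₗ ls → b * A l ≈ 0#) → b * L ls a S f ≈ b * (a * E S f)
  L-outside []       b a S f b*A≈0 = refl
  L-outside (l ∷ ls) b a S f b*A≈0 = begin
    b * (L ls a S f - L ls (a * A l) (S ∪ scope l) f)       ≈⟨ distribˡ _ _ _ ⟩
    b * L ls a S f + b * - L ls (a * A l) (S ∪ scope l) f   ≈⟨ +-cong (L-outside ls b a S f (b*A≈0 ∘ there)) vanish ⟩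
    b * (a * E S f) + 0#                                    ≈⟨ +-identityʳ _ ⟩
    b * (a * E S f)                                         ∎
    where
    open import Relation.Binary.Reasoning.Setoid setoid
    X : Carrier
    X = L ls (a * A l) (S ∪ scope l) f
    vanish : b * - X ≈ 0#
    vanish = begin
      b * - X                                      ≈⟨ solve 2 (λ b x → b :* (:- x) := :- (b :* x)) refl b X ⟩
      - (b * X)                                    ≈⟨ -‿cong (L-factor ls b (a * A l) _ f) ⟨
      - L ls (b * (a * A l)) (S ∪ scope l) f       ≈⟨ -‿cong (L-vanish ls _ f
        (trans (solve 3 (λ b a x → b :* (a :* x) := a :* (b :* x)) refl b a (A l)) (trans (*-congˡ (b*A≈0 (here ≡.refl))) (zeroʳ a)))) ⟩
      - 0#                                         ≈⟨ solve 0 (:- con (+ 0) := con (+ 0)) refl ⟩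
      0#                                           ∎

  private
    drop-adjacent : ∀ {l j} ls a S f → l ≢ j → ¬ Far l j → A l * L (j ∷ ls) a S f ≈ A l * L ls a S f
    drop-adjacent {l} {j} ls a S f l≢j ¬far = begin
      A l * (L ls a S f - X)        ≈⟨ solve 3 (λ b x y → b :* (x :- y) := b :* x :- b :* y) refl (A l) _ X ⟩
      A l * L ls a S f - A l * X    ≈⟨ +-congˡ (-‿cong (trans (sym (L-factor ls (A l) (a * A j) _ f)) (L-vanish ls _ f
          (trans (solve 3 (λ b a x → b :* (a :* x) := a :* (b :* x)) refl (A l) a (A j))
            (trans (*-congˡ (¬Far⇒A*A≈0 l≢j ¬far)) (zeroʳ a)))))) ⟩
      A l * L ls a S f - 0#         ≈⟨ solve 1 (λ x → x :- con (+ 0) := x) refl _ ⟩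
      A l * L ls a S f              ∎
      where
      open import Relation.Binary.Reasoning.Setoid setoid
      X : Carrier
      X = L ls (a * A j) (S ∪ scope j) f

    distribute : ∀ {a x y u v} → a * x ≈ a * u → a * y ≈ a * v → a * (x - y) ≈ a * (u - v)
    distribute {a} {x} {y} {u} {v} p q = trans (solve 3 (λ a x y → a :* (x :- y) := a :* x :- a :* y) refl a x y)
      (trans (+-cong p (-‿cong q)) (solve 3 (λ a x y → a :* x :- a :* y := a :* (x :- y)) refl a u v))

  -- A set `I` containing a neighbour `j` of `l` has the factor `A l * A j`, which is zero.
  L-restrict : ∀ l ls a S f → l ∉ₗ ls → A l * L ls a S f ≈ A l * L (others l ls) a S f
  L-restrict l []       a S f l∉ = refl
  L-restrict l (j ∷ ls) a S f l∉ with far? l j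
  ... | yes far = distribute (L-restrict l ls a S f (l∉ ∘ there)) (L-restrict l ls _ _ f (l∉ ∘ there))
  ... | no ¬far = trans (drop-adjacent ls a S f (l∉ ∘ here) ¬far) (L-restrict l ls a S f (l∉ ∘ there))

  -- Terms with a neighbour of l vanish, and the terms for I and I ∪ {l} pair up.
  L-extract : ∀ l ls a S f → Unique ls → l ∈ₗ ls →
              A l * L ls a S f ≈ A l * L (others l ls) a S (f - E (scope l) f)
  L-extract l (.l ∷ ls) a S f (l∉ls ∷ _) (here ≡.refl) with far? l l
  ... | yes (l≢l , _) = ⊥-elim (l≢l ≡.refl)
  ... | no _ = begin
    A l * (L ls a S f - L ls (a * A l) (S ∪ scope l) f)    ≈⟨ distribute refl (trans
        (sym (L-factor ls (A l) _ _ f)) (trans (L-cong ls _ reorder refl) (L-factor ls (A l) a _ f))) ⟩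
    A l * (L ls a S f - L ls a (S ∪ scope l) f)            ≈⟨ *-congˡ (+-congˡ (-‿cong (L-shift ls a S (scope l) f))) ⟩
    A l * (L ls a S f - L ls a S (E (scope l) f))          ≈⟨ *-congˡ (L-minus ls a S f _) ⟨
    A l * L ls a S (f - E (scope l) f)                     ≈⟨ L-restrict l ls a S _ (λ l∈ls → All.lookup l∉ls l∈ls ≡.refl) ⟩
    A l * L (others l ls) a S (f - E (scope l) f)          ∎
    where
    open import Relation.Binary.Reasoning.Setoid setoid
    reorder : A l * (a * A l) ≈ A l * a
    reorder = trans (solve 2 (λ x a → x :* (a :* x) := x :* x :* a) refl (A l) a) (*-congʳ (A-idem l))
  L-extract l (j ∷ ls) a S f (j∉ls ∷ ls!) (there l∈ls) with far? l j
  ... | yes far = distribute (L-extract l ls a S f ls! l∈ls) (L-extract l ls _ _ f ls! l∈ls)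
  ... | no ¬far = trans (drop-adjacent ls a S f (λ { ≡.refl → All.lookup j∉ls l∈ls ≡.refl }) ¬far)
                    (L-extract l ls a S f ls! l∈ls)

  -- Every average in the sum runs over variables outside `scope l`, so it treats `A l` as a scalar.
  L-commute : ∀ l ls a S f → All (Far l) ls → Disjoint (scope l) S → L ls a S (A l * f) ≈ A l * L ls a S f
  L-commute l []       a S f []           d =
    trans (*-congˡ (E-pull S f (A-local l S (Disjoint-sym d)))) (solve 3 (λ a x y → a :* (x :* y) := x :* (a :* y)) refl a (A l) _)
  L-commute l (j ∷ ls) a S f (far ∷ fars) d =
    trans (+-cong (L-commute l ls a S f fars d)
            (-‿cong (L-commute l ls _ _ f fars (Disjoint-∪ d (Far⇒Disjoint far)))))
      (solve 3 (λ a x y → a :* x :- a :* y := a :* (x :- y)) refl (A l) _ _)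

  none-∈ : ∀ {l ls} → l ∈ₗ ls → none ls * A l ≈ 0#
  none-∈ {l} {_ ∷ ls} (here ≡.refl) = begin
    (1# - A l) * none ls * A l        ≈⟨ solve 2 (λ x y → (con (+ 1) :- x) :* y :* x := (x :- x :* x) :* y) refl (A l) (none ls) ⟩
    (A l - A l * A l) * none ls       ≈⟨ *-congʳ (+-congˡ (-‿cong (A-idem l))) ⟩
    (A l - A l) * none ls             ≈⟨ trans (*-congʳ (-‿inverseʳ _)) (zeroˡ _) ⟩
    0#                                ∎
    where open import Relation.Binary.Reasoning.Setoid setoid
  none-∈ {l} (there l∈ls) = trans (*-assoc _ _ _) (trans (*-congˡ (none-∈ l∈ls)) (zeroʳ _))

  -- The case `f = 1#` of `L-restrict`, read through `L-1`.
  none-restrict : ∀ l ls → l ∉ₗ ls → A l * none ls ≈ A l * none (others l ls)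
  none-restrict l ls l∉ = begin
    A l * none ls                      ≈⟨ *-congˡ (none-L ls) ⟩
    A l * L ls 1# ⊥ 1#                 ≈⟨ L-restrict l ls 1# ⊥ 1# l∉ ⟩
    A l * L (others l ls) 1# ⊥ 1#      ≈⟨ *-congˡ (none-L (others l ls)) ⟨
    A l * none (others l ls)           ∎
    where
    open import Relation.Binary.Reasoning.Setoid setoid
    none-L : ∀ js → none js ≈ L js 1# ⊥ 1#
    none-L js = sym (trans (L-1 js 1# ⊥) (*-identityˡ _))

  module _ {f : Carrier} {U : Subset n} (f-killed : ∀ V → U ⊆ V → V ⊈ U → E V f ≈ 0#) where

    -- `a` depends only on `S` while `E S f` no longer depends on `S`, so `E U` factorises. The
    -- second factor is `E (U ∪ S) f`, killed because `U ∪ S` is strictly above `U`.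
    E-L-⊈ : ∀ ls {a} S → Local S a → S ⊈ U → E U (L ls a S f) ≈ 0#
    E-L-⊈ []       {a} S a-loc S⊈U = begin
      E U (a * E S f)          ≈⟨ E-independent U a-loc (E-idem S f) ⟩
      E U a * E U (E S f)      ≈⟨ *-congˡ (trans (E-∪ U S f) (f-killed (U ∪ S) (p⊆p∪q S) (λ sub → S⊈U (sub ∘ q⊆p∪q U S)))) ⟩
      E U a * 0#               ≈⟨ zeroʳ _ ⟩
      0#                       ∎
      where open import Relation.Binary.Reasoning.Setoid setoid
    E-L-⊈ (l ∷ ls) {a} S a-loc S⊈U = trans (E-minus U _ _)
      (trans (+-cong (E-L-⊈ ls S a-loc S⊈U)
        (-‿cong (E-L-⊈ ls (S ∪ scope l) (Local-* (Local-⊆ (p⊆p∪q (scope l)) a-loc) (Local-⊆ (q⊆p∪q S (scope l)) (A-local l)))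
                  (λ sub → S⊈U (sub ∘ p⊆p∪q (scope l))))))
        (-‿inverseʳ 0#))

    -- For `S` inside `U` the same factorisation leaves the scalar `E ⊤ a` times `E U f`. Sets with
    -- a scope sticking out of `U` contribute nothing, and the coefficients of the others add up to
    -- an expanded product over the clauses inside `U`.
    E-L : ∀ ls {a} S → Local S a → S ⊆ U →
          E U (L ls a S f) ≈ E ⊤ (a * none (inside-of U ls)) * E U f
    E-L [] {a} S a-loc S⊆U = begin
      E U (a * E S f)          ≈⟨ E-independent U a-loc (E-idem S f) ⟩
      E U a * E U (E S f)      ≈⟨ *-cong (E-local a a-loc S⊆U) (E-absorb f S⊆U) ⟩
      E ⊤ a * E U f            ≈⟨ *-congʳ (E-cong ⊤ (*-identityʳ a)) ⟨
      E ⊤ (a * 1#) * E U f     ∎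
      where open import Relation.Binary.Reasoning.Setoid setoid
    E-L (l ∷ ls) {a} S a-loc S⊆U with scope l ⊆? U
    ... | yes l⊆U = begin
      E U (L ls a S f - L ls (a * A l) (S ∪ scope l) f)   ≈⟨ E-minus U _ _ ⟩
      E U (L ls a S f) - E U (L ls (a * A l) (S ∪ scope l) f)
        ≈⟨ +-cong (E-L ls S a-loc S⊆U) (-‿cong (E-L ls (S ∪ scope l) aA-loc (∪-least S⊆U l⊆U))) ⟩
      E ⊤ (a * N) * E U f - E ⊤ (a * A l * N) * E U f
        ≈⟨ solve 3 (λ x y z → x :* z :- y :* z := (x :- y) :* z) refl _ _ _ ⟩
      (E ⊤ (a * N) - E ⊤ (a * A l * N)) * E U f           ≈⟨ *-congʳ (E-minus ⊤ _ _) ⟨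
      E ⊤ (a * N - a * A l * N) * E U f
        ≈⟨ *-congʳ (E-cong ⊤ (solve 3 (λ a x y → a :* y :- a :* x :* y := a :* ((con (+ 1) :- x) :* y)) refl a (A l) N)) ⟩
      E ⊤ (a * ((1# - A l) * N)) * E U f                  ∎
      where
      open import Relation.Binary.Reasoning.Setoid setoid
      N : Carrier
      N = none (inside-of U ls)
      aA-loc : Local (S ∪ scope l) (a * A l)
      aA-loc = Local-* (Local-⊆ (p⊆p∪q (scope l)) a-loc) (Local-⊆ (q⊆p∪q S (scope l)) (A-local l))
    ... | no l⊈U = trans (E-minus U _ _) (trans
      (+-cong (E-L ls S a-loc S⊆U)
        (-‿cong (E-L-⊈ ls (S ∪ scope l) (Local-* (Local-⊆ (p⊆p∪q (scope l)) a-loc) (Local-⊆ (q⊆p∪q S (scope l)) (A-local l)))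
          (λ sub → l⊈U (sub ∘ q⊆p∪q S (scope l))))))
      (solve 1 (λ x → x :- con (+ 0) := x) refl _))

    -- Triangularity: if all E V with V ⊋ U kill f, the operator acts under E U as a scalar.
    E-𝓛 : ∀ ls → E U (L ls 1# ⊥ f) ≈ E ⊤ (none (inside-of U ls)) * E U f
    E-𝓛 ls = trans (E-L ls ⊥ (Local-1 ⊥) ⊥⊆) (*-congʳ (E-cong ⊤ (*-identityˡ _)))

  Killed : (Subset n → Set) → Carrier → Set ℓ
  Killed K f = ∀ U → K U → E U f ≈ 0#

  Killed-above : ∀ {U f} → E U f ≈ 0# → ∀ V → U ⊆ V → E V f ≈ 0#
  Killed-above {f = f} EUf≈0 V U⊆V = trans (sym (E-absorb f U⊆V)) (trans (E-cong V EUf≈0) (E-0 V))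

  Killed-all : ∀ {f} → Killed (λ _ → Unit) f → f ≈ 0#
  Killed-all {f} killed = trans (sym (E-⊥ f)) (killed ⊥ tt)

  -- An inverse is required for every list: the diagonal entry at `U` belongs to the clauses inside
  -- `U`, and the clauses far from each `l` have an operator of their own.
  module Inversion (invertible : ∀ ls → ∃[ r ] r * E ⊤ (none ls) ≈ 1#) where

    module _ (ls : List (Fin m)) where

      private
        𝓛 : Carrier → Carrier
        𝓛 = L ls 1# ⊥
        q : Subset n → Carrier
        q U = E ⊤ (none (inside-of U ls))

      abstract
        -- Once the averages over all proper supersets of `U` vanish, `E U` of the equation reads
        -- `q U * E U f ≈ 0#`, and `q U` cancels. The descent ends at `E ⊥ f`, which is `f`.
        injective : ∀ f → 𝓛 f ≈ 0# → f ≈ 0#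
        injective f 𝓛f≈0 = superset-first P (λ _ _ sub p killed → p (λ U k → killed U (sub U k))) step Killed-all
          (λ U U≢U → ⊥-elim (U≢U ≡.refl))
          where
          P : (Subset n → Set) → Set ℓ
          P K = Killed K f → f ≈ 0#
          step : ∀ K U → (∀ V → U ⊆ V → V ⊈ U → K V) → P (λ V → K V ⊎ V ≡ U) → P K
          step K U above p killed = p (λ { V (inj₁ k) → killed V k ; V (inj₂ ≡.refl) → EUf≈0 })
            where
            open import Relation.Binary.Reasoning.Setoid setoid
            r : Carrier
            r = proj₁ (invertible (inside-of U ls))
            EUf≈0 : E U f ≈ 0#
            EUf≈0 = begin
              E U f              ≈⟨ *-identityˡ _ ⟨
              1# * E U f         ≈⟨ *-congʳ (proj₂ (invertible (inside-of U ls))) ⟨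
              r * q U * E U f    ≈⟨ *-assoc r _ _ ⟩
              r * (q U * E U f)  ≈⟨ *-congˡ (E-𝓛 (λ V U⊆V V⊈U → killed V (above V U⊆V V⊈U)) ls) ⟨
              r * E U (𝓛 f)      ≈⟨ *-congˡ (trans (E-cong U 𝓛f≈0) (E-0 U)) ⟩
              r * 0#             ≈⟨ zeroʳ r ⟩
              0#                 ∎

        -- The element `f₁ = 𝓛 f - q U * f` stays killed on `K` and is killed at `U` too, so it has
        -- a preimage `g`; then `𝓛 (f - g) ≈ q U * f`, and dividing by `q U` solves for `f`. In
        -- effect the product of `𝓛 - q U` over all `U` is zero, and inversion follows because each
        -- `q U` is invertible.
        surjective : ∀ f → ∃[ g ] 𝓛 g ≈ f
        surjective f = superset-first P (λ _ _ sub p f killed → p f (λ U k → killed U (sub U k))) step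
          (λ f killed → 0# , trans 𝓛0≈0 (sym (Killed-all killed))) f (λ U U≢U → ⊥-elim (U≢U ≡.refl))
          where
          open import Relation.Binary.Reasoning.Setoid setoid
          P : (Subset n → Set) → Set (c ⊔ ℓ)
          P K = ∀ f → Killed K f → ∃[ g ] 𝓛 g ≈ f
          𝓛0≈0 : 𝓛 0# ≈ 0#
          𝓛0≈0 = begin
            𝓛 0#              ≈⟨ L-cong ls ⊥ refl (-‿inverseʳ 0#) ⟨
            𝓛 (0# - 0#)       ≈⟨ L-minus ls 1# ⊥ 0# 0# ⟩
            𝓛 0# - 𝓛 0#       ≈⟨ -‿inverseʳ _ ⟩
            0#                ∎
          step : ∀ K U → (∀ V → U ⊆ V → V ⊈ U → K V) → P (λ V → K V ⊎ V ≡ U) → P K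
          step K U above p f killed = r * (f - g) , (begin
              𝓛 (r * (f - g))             ≈⟨ L-scalar ls 1# ⊥ r (f - g) r-invariant ⟩
              r * 𝓛 (f - g)               ≈⟨ *-congˡ (L-minus ls 1# ⊥ f g) ⟩
              r * (𝓛 f - 𝓛 g)             ≈⟨ *-congˡ (+-congˡ (-‿cong 𝓛g≈)) ⟩
              r * (𝓛 f - (𝓛 f - q U * f)) ≈⟨ solve 4 (λ r x q f → r :* (x :- (x :- q :* f)) := r :* q :* f) refl r (𝓛 f) (q U) f ⟩
              r * q U * f                 ≈⟨ *-congʳ rq≈1 ⟩
              1# * f                      ≈⟨ *-identityˡ f ⟩
              f                           ∎)
            where
            r : Carrier
            r = proj₁ (invertible (inside-of U ls))
            rq≈1 : r * q U ≈ 1#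
            rq≈1 = proj₂ (invertible (inside-of U ls))
            -- `r` is just some inverse of an average over all variables; being inverse to an
            -- invariant element makes it invariant.
            r-invariant : ∀ V → E V r ≈ r
            r-invariant V = begin
              E V r                ≈⟨ *-identityʳ _ ⟨
              E V r * 1#           ≈⟨ *-congˡ rq≈1 ⟨
              E V r * (r * q U)    ≈⟨ solve 3 (λ x r q → x :* (r :* q) := r :* (q :* x)) refl _ r (q U) ⟩
              r * (q U * E V r)    ≈⟨ *-congˡ (E-pull V r (E-⊤-invariant V _)) ⟨
              r * E V (q U * r)    ≈⟨ *-congˡ (trans (E-cong V (trans (*-comm _ _) rq≈1)) (E-1 V)) ⟩
              r * 1#               ≈⟨ *-identityʳ r ⟩
              r                    ∎
            f₁ : Carrier
            f₁ = 𝓛 f - q U * f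
            E-f₁ : ∀ V → E V f₁ ≈ E V (𝓛 f) - q U * E V f
            E-f₁ V = trans (E-minus V _ _) (+-congˡ (-‿cong (E-pull V f (E-⊤-invariant V _))))
            f₁-killed : Killed (λ V → K V ⊎ V ≡ U) f₁
            f₁-killed V (inj₂ ≡.refl) = begin
              E U f₁                        ≈⟨ E-f₁ U ⟩
              E U (𝓛 f) - q U * E U f       ≈⟨ +-congʳ (E-𝓛 (λ V U⊆V V⊈U → killed V (above V U⊆V V⊈U)) ls) ⟩
              q U * E U f - q U * E U f     ≈⟨ -‿inverseʳ _ ⟩
              0#                            ∎
            f₁-killed V (inj₁ k) = begin
              E V f₁                        ≈⟨ E-f₁ V ⟩
              E V (𝓛 f) - q U * E V f       ≈⟨ +-congʳ (E-𝓛 (λ V′ V⊆V′ _ → Killed-above (killed V k) V′ V⊆V′) ls) ⟩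
              q V * E V f - q U * E V f     ≈⟨ +-cong (*-congˡ (killed V k)) (-‿cong (*-congˡ (killed V k))) ⟩
              q V * 0# - q U * 0#           ≈⟨ solve 2 (λ x y → x :* con (+ 0) :- y :* con (+ 0) := con (+ 0)) refl (q V) (q U) ⟩
              0#                            ∎
            g : Carrier
            g = proj₁ (p f₁ f₁-killed)
            𝓛g≈ : 𝓛 g ≈ f₁
            𝓛g≈ = proj₂ (p f₁ f₁-killed)

    module Solution (ls : List (Fin m)) (ls! : Unique ls) (ls-all : ∀ l → l ∈ₗ ls) (k : Fin m) where

      -- For 0/1-valued A this indicates that k is the only violated clause.
      only : Carrier
      only = A k * none (filter (λ l → ¬? (k Fin.≟ l)) ls)

      F : Carrier
      F = proj₁ (surjective ls only)

      𝓛F≈only : L ls 1# ⊥ F ≈ only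
      𝓛F≈only = proj₂ (surjective ls only)

      private
        others-far : ∀ l js → All (Far l) (others l js)
        others-far l = all-filter (far? l)

        -- Multiplication by `A l` confines the equation to the clauses far from `l`, whose operator
        -- commutes with `A l` and can be cancelled by `injective`.
        A*𝓛F : ∀ l → A l * L ls 1# ⊥ F ≈ L (others l ls) 1# ⊥ (A l * (F - E (scope l) F))
        A*𝓛F l = trans (L-extract l ls 1# ⊥ F ls! (ls-all l))
          (sym (L-commute l (others l ls) 1# ⊥ _ (others-far l ls) (λ _ → ∉⊥)))

        others-≢ : ∀ js → others k (filter (λ l → ¬? (k Fin.≟ l)) js) ≡ others k js
        others-≢ [] = ≡.refl
        others-≢ (j ∷ js) with k Fin.≟ j
        others-≢ (j ∷ js) | no k≢j with far? k j
        ... | yes _ = ≡.cong (j ∷_) (others-≢ js)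
        ... | no _  = others-≢ js
        others-≢ (j ∷ js) | yes ≡.refl with far? j j
        ... | yes (j≢j , _) = ⊥-elim (j≢j ≡.refl)
        ... | no _ = others-≢ js

        ∉-≢ : ∀ js → k ∉ₗ filter (λ l → ¬? (k Fin.≟ l)) js
        ∉-≢ js k∈ = All.lookup (all-filter (λ l → ¬? (k Fin.≟ l)) js) k∈ ≡.refl

        ∈-≢ : ∀ {l js} → k ≢ l → l ∈ₗ js → l ∈ₗ filter (λ l → ¬? (k Fin.≟ l)) js
        ∈-≢ k≢l l∈ = ∈-filter⁺ (λ l → ¬? (k Fin.≟ l)) l∈ k≢l
          where open import Data.List.Membership.Propositional.Properties using (∈-filter⁺)

      -- On the right-hand side `only` contains the factor `1# - A l`, which `A l` annihilates.
      -- Injectivity of the operator of the far clauses does the rest.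
      local-other : ∀ l → k ≢ l → A l * (F - E (scope l) F) ≈ 0#
      local-other l k≢l = injective (others l ls) _ (begin
        L (others l ls) 1# ⊥ (A l * (F - E (scope l) F))     ≈⟨ A*𝓛F l ⟨
        A l * L ls 1# ⊥ F                                    ≈⟨ *-congˡ 𝓛F≈only ⟩
        A l * (A k * none (filter (λ l → ¬? (k Fin.≟ l)) ls))
          ≈⟨ solve 3 (λ x y z → x :* (y :* z) := y :* (z :* x)) refl (A l) (A k) _ ⟩
        A k * (none (filter (λ l → ¬? (k Fin.≟ l)) ls) * A l) ≈⟨ *-congˡ (none-∈ (∈-≢ k≢l (ls-all l))) ⟩
        A k * 0#                                             ≈⟨ zeroʳ _ ⟩
        0#                                                   ∎)
        where open import Relation.Binary.Reasoning.Setoid setoid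

      -- `A k` solves the same reduced equation: the operator of the clauses far from `k` sends it
      -- to `A k * none (others k ls)`, which is also `A k * only`. Injectivity identifies the two
      -- solutions.
      local-self : A k * (F - E (scope k) F) ≈ A k
      local-self = trans (solve 2 (λ x y → x := x :- y :+ y) refl _ (A k))
        (trans (+-congʳ (injective (others k ls) _ (begin
        L (others k ls) 1# ⊥ (A k * (F - E (scope k) F) - A k)     ≈⟨ L-minus (others k ls) 1# ⊥ _ _ ⟩
        L (others k ls) 1# ⊥ (A k * (F - E (scope k) F)) - L (others k ls) 1# ⊥ (A k)
          ≈⟨ +-cong (trans (sym (A*𝓛F k)) (trans (*-congˡ 𝓛F≈only) A*only)) (-‿cong 𝓛A) ⟩
        A k * none (others k ls) - A k * none (others k ls)        ≈⟨ -‿inverseʳ _ ⟩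
        0#                                                         ∎))) (+-identityˡ _))
        where
        open import Relation.Binary.Reasoning.Setoid setoid
        A*only : A k * only ≈ A k * none (others k ls)
        A*only = begin
          A k * only          ≈⟨ trans (sym (*-assoc _ _ _)) (*-congʳ (A-idem k)) ⟩
          only                ≈⟨ none-restrict k _ (∉-≢ ls) ⟩
          A k * none (others k (filter (λ l → ¬? (k Fin.≟ l)) ls))  ≈⟨ *-congˡ (reflexive (≡.cong none (others-≢ ls))) ⟩
          A k * none (others k ls)  ∎
        𝓛A : L (others k ls) 1# ⊥ (A k) ≈ A k * none (others k ls)
        𝓛A = begin
          L (others k ls) 1# ⊥ (A k)        ≈⟨ L-cong (others k ls) ⊥ refl (*-identityʳ _) ⟨
          L (others k ls) 1# ⊥ (A k * 1#)   ≈⟨ L-commute k (others k ls) 1# ⊥ 1# (others-far k ls) (λ _ → ∉⊥) ⟩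
          A k * L (others k ls) 1# ⊥ 1#     ≈⟨ *-congˡ (trans (L-1 (others k ls) 1# ⊥) (*-identityˡ _)) ⟩
          A k * none (others k ls)          ∎

      -- Multiplication by `none ls` reduces the left-hand side to `F` and annihilates the factor
      -- `A k` on the right.
      satisfied : none ls * F ≈ 0#
      satisfied = begin
        none ls * F                 ≈⟨ *-congˡ (trans (*-identityˡ _) (E-⊥ F)) ⟨
        none ls * (1# * E ⊥ F)      ≈⟨ L-outside ls (none ls) 1# ⊥ F none-∈ ⟨
        none ls * L ls 1# ⊥ F       ≈⟨ *-congˡ 𝓛F≈only ⟩
        none ls * (A k * _)         ≈⟨ *-assoc _ _ _ ⟨
        none ls * A k * _           ≈⟨ *-congʳ (none-∈ (ls-all k)) ⟩
        0# * _                      ≈⟨ zeroˡ _ ⟩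
        0#                          ∎
        where open import Relation.Binary.Reasoning.Setoid setoid

      -- Triangularity at `⊤`, where the condition on proper supersets is vacuous and all clauses
      -- are inside.
      average : E ⊤ (none ls) * E ⊤ F ≈ E ⊤ only
      average = begin
        E ⊤ (none ls) * E ⊤ F                 ≈⟨ *-congʳ (E-cong ⊤ (reflexive (≡.cong none (filter-all (λ l → scope l ⊆? ⊤) {ls} (All.tabulate (λ _ → ⊆⊤)))))) ⟨
        E ⊤ (none (inside-of ⊤ ls)) * E ⊤ F   ≈⟨ E-𝓛 (λ V _ V⊈⊤ → ⊥-elim (V⊈⊤ ⊆⊤)) ls ⟨
        E ⊤ (L ls 1# ⊥ F)                     ≈⟨ E-cong ⊤ 𝓛F≈only ⟩
        E ⊤ only                              ∎
        where open import Relation.Binary.Reasoning.Setoid setoid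

-- Product distributions and conditional expectation.

Values-≟ : ∀ {n} {D : Fin n → Set} → (∀ i → DecidableEquality (D i)) → ∀ S → DecidableEquality (Values D S)
Values-≟ _≟_ []            tt tt = yes ≡.refl
Values-≟ _≟_ (inside  ∷ S) = ≡-dec (_≟_ zero) (Values-≟ (λ i → _≟_ (suc i)) S)
Values-≟ _≟_ (outside ∷ S) = Values-≟ (λ i → _≟_ (suc i)) S

overwrite-⊥ : ∀ {n} (D : Fin n → Set) x v → overwrite D ⊥ x v ≡ x
overwrite-⊥ {zero}  D tt      v = ≡.refl
overwrite-⊥ {suc n} D (a , x) v = ≡.cong (a ,_) (overwrite-⊥ (D ∘ suc) x v)

overwrite-⊤ : ∀ {n} (D : Fin n → Set) x v → overwrite D ⊤ x v ≡ v
overwrite-⊤ {zero}  D x       tt      = ≡.refl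
overwrite-⊤ {suc n} D (a , x) (b , v) = ≡.cong (b ,_) (overwrite-⊤ (D ∘ suc) x v)

overwrite-overwrite : ∀ {n} (D : Fin n → Set) S x v w → overwrite D S (overwrite D S x v) w ≡ overwrite D S x w
overwrite-overwrite D []            x       v       w       = ≡.refl
overwrite-overwrite D (inside  ∷ S) (a , x) (b , v) (c , w) = ≡.cong (c ,_) (overwrite-overwrite (D ∘ suc) S x v w)
overwrite-overwrite D (outside ∷ S) (a , x) v       w       = ≡.cong (a ,_) (overwrite-overwrite (D ∘ suc) S x v w)

restrict-overwrite : ∀ {n} (D : Fin n → Set) V S → Disjoint V S → ∀ x v → restrict D S (overwrite D V x v) ≡ restrict D S x
restrict-overwrite D []            []            d x       v       = ≡.refl
restrict-overwrite D (inside  ∷ V) (inside  ∷ S) d x       v       = ⊥-elim (d Vec.here Vec.here)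
restrict-overwrite D (inside  ∷ V) (outside ∷ S) d (a , x) (b , v) =
  restrict-overwrite (D ∘ suc) V S (λ i j → d (Vec.there i) (Vec.there j)) x v
restrict-overwrite D (outside ∷ V) (inside  ∷ S) d (a , x) v       =
  ≡.cong (a ,_) (restrict-overwrite (D ∘ suc) V S (λ i j → d (Vec.there i) (Vec.there j)) x v)
restrict-overwrite D (outside ∷ V) (outside ∷ S) d (a , x) v       =
  restrict-overwrite (D ∘ suc) V S (λ i j → d (Vec.there i) (Vec.there j)) x v

module ProductMean {c ℓ₁ ℓ₂} (ℝ : RealNumbers c ℓ₁ ℓ₂) where
  open RealNumbers ℝ hiding (zero)
  open OrderedField ℝ
  open Summation ℝ
  open Expectation ℝ
  open PartialRejectionSampling ℝ using (Distribution; pmf; nonNegative; mass)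

  -- Equality is pointwise and ignores the bounds; the two sides of a ring law usually carry
  -- different ones.
  Bounded-commutativeRing : Set → CommutativeRing _ _
  Bounded-commutativeRing A = record
    { Carrier = Bounded A
    ; _≈_     = λ f g → ∀ a → at f a ≈ at g a
    ; _+_     = _+ᵇ_
    ; _*_     = _*ᵇ_
    ; -_      = -ᵇ_
    ; 0#      = constᵇ 0#
    ; 1#      = constᵇ 1#
    ; isCommutativeRing = record
      { isRing = record
        { +-isAbelianGroup = record
          { isGroup = record
            { isMonoid = record
              { isSemigroup = record
                { isMagma = record
                  { isEquivalence = record
                    { refl  = λ _ → refl
                    ; sym   = λ p a → sym (p a)
                    ; trans = λ p q a → trans (p a) (q a)
                    }
                  ; ∙-cong = λ p q a → +-cong (p a) (q a)
                  }
                ; assoc = λ f g h a → +-assoc _ _ _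
                }
              ; identity = (λ f a → +-identityˡ _) , (λ f a → +-identityʳ _)
              }
            ; inverse = (λ f a → -‿inverseˡ _) , (λ f a → -‿inverseʳ _)
            ; ⁻¹-cong = λ p a → -‿cong (p a)
            }
          ; comm = λ f g a → +-comm _ _
          }
        ; *-cong     = λ p q a → *-cong (p a) (q a)
        ; *-assoc    = λ f g h a → *-assoc _ _ _
        ; *-identity = (λ f a → *-identityˡ _) , (λ f a → *-identityʳ _)
        ; distrib    = (λ f g h a → distribˡ _ _ _) , (λ f g h a → distribʳ _ _ _)
        }
      ; *-comm = λ f g a → *-comm _ _
      }
    }

  abstract
    represents-pushforward : ∀ {A B : Set} (ι : A → B) → (∀ {x y} → ι x ≡ ι y → x ≡ y) →
      ∀ {w M} → Represents w M → (g : B → Carrier) → (∀ x → g (ι x) ≈ w x) →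
      (∀ y → (∃[ x ] y ≡ ι x) ⊎ g y ≈ 0#) → Represents g (pushforward ι M)
    represents-pushforward ι injective rep g g∘ι≈w support f 0≤f =
      HasSum-image ι injective (λ y → g y * at f y) support′
        (HasSum-cong (λ x → *-congʳ (sym (g∘ι≈w x))) refl (rep (f ∘ᵇ ι) (0≤f ∘ ι)))
      where
      support′ : ∀ y → (∃[ x ] y ≡ ι x) ⊎ g y * at f y ≈ 0#
      support′ y with support y
      ... | inj₁ image = inj₁ image
      ... | inj₂ gy≈0  = inj₂ (trans (*-congʳ gy≈0) (zeroˡ _))

    represents-dirac : ∀ {A : Set} (x : A) (w : A → Carrier) → w x ≈ 1# → (∀ y → y ≡ x ⊎ w y ≈ 0#) → Represents w (dirac x)
    represents-dirac x w wx≈1 support f 0≤f =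
      HasSum-cong (λ _ → refl) w*f≈f (HasSum-singleton x (λ y → w y * at f y) support′ (≤-respʳ (sym w*f≈f) (0≤f x)))
      where
      w*f≈f : w x * at f x ≈ at f x
      w*f≈f = trans (*-congʳ wx≈1) (*-identityˡ _)
      support′ : ∀ y → y ≡ x ⊎ w y * at f y ≈ 0#
      support′ y with support y
      ... | inj₁ y≡x  = inj₁ y≡x
      ... | inj₂ wy≈0 = inj₂ (trans (*-congʳ wy≈0) (zeroˡ _))

  module _ {A B : Set} (_≟ᴬ_ : DecidableEquality A) (_≟ᴮ_ : DecidableEquality B) (π : B → A) where
    open Discrete _≟ᴬ_

    abstract
      -- The chain rule: `π b` is the part of `b` drawn first, and `K a` is the law of `b` on the
      -- fibre over `a`.
      represents-bind : ∀ {u M} {w : B → Carrier} {K : A → Mean B} → (∀ a → 0# ≤ u a) → (∀ b → 0# ≤ w b) →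
        Represents u M → (∀ a → Represents (λ b → δ (π b) a * w b) (K a)) →
        Represents (λ b → u (π b) * w b) (bind M K)
      represents-bind {u} {M} {w} {K} 0≤u 0≤w repM repK f 0≤f =
        HasSum-fibres _≟ᴬ_ _≟ᴮ_ π (λ b → 0≤* (0≤* (0≤u (π b)) (0≤w b)) (0≤f b)) fibre
          (repM (marginal K f) (λ a → E-lower (K a) f 0≤f))
        where
        fibre : ∀ a → HasSum (λ b → δ (π b) a * (u (π b) * w b * at f b)) (u a * E (K a) f)
        fibre a = HasSum-cong (λ b → trans (solve 4 (λ u d w f → u :* (d :* w :* f) := d :* u :* (w :* f)) refl _ _ _ _)
            (trans (*-congʳ (sym (δ-subst u (π b) a))) (solve 4 (λ u d w f → d :* u :* (w :* f) := d :* (u :* w :* f)) refl _ _ _ _)))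
          refl (HasSum-* (0≤u a) (repK a f 0≤f))

  valuesMean : ∀ {n} {D : Fin n → Set} → (∀ i → DecidableEquality (D i)) → (∀ i → Distribution (D i)) →
               ∀ S → Mean (Values D S)
  valuesMean _≟_ μ []            = dirac tt
  valuesMean _≟_ μ (inside  ∷ S) = bind (Discretely.mean (_≟_ zero) (μ zero))
    (λ a → pushforward (a ,_) (valuesMean (λ i → _≟_ (suc i)) (μ ∘ suc) S))
  valuesMean _≟_ μ (outside ∷ S) = valuesMean (λ i → _≟_ (suc i)) (μ ∘ suc) S

  abstract
    0≤mass : ∀ {n} {D : Fin n → Set} (μ : ∀ i → Distribution (D i)) S v → 0# ≤ mass D μ S v
    0≤mass μ []            v       = <⇒≤ 0<1
    0≤mass μ (inside  ∷ S) (a , v) = 0≤* (nonNegative (μ zero) a) (0≤mass (μ ∘ suc) S v)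
    0≤mass μ (outside ∷ S) v       = 0≤mass (μ ∘ suc) S v

    valuesMean-represents : ∀ {n} {D : Fin n → Set} (_≟_ : ∀ i → DecidableEquality (D i)) (μ : ∀ i → Distribution (D i)) S →
                            Represents (mass D μ S) (valuesMean _≟_ μ S)
    valuesMean-represents _≟_ μ []            = represents-dirac tt _ refl (λ _ → inj₁ ≡.refl)
    valuesMean-represents {D = D} _≟_ μ (inside  ∷ S) =
      represents-bind (_≟_ zero) (Values-≟ _≟_ (inside ∷ S)) proj₁
        {u = pmf (μ zero)} {M = Discretely.mean (_≟_ zero) (μ zero)} {w = λ b → mass (D ∘ suc) (μ ∘ suc) S (proj₂ b)}
        {K = λ a → pushforward (a ,_) (valuesMean (λ i → _≟_ (suc i)) (μ ∘ suc) S)} (nonNegative (μ zero)) (λ b → 0≤mass (μ ∘ suc) S (proj₂ b))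
        (Discretely.mean-represents (_≟_ zero) (μ zero))
        (λ a → represents-pushforward (a ,_) (λ { ≡.refl → ≡.refl })
          {w = mass (D ∘ suc) (μ ∘ suc) S} {M = valuesMean (λ i → _≟_ (suc i)) (μ ∘ suc) S} (valuesMean-represents (λ i → _≟_ (suc i)) (μ ∘ suc) S)
          (λ b → δ (proj₁ b) a * mass (D ∘ suc) (μ ∘ suc) S (proj₂ b))
          (λ v → trans (*-congʳ (δ-≡ ≡.refl)) (*-identityˡ _))
          (λ b → support a b))
      where
      open Discrete (_≟_ zero)
      support : ∀ a b → (∃[ v ] b ≡ (a , v)) ⊎ δ (proj₁ b) a * mass (D ∘ suc) (μ ∘ suc) S (proj₂ b) ≈ 0#
      support a (a′ , v) with _≟_ zero a′ a
      ... | yes ≡.refl = inj₁ (v , ≡.refl)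
      ... | no  a′≢a   = inj₂ (zeroˡ _)
    valuesMean-represents _≟_ μ (outside ∷ S) = valuesMean-represents (λ i → _≟_ (suc i)) (μ ∘ suc) S

  module Conditioning {n} {D : Fin n → Set} (_≟_ : ∀ i → DecidableEquality (D i)) (μ : ∀ i → Distribution (D i)) where

    resampled : Subset n → Assignment D → Mean (Assignment D)
    resampled S x = pushforward (overwrite D S x) (valuesMean _≟_ μ S)

    conditional : Subset n → Bounded (Assignment D) → Bounded (Assignment D)
    conditional S = marginal (resampled S)

  abstract
    -- Induction over the variables. The delicate case is a first variable lying in `T` but not in
    -- `S`: its mean stands inside the average over the tail of `S` and has to be moved out by
    -- `fubini`.
    conditional-∪ : ∀ {n} {D : Fin n → Set} (_≟_ : ∀ i → DecidableEquality (D i)) (μ : ∀ i → Distribution (D i)) →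
      let open Conditioning _≟_ μ in
      ∀ S T f x → at (conditional S (conditional T f)) x ≈ at (conditional (S ∪ T) f) x
    conditional-∪ {zero} _≟_ μ [] [] f x = refl
    conditional-∪ {suc n} {D} _≟_ μ (s ∷ S) (t ∷ T) f (a , x) = by-cases s t
      where
      _≟ₛ_ : ∀ i → DecidableEquality (D (suc i))
      _≟ₛ_ i = _≟_ (suc i)
      μₛ : ∀ i → Distribution (D (suc i))
      μₛ i = μ (suc i)
      module C = Conditioning _≟_ μ
      module Cₛ = Conditioning _≟ₛ_ μₛ
      M₀ : Mean (D zero)
      M₀ = Discretely.mean (_≟_ zero) (μ zero)
      section : D zero → Bounded (Assignment (D ∘ suc))
      section b = f ∘ᵇ (b ,_)
      ih : ∀ b → at (Cₛ.conditional S (Cₛ.conditional T (section b))) x ≈ at (Cₛ.conditional (S ∪ T) (section b)) x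
      ih b = conditional-∪ _≟ₛ_ μₛ S T (section b) x
      inner : Bounded (D zero)
      inner = record
        { at = λ b → at (Cₛ.conditional S (Cₛ.conditional T (section b))) x
        ; bound = bound f ; 0≤bound = 0≤bound f
        ; upper = λ b → upper (Cₛ.conditional S (Cₛ.conditional T (section b))) x
        ; lower = λ b → lower (Cₛ.conditional S (Cₛ.conditional T (section b))) x }
      outer : Bounded (D zero)
      outer = record
        { at = λ b → at (Cₛ.conditional (S ∪ T) (section b)) x
        ; bound = bound f ; 0≤bound = 0≤bound f
        ; upper = λ b → upper (Cₛ.conditional (S ∪ T) (section b)) x
        ; lower = λ b → lower (Cₛ.conditional (S ∪ T) (section b)) x }
      inner≈outer : E M₀ inner ≈ E M₀ outer
      inner≈outer = E-cong M₀ inner outer ih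
      averaged : Bounded (Values (D ∘ suc) S)
      averaged = C.conditional (inside ∷ T) f ∘ᵇ (λ v → a , overwrite (D ∘ suc) S x v)
      swap : E M₀ inner ≈ E (valuesMean _≟ₛ_ μₛ S) averaged
      swap = Discretely.fubini (_≟_ zero) (μ zero) (valuesMean _≟ₛ_ μₛ S)
        (λ b → Cₛ.conditional T (section b) ∘ᵇ overwrite (D ∘ suc) S x)
        (λ v → record
          { at = λ b → at (Cₛ.conditional T (section b)) (overwrite (D ∘ suc) S x v)
          ; bound = bound f ; 0≤bound = 0≤bound f
          ; upper = λ b → upper (Cₛ.conditional T (section b)) (overwrite (D ∘ suc) S x v)
          ; lower = λ b → lower (Cₛ.conditional T (section b)) (overwrite (D ∘ suc) S x v) })
        (λ _ _ → refl) inner averaged (λ _ → refl) (λ _ → refl) (bound f) (λ _ → ≤-refl)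
      by-cases : ∀ s t → at (C.conditional (s ∷ S) (C.conditional (t ∷ T) f)) (a , x)
                       ≈ at (C.conditional ((s ∷ S) ∪ (t ∷ T)) f) (a , x)
      by-cases outside outside = ih a
      by-cases inside  outside = inner≈outer
      by-cases outside inside  = trans (sym swap) inner≈outer
      -- The first value drawn for `S` is overwritten by the one drawn for `T`, so the outer mean is
      -- that of a constant.
      by-cases inside  inside  = trans (E-const M₀ (E (valuesMean _≟ₛ_ μₛ S) averaged) _ (λ _ → refl))
                                   (trans (sym swap) inner≈outer)

  module _ {n} {D : Fin n → Set} (_≟_ : ∀ i → DecidableEquality (D i)) (μ : ∀ i → Distribution (D i)) where
    open Conditioning _≟_ μ

    abstract
      -- The average over `S` forgets the old values on `S`, as they get overwritten; a function
      -- equal to its average forgets them too.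
      conditional-invariant : ∀ S f → (∀ x → at (conditional S f) x ≈ at f x) →
                              ∀ x v → at f (overwrite D S x v) ≈ at f x
      conditional-invariant S f invariant x v = trans (sym (invariant (overwrite D S x v)))
        (trans (E-cong (valuesMean _≟_ μ S) (f ∘ᵇ overwrite D S (overwrite D S x v)) (f ∘ᵇ overwrite D S x)
                 (λ w → reflexive (≡.cong (at f) (overwrite-overwrite D S x v w))))
          (invariant x))

      conditional-pull : ∀ S f g → (∀ x → at (conditional S f) x ≈ at f x) →
                         ∀ x → at (conditional S (f *ᵇ g)) x ≈ at f x * at (conditional S g) x
      conditional-pull S f g invariant x =
        E-* (valuesMean _≟_ μ S) (at f x) (g ∘ᵇ overwrite D S x) ((f *ᵇ g) ∘ᵇ overwrite D S x)
          (λ v → *-congʳ (conditional-invariant S f invariant x v))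

      conditional-⊥ : ∀ f x → at (conditional ⊥ f) x ≈ at f x
      conditional-⊥ f x = E-const (valuesMean _≟_ μ ⊥) (at f x) (f ∘ᵇ overwrite D ⊥ x)
        (λ v → reflexive (≡.cong (at f) (overwrite-⊥ D x v)))

      conditional-⊤ : ∀ f x → at (conditional ⊤ f) x ≈ E (valuesMean _≟_ μ ⊤) f
      conditional-⊤ f x = E-cong (valuesMean _≟_ μ ⊤) (f ∘ᵇ overwrite D ⊤ x) f
        (λ v → reflexive (≡.cong (at f) (overwrite-⊤ D x v)))

    conditionalAveraging : Averaging (Bounded-commutativeRing (Assignment D)) n
    conditionalAveraging = record
      { E      = conditional
      ; E-cong = λ S {f} {g} f≈g x → E-cong (valuesMean _≟_ μ S) (f ∘ᵇ overwrite D S x) (g ∘ᵇ overwrite D S x) (λ v → f≈g _)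
      ; E-+    = λ S f g x → E-+ (valuesMean _≟_ μ S) (f ∘ᵇ overwrite D S x) (g ∘ᵇ overwrite D S x) ((f +ᵇ g) ∘ᵇ overwrite D S x) (λ _ → refl)
      ; E-∪    = conditional-∪ _≟_ μ
      ; E-⊥    = conditional-⊥
      ; E-pull = λ S {f} g → conditional-pull S f g
      ; E-1    = λ S x → E-1 (valuesMean _≟_ μ S) (constᵇ 1# ∘ᵇ overwrite D S x) (λ _ → refl)
      }

-- Inclusion-exclusion over sets of clauses.

module FiniteExpansion {c ℓ₁ ℓ₂} (ℝ : RealNumbers c ℓ₁ ℓ₂) where
  open RealNumbers ℝ hiding (zero)
  open OrderedField ℝ
  open Summation ℝ

  abstract
    ∏-cong-∈ : ∀ {A : Set} (xs : List A) {f g : A → Carrier} → (∀ {x} → x ∈ₗ xs → f x ≈ g x) → ∏ xs f ≈ ∏ xs g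
    ∏-cong-∈ []       f≈g = refl
    ∏-cong-∈ (x ∷ xs) f≈g = *-cong (f≈g (here ≡.refl)) (∏-cong-∈ xs (f≈g ∘ there))

    ∏-cong : ∀ {A : Set} (xs : List A) {f g : A → Carrier} → (∀ x → f x ≈ g x) → ∏ xs f ≈ ∏ xs g
    ∏-cong xs f≈g = ∏-cong-∈ xs (λ {x} _ → f≈g x)

    ∑-++ : ∀ {A : Set} (xs ys : List A) (f : A → Carrier) → ∑ (xs ++ ys) f ≈ ∑ xs f + ∑ ys f
    ∑-++ []       ys f = sym (+-identityˡ _)
    ∑-++ (x ∷ xs) ys f = trans (+-congˡ (∑-++ xs ys f)) (sym (+-assoc _ _ _))

    ∑-filter : ∀ {A : Set} {p} {P : Pred A p} (P? : Decidable P) xs (f : A → Carrier) →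
               ∑ (filter P? xs) f ≈ ∑ xs (λ x → if does (P? x) then f x else 0#)
    ∑-filter P? []       f = refl
    ∑-filter P? (x ∷ xs) f with does (P? x)
    ... | true  = +-congˡ (∑-filter P? xs f)
    ... | false = trans (∑-filter P? xs f) (sym (+-identityˡ _))

    ∏-filter : ∀ {A : Set} {p} {P : Pred A p} (P? : Decidable P) xs (f : A → Carrier) →
               ∏ (filter P? xs) f ≈ ∏ xs (λ x → if does (P? x) then f x else 1#)
    ∏-filter P? []       f = refl
    ∏-filter P? (x ∷ xs) f with does (P? x)
    ... | true  = *-congˡ (∏-filter P? xs f)
    ... | false = trans (∏-filter P? xs f) (sym (*-identityˡ _))

    ∏-map : ∀ {A B : Set} (g : A → B) xs (f : B → Carrier) → ∏ (map g xs) f ≈ ∏ xs (f ∘ g)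
    ∏-map g []       f = refl
    ∏-map g (x ∷ xs) f = *-congˡ (∏-map g xs f)

    ∏-allFin-suc : ∀ m (f : Fin (suc m) → Carrier) → ∏ (allFin (suc m)) f ≈ f zero * ∏ (allFin m) (f ∘ suc)
    ∏-allFin-suc m f = *-congˡ (trans
      (reflexive (≡.cong (λ xs → ∏ xs f) (≡.sym (map-tabulate (λ i → i) suc)))) (∏-map suc (allFin m) f))

  signedTerm : ∀ {m} (S : Subset m) (a : Fin m → Carrier) → Subset m → Carrier
  signedTerm {m} S a I = (- 1#) ^ ∣ I ─ S ∣ * ∏ (allFin m) (λ l → if does (l ∈? I) then a l else 1#)

  termAbove : ∀ {m} (S : Subset m) (a : Fin m → Carrier) → Subset m → Carrier
  termAbove S a I = if does (S ⊆? I) then signedTerm S a I else 0#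

  abstract
    -- Expansion of the product, where `I` records the factors outside `S` in which `- a l` is
    -- chosen over `1#`. `factor-out` and `factor-in` give the contribution of the first element
    -- according to whether `I` omits or contains it.
    inclusion-exclusion : ∀ {m} (S : Subset m) (a : Fin m → Carrier) →
      ∑ (subsets m) (termAbove S a) ≈ ∏ (allFin m) (λ l → if does (l ∈? S) then a l else 1# - a l)
    inclusion-exclusion {zero} [] a = trans (+-identityʳ _) (*-identityˡ _)
    inclusion-exclusion {suc m} (s ∷ S) a = begin
      ∑ (subsets (suc m)) (termAbove (s ∷ S) a)
        ≈⟨ ∑-++ (map (outside ∷_) (subsets m)) (map (inside ∷_) (subsets m)) _ ⟩
      ∑ (map (outside ∷_) (subsets m)) (termAbove (s ∷ S) a) + ∑ (map (inside ∷_) (subsets m)) (termAbove (s ∷ S) a)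
        ≈⟨ +-cong (∑-map (outside ∷_) (subsets m) _) (∑-map (inside ∷_) (subsets m) _) ⟩
      ∑ (subsets m) (λ I → termAbove (s ∷ S) a (outside ∷ I)) + ∑ (subsets m) (λ I → termAbove (s ∷ S) a (inside ∷ I))
        ≈⟨ +-cong (∑-cong (subsets m) (without s)) (∑-cong (subsets m) (within s)) ⟩
      ∑ (subsets m) (λ I → factor-out s * termAbove S (a ∘ suc) I) + ∑ (subsets m) (λ I → factor-in s * termAbove S (a ∘ suc) I)
        ≈⟨ +-cong (∑-* (subsets m) _ _) (∑-* (subsets m) _ _) ⟩
      factor-out s * ∑ (subsets m) (termAbove S (a ∘ suc)) + factor-in s * ∑ (subsets m) (termAbove S (a ∘ suc))
        ≈⟨ trans (sym (distribʳ _ _ _)) (*-cong (factors s) (inclusion-exclusion S (a ∘ suc))) ⟩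
      (if does (zero ∈? (s ∷ S)) then a zero else 1# - a zero) * ∏ (allFin m) (λ l → if does (l ∈? S) then a (suc l) else 1# - a (suc l))
        ≈⟨ ∏-allFin-suc m (λ l → if does (l ∈? (s ∷ S)) then a l else 1# - a l) ⟨
      ∏ (allFin (suc m)) (λ l → if does (l ∈? (s ∷ S)) then a l else 1# - a l) ∎
      where
      open import Relation.Binary.Reasoning.Setoid setoid
      factor-in factor-out : Bool → Carrier
      factor-in  true  = a zero
      factor-in  false = - a zero
      factor-out true  = 0#
      factor-out false = 1#
      factors : ∀ s → factor-out s + factor-in s ≈ (if does (zero ∈? (s ∷ S)) then a zero else 1# - a zero)
      factors true  = +-identityˡ _
      factors false = refl
      peel : ∀ (i : Bool) (I : Subset m) → ∏ (allFin (suc m)) (λ l → if does (l ∈? (i ∷ I)) then a l else 1#)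
             ≈ (if does (zero ∈? (i ∷ I)) then a zero else 1#) * ∏ (allFin m) (λ l → if does (l ∈? I) then a (suc l) else 1#)
      peel i I = ∏-allFin-suc m (λ l → if does (l ∈? (i ∷ I)) then a l else 1#)
      without : ∀ s I → termAbove (s ∷ S) a (outside ∷ I) ≈ factor-out s * termAbove S (a ∘ suc) I
      without true  I = sym (zeroˡ _)
      without false I with does (S ⊆? I)
      ... | true  = trans (*-congˡ (trans (peel outside I) (*-identityˡ _))) (sym (*-identityˡ _))
      ... | false = sym (zeroʳ _)
      within : ∀ s I → termAbove (s ∷ S) a (inside ∷ I) ≈ factor-in s * termAbove S (a ∘ suc) I
      within true  I with does (S ⊆? I)
      ... | true  = trans (*-congˡ (peel inside I)) (solve 3 (λ e x y → e :* (x :* y) := x :* (e :* y)) refl _ _ _)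
      ... | false = sym (zeroʳ _)
      within false I with does (S ⊆? I)
      ... | true  = trans (*-congˡ (peel inside I))
        (solve 3 (λ e x y → (:- con (+ 1) :* e) :* (x :* y) := (:- x) :* (e :* y)) refl _ _ _)
      ... | false = sym (zeroʳ _)

-- The clauses of an instance and the meaning of `q`.

module InstanceMean {c ℓ₁ ℓ₂} (ℝ : RealNumbers c ℓ₁ ℓ₂) {n m} (Φ : PartialRejectionSampling.Instance ℝ n m) where
  open RealNumbers ℝ hiding (zero)
  open OrderedField ℝ
  open Summation ℝ
  open Expectation ℝ
  open ProductMean ℝ
  open FiniteExpansion ℝ
  open PartialRejectionSampling ℝ using (module Instance; mass; HasProbability; Extremal; Independent; independent?; q)
  open Instance Φ

  -- Countability supplies decidable equality, on which the unions of finite lists and the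
  -- indicators of fibres rely.
  _≟ᴰ_ : ∀ i → DecidableEquality (D i)
  _≟ᴰ_ i = via-injection (countable i) ℕ._≟_

  open Conditioning _≟ᴰ_ 𝒟 public

  values : ∀ S → Mean (Values D S)
  values = valuesMean _≟ᴰ_ 𝒟

  M : Mean (Assignment D)
  M = values ⊤

  violated : Fin m → Bounded (Assignment D)
  violated l = indicator (λ x → not (φ l x))

  abstract
    probability : ∀ (B : Assignment D → Bool) {p} → HasProbability Φ B p → E M (indicator B) ≈ p
    probability B hasP = HasSum-unique
      (valuesMean-represents _≟ᴰ_ 𝒟 ⊤ (indicator B) 0≤indicator) (HasSum-cong by-value refl hasP)
      where
      0≤indicator : ∀ x → 0# ≤ at (indicator B) x
      0≤indicator x with B x
      ... | true  = <⇒≤ 0<1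
      ... | false = ≤-refl
      by-value : ∀ x → (if B x then mass D 𝒟 ⊤ x else 0#) ≈ mass D 𝒟 ⊤ x * (if B x then 1# else 0#)
      by-value x with B x
      ... | true  = sym (*-identityʳ _)
      ... | false = sym (zeroʳ _)

    violated-local : ∀ l V → Disjoint V (scope l) → ∀ x → at (conditional V (violated l)) x ≈ at (violated l) x
    violated-local l V d x = E-const (values V) (at (violated l) x) (violated l ∘ᵇ overwrite D V x)
      (λ v → reflexive (≡.cong (λ y → if not (clause l y) then 1# else 0#) (restrict-overwrite D V (scope l) d x v)))

    violated-idem : ∀ l x → at (violated l) x * at (violated l) x ≈ at (violated l) x
    violated-idem l x with φ l x
    ... | true  = zeroˡ _
    ... | false = *-identityˡ _

    violated-adjacent : Extremal Φ → ∀ k l → k ≢ l → Nonempty (scope k ∩ scope l) → ∀ x →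
                        at (violated k) x * at (violated l) x ≈ 0#
    violated-adjacent extremal k l k≢l meet x with φ k x | φ l x | extremal k l (k≢l , meet) x
    ... | true  | _     | _ = zeroˡ _
    ... | false | true  | _ = zeroʳ _
    ... | false | false | ()

    E-conditional-⊤ : ∀ f → E M f ≈ E M (conditional ⊤ f)
    E-conditional-⊤ f = sym (E-const M (E M f) (conditional ⊤ f) (conditional-⊤ _≟ᴰ_ 𝒟 f))

    E-conditional-⊤-* : ∀ f g → E M (conditional ⊤ f *ᵇ conditional ⊤ g) ≈ E M f * E M g
    E-conditional-⊤-* f g = E-const M (E M f * E M g) (conditional ⊤ f *ᵇ conditional ⊤ g)
      (λ x → *-cong (conditional-⊤ _≟ᴰ_ 𝒟 f x) (conditional-⊤ _≟ᴰ_ 𝒟 g x))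

    unit-difference : ∀ {a x y z} → a ≈ 1# → a * (x - y) ≈ z → x ≈ z + y
    unit-difference {a} {x} {y} {z} a≈1 eq = begin
      x                    ≈⟨ solve 2 (λ x y → x := con (+ 1) :* (x :- y) :+ y) refl x y ⟩
      1# * (x - y) + y     ≈⟨ +-congʳ (*-congʳ a≈1) ⟨
      a * (x - y) + y      ≈⟨ +-congʳ eq ⟩
      z + y                ∎
      where open import Relation.Binary.Reasoning.Setoid setoid

  module _ (extremal : Extremal Φ) where
    clauses : Clauses (Bounded-commutativeRing (Assignment D)) (conditionalAveraging _≟ᴰ_ 𝒟) m
    clauses = record
      { A          = violated
      ; scope      = scope
      ; A-local    = violated-local
      ; A-idem     = violated-idem
      ; A-adjacent = violated-adjacent extremal
      }

    open ClauseOperator (Bounded-commutativeRing (Assignment D)) (conditionalAveraging _≟ᴰ_ 𝒟) clauses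
    open AveragingProperties (Bounded-commutativeRing (Assignment D)) (conditionalAveraging _≟ᴰ_ 𝒟)
      using (Local-1; E-independent)

    every : List (Fin m) → Bounded (Assignment D)
    every []       = constᵇ 1#
    every (l ∷ ls) = violated l *ᵇ every ls

    abstract
      at-every : ∀ ls x → at (every ls) x ≈ ∏ ls (λ l → at (violated l) x)
      at-every []       x = refl
      at-every (l ∷ ls) x = *-congˡ (at-every ls x)

      at-none : ∀ ls x → at (none ls) x ≈ ∏ ls (λ l → 1# - at (violated l) x)
      at-none []       x = refl
      at-none (l ∷ ls) x = *-congˡ (at-none ls x)

      at-none-all : ∀ ls x → at (none ls) x ≈ (if all (λ l → φ l x) ls then 1# else 0#)
      at-none-all []       x = refl
      at-none-all (l ∷ ls) x with φ l x
      ... | true  = trans (*-cong (solve 0 (con (+ 1) :- con (+ 0) := con (+ 1)) refl) (at-none-all ls x)) (*-identityˡ _)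
      ... | false = trans (*-congʳ (-‿inverseʳ 1#)) (zeroˡ _)

      0≤at-none : ∀ ls x → 0# ≤ at (none ls) x
      0≤at-none ls x = ≤-respʳ (sym (at-none-all ls x)) (0≤if (all (λ l → φ l x) ls))
        where
        0≤if : ∀ b → 0# ≤ (if b then 1# else 0#)
        0≤if true  = <⇒≤ 0<1
        0≤if false = ≤-refl

      all-⊆ : ∀ {x} ls js → all (λ l → φ l x) ls ≡ true → (∀ {l} → l ∈ₗ js → l ∈ₗ ls) → all (λ l → φ l x) js ≡ true
      all-⊆ ls [] eq sub = ≡.refl
      all-⊆ {x} ls (j ∷ js) eq sub = ≡.cong₂ _∧_ (lookup ls eq (sub (here ≡.refl))) (all-⊆ ls js eq (sub ∘ there))
        where
        lookup : ∀ ls → all (λ l → φ l x) ls ≡ true → ∀ {l} → l ∈ₗ ls → φ l x ≡ true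
        lookup (l ∷ ls) eq (here ≡.refl) = ∧-conicalˡ (φ l x) _ eq
        lookup (l ∷ ls) eq (there l∈ls)  = lookup ls (∧-conicalʳ (φ l x) _ eq) l∈ls

      none-positive : ∀ {P} → HasProbability Φ formula P → 0# < P → ∀ ls → 0# < E M (none ls)
      none-positive hasP 0<P ls = <-≤-trans (<-respʳ (sym (probability formula hasP)) 0<P)
        (E-mono M (indicator formula) (none ls) below)
        where
        below : ∀ x → at (indicator formula) x ≤ at (none ls) x
        below x = by-value (formula x) ≡.refl
          where
          by-value : ∀ b → formula x ≡ b → (if b then 1# else 0#) ≤ at (none ls) x
          by-value false _  = 0≤at-none ls x
          by-value true  eq = ≤-reflexive (sym (trans (at-none-all ls x)
            (reflexive (≡.cong (λ b → if b then 1# else 0#) (all-⊆ (allFin m) ls eq (λ {l} _ → ∈-allFin l))))))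

      -- Pairwise far clauses have disjoint scopes, so their violations are independent events and
      -- the probabilities multiply.
      E-every : ∀ ls → AllPairs Far ls → E M (every ls) ≈ ∏ ls (λ l → E M (violated l))
      E-every []       _              = E-1 M (constᵇ 1#) (λ _ → refl)
      E-every (l ∷ ls) (fars ∷ pairs) = trans product (*-congˡ (E-every ls pairs))
        where
        far-inv : ∀ js → All (Far l) js → ∀ x → at (conditional (scope l) (every js)) x ≈ at (every js) x
        far-inv []       _              = Local-1 ⊥ (scope l) (λ _ → ∉⊥)
        far-inv (j ∷ js) (far ∷ fars) x = trans
          (conditional-pull _≟ᴰ_ 𝒟 (scope l) (violated j) (every js) (violated-local j (scope l) (Far⇒Disjoint far)) x)
          (*-congˡ (far-inv js fars x))
        product : E M (violated l *ᵇ every ls) ≈ E M (violated l) * E M (every ls)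
        product = begin
          E M (violated l *ᵇ every ls)   ≈⟨ E-conditional-⊤ (violated l *ᵇ every ls) ⟩
          E M (conditional ⊤ (violated l *ᵇ every ls))
            ≈⟨ E-cong M (conditional ⊤ (violated l *ᵇ every ls)) (conditional ⊤ (violated l) *ᵇ conditional ⊤ (every ls))
                 (E-independent ⊤ {violated l} {every ls} (violated-local l) (far-inv ls fars)) ⟩
          E M (conditional ⊤ (violated l) *ᵇ conditional ⊤ (every ls))
            ≈⟨ E-conditional-⊤-* (violated l) (every ls) ⟩
          E M (violated l) * E M (every ls)   ∎
          where open import Relation.Binary.Reasoning.Setoid setoid

      -- Distinct clauses that are not pairwise far include an adjacent pair, which extremality
      -- prevents from being violated jointly.
      every-dichotomy : ∀ ls → Unique ls → AllPairs Far ls ⊎ E M (every ls) ≈ 0#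
      every-dichotomy [] _ = inj₁ []
      every-dichotomy (l ∷ ls) (l∉ls ∷ ls!) with every-dichotomy ls ls! | All.all? (far? l) ls
      ... | inj₁ pairs | yes fars = inj₁ (fars ∷ pairs)
      ... | inj₂ E≈0   | _        = inj₂ (≤-antisym
        (≤-trans (E-mono M (violated l *ᵇ every ls) (every ls) (λ x → violated*≤ x)) (≤-reflexive E≈0))
        (E-lower M (violated l *ᵇ every ls) (λ x → 0≤* (0≤violated l x) (0≤every ls x))))
        where
        0≤violated : ∀ l x → 0# ≤ at (violated l) x
        0≤violated l x with φ l x
        ... | true  = ≤-refl
        ... | false = <⇒≤ 0<1
        0≤every : ∀ ls x → 0# ≤ at (every ls) x
        0≤every []       x = <⇒≤ 0<1
        0≤every (l ∷ ls) x = 0≤* (0≤violated l x) (0≤every ls x)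
        violated*≤ : ∀ x → at (violated l) x * at (every ls) x ≤ at (every ls) x
        violated*≤ x with φ l x
        ... | true  = ≤-respˡ (sym (zeroˡ _)) (0≤every ls x)
        ... | false = ≤-reflexive (*-identityˡ _)
      ... | inj₁ _ | no ¬fars = inj₂ (E-const M 0# (violated l *ᵇ every ls) (λ x → vanish ls l∉ls ¬fars x))
        where
        vanish : ∀ js → All (l ≢_) js → ¬ All (Far l) js → ∀ x → at (violated l) x * at (every js) x ≈ 0#
        vanish []       _             ¬fars x = ⊥-elim (¬fars [])
        vanish (j ∷ js) (l≢j ∷ l≢js) ¬fars x with far? l j
        ... | no ¬far = trans (sym (*-assoc _ _ _)) (trans (*-congʳ (¬Far⇒A*A≈0 l≢j ¬far x)) (zeroˡ _))
        ... | yes far = trans (solve 3 (λ x y z → x :* (y :* z) := y :* (x :* z)) refl _ _ _)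
                          (trans (*-congˡ (vanish js l≢js (λ fars → ¬fars (far ∷ fars)) x)) (zeroʳ _))

      members : ∀ (I : Subset m) → Unique (filter (_∈? I) (allFin m))
      members I = Unique.filter⁺ (_∈? I) (Unique.allFin⁺ m)

      independent⇒pairs : ∀ I → Independent Φ I → AllPairs Far (filter (_∈? I) (allFin m))
      independent⇒pairs I ind = go _ (members I) (λ l∈ → proj₂ (∈-filter⁻ (_∈? I) {xs = allFin m} l∈))
        where
        go : ∀ ls → Unique ls → (∀ {l} → l ∈ₗ ls → l ∈ I) → AllPairs Far ls
        go []       _            _  = []
        go (l ∷ ls) (l∉ls ∷ ls!) ⊆I =
          All.tabulate (λ j∈ls → All.lookup l∉ls j∈ls , λ meet →
            ind l (⊆I (here ≡.refl)) _ (⊆I (there j∈ls)) (All.lookup l∉ls j∈ls , meet)) ∷ go ls ls! (⊆I ∘ there)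

      pairs⇒independent : ∀ I → AllPairs Far (filter (_∈? I) (allFin m)) → Independent Φ I
      pairs⇒independent I pairs k k∈I l l∈I (k≢l , meet) =
        go _ pairs (∈-filter⁺ (_∈? I) (∈-allFin k) k∈I) (∈-filter⁺ (_∈? I) (∈-allFin l) l∈I)
        where
        go : ∀ ls → AllPairs Far ls → k ∈ₗ ls → l ∈ₗ ls → Empty.⊥
        go (_ ∷ _) (fars ∷ _) (here ≡.refl) (here ≡.refl) = k≢l ≡.refl
        go (_ ∷ _) (fars ∷ _) (here ≡.refl) (there l∈)    = proj₂ (All.lookup fars l∈) meet
        go (_ ∷ _) (fars ∷ _) (there k∈)    (here ≡.refl) =
          proj₂ (All.lookup fars k∈) (≡.subst Nonempty (∩-comm (scope k) (scope l)) meet)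
        go (_ ∷ _) (_ ∷ pairs) (there k∈)   (there l∈)    = go _ pairs k∈ l∈

    module _ (p : Fin m → Carrier) (hasP : ∀ k → HasProbability Φ (not ∘ φ k) (p k)) where

      pattern-of : Subset m → Assignment D → Carrier
      pattern-of S x = ∏ (allFin m) (λ l → if does (l ∈? S) then at (violated l) x else 1# - at (violated l) x)

      abstract
        -- `q Φ p S` is the probability that exactly the clauses in `S` are violated. The joint
        -- violation of `I` has probability `p_I` for independent `I` and zero otherwise, so the sum
        -- extends to all `I ⊇ S`, where it is an inclusion-exclusion.
        q-mean : ∀ S G → (∀ x → at G x ≈ pattern-of S x) → q Φ p S ≈ E M G
        q-mean S G G≈ = begin
          q Φ p S
            ≈⟨ ∑-filter (λ I → independent? Φ I ×-dec (S ⊆? I)) (subsets m) _ ⟩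
          ∑ (subsets m) (λ I → if does (independent? Φ I ×-dec (S ⊆? I)) then sign I * ∏ (members-of I) p else 0#)
            ≈⟨ ∑-cong (subsets m) (λ I → weighted I (independent? Φ I) (does (S ⊆? I))) ⟩
          ∑ (subsets m) (λ I → if does (S ⊆? I) then sign I * E M (every (members-of I)) else 0#)
            ≈⟨ ∑-filter (S ⊆?_) (subsets m) _ ⟨
          ∑ (filter (S ⊆?_) (subsets m)) (λ I → sign I * E M (every (members-of I)))
            ≈⟨ proj₂ (proj₂ combination) ⟨
          E M (proj₁ combination)
            ≈⟨ E-cong M (proj₁ combination) G (λ x → trans (proj₁ (proj₂ combination) x) (trans (expand x) (sym (G≈ x)))) ⟩
          E M G ∎
          where
          open import Relation.Binary.Reasoning.Setoid setoid
          sign : Subset m → Carrier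
          sign I = (- 1#) ^ ∣ I ─ S ∣
          members-of : Subset m → List (Fin m)
          members-of I = filter (_∈? I) (allFin m)
          combination : Σ[ H ∈ Bounded (Assignment D) ]
            (∀ x → at H x ≈ ∑ (filter (S ⊆?_) (subsets m)) (λ I → sign I * at (every (members-of I)) x)) ×
            E M H ≈ ∑ (filter (S ⊆?_) (subsets m)) (λ I → sign I * E M (every (members-of I)))
          combination = E-∑ M (filter (S ⊆?_) (subsets m)) sign (λ I → every (members-of I))
          weighted : ∀ I (ind? : Dec (Independent Φ I)) (b : Bool) →
            (if does ind? ∧ b then sign I * ∏ (members-of I) p else 0#)
            ≈ (if b then sign I * E M (every (members-of I)) else 0#)
          weighted I (yes ind) true  = *-congˡ (trans
            (∏-cong (members-of I) (λ l → sym (probability (not ∘ φ l) (hasP l))))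
            (sym (E-every (members-of I) (independent⇒pairs I ind))))
          weighted I (yes ind) false = refl
          weighted I (no ¬ind) false = refl
          weighted I (no ¬ind) true with every-dichotomy (members-of I) (members I)
          ... | inj₁ pairs = contradiction (pairs⇒independent I pairs) ¬ind
          ... | inj₂ E≈0   = sym (trans (*-congˡ E≈0) (zeroʳ _))
          expand : ∀ x → ∑ (filter (S ⊆?_) (subsets m)) (λ I → sign I * at (every (members-of I)) x) ≈ pattern-of S x
          expand x = trans (∑-cong (filter (S ⊆?_) (subsets m)) (λ I → *-congˡ
              (trans (at-every (members-of I) x) (∏-filter (_∈? I) (allFin m) _))))
            (trans (∑-filter (S ⊆?_) (subsets m) _) (inclusion-exclusion S (λ l → at (violated l) x)))

        q-∅ : q Φ p ⊥ ≈ E M (none (allFin m))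
        q-∅ = q-mean ⊥ (none (allFin m)) (λ x → trans (at-none (allFin m) x)
          (∏-cong (allFin m) (λ l → reflexive (≡.cong (λ b → if b then at (violated l) x else 1# - at (violated l) x)
            (≡.sym (dec-false (l ∈? ⊥) ∉⊥))))))

        q-singleton : ∀ k → q Φ p ⁅ k ⁆ ≈ E M (violated k *ᵇ none (filter (λ l → ¬? (k Fin.≟ l)) (allFin m)))
        q-singleton k = q-mean ⁅ k ⁆ (violated k *ᵇ none (filter (λ l → ¬? (k Fin.≟ l)) (allFin m))) (λ x →
          trans (*-congˡ (trans (at-none (filter (λ l → ¬? (k Fin.≟ l)) (allFin m)) x)
            (∏-filter (λ l → ¬? (k Fin.≟ l)) (allFin m) _))) (merge x (allFin m) (Unique.allFin⁺ m) (∈-allFin k)))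
          where
          merge : ∀ x ls → Unique ls → k ∈ₗ ls →
            at (violated k) x * ∏ ls (λ l → if does (¬? (k Fin.≟ l)) then 1# - at (violated l) x else 1#)
            ≈ ∏ ls (λ l → if does (l ∈? ⁅ k ⁆) then at (violated l) x else 1# - at (violated l) x)
          merge x (l ∷ ls) (l∉ls ∷ _) (here ≡.refl) = *-cong
            (reflexive (≡.cong (λ b → if b then at (violated l) x else 1# - at (violated l) x) (≡.sym (dec-true (l ∈? ⁅ l ⁆) (x∈⁅x⁆ l)))))
            (trans (*-congʳ (reflexive (≡.cong (λ b → if not b then 1# - at (violated l) x else 1#) (dec-true (l Fin.≟ l) ≡.refl))))
              (trans (*-identityˡ _) (∏-cong-∈ ls (λ {j} j∈ls → other j (All.lookup l∉ls j∈ls)))))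
            where
            other : ∀ j → l ≢ j → (if does (¬? (l Fin.≟ j)) then 1# - at (violated j) x else 1#)
                    ≈ (if does (j ∈? ⁅ l ⁆) then at (violated j) x else 1# - at (violated j) x)
            other j l≢j = trans
              (reflexive (≡.cong (λ b → if not b then 1# - at (violated j) x else 1#) (dec-false (l Fin.≟ j) l≢j)))
              (reflexive (≡.cong (λ b → if b then at (violated j) x else 1# - at (violated j) x)
                (≡.sym (dec-false (j ∈? ⁅ l ⁆) (λ j∈ → l≢j (≡.sym (x∈⁅y⁆⇒x≡y l j∈)))))))
          merge x (l ∷ ls) (l∉ls ∷ ls!) (there k∈ls) = trans (solve 3 (λ x y z → x :* (y :* z) := y :* (x :* z)) refl _ _ _)
            (*-cong (trans
              (reflexive (≡.cong (λ b → if not b then 1# - at (violated l) x else 1#) (dec-false (k Fin.≟ l) k≢l)))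
              (reflexive (≡.cong (λ b → if b then at (violated l) x else 1# - at (violated l) x)
                (≡.sym (dec-false (l ∈? ⁅ k ⁆) (λ l∈ → k≢l (≡.sym (x∈⁅y⁆⇒x≡y k l∈))))))))
              (merge x ls ls! k∈ls))
            where
            k≢l : k ≢ l
            k≢l ≡.refl = All.lookup l∉ls k∈ls ≡.refl

    module _ {P} (hasP : HasProbability Φ formula P) (0<P : 0# < P) where

      invertible : ∀ ls → Σ[ r ∈ Bounded (Assignment D) ] (∀ x → at r x * at (conditional ⊤ (none ls)) x ≈ 1#)
      invertible ls =
        let y , _ , Ey≈1 = positive-inverse (none-positive hasP 0<P ls)
        in  constᵇ y , λ x → trans (*-congˡ (conditional-⊤ _≟ᴰ_ 𝒟 (none ls) x)) (trans (*-comm _ _) Ey≈1)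

      open Inversion invertible
      module Solutions (k : Fin m) = Solution (allFin m) (Unique.allFin⁺ m) ∈-allFin k

      potential : Fin m → Bounded (Assignment D)
      potential k = Solutions.F k

      abstract
        violated≈1 : ∀ l x → φ l x ≡ false → at (violated l) x ≈ 1#
        violated≈1 l x φ≡false = reflexive (≡.cong (λ b → if not b then 1# else 0#) φ≡false)

        potential-step : ∀ k l x → φ l x ≡ false →
          at (potential k) x ≈ (if does (k Fin.≟ l) then 1# else 0#) + E (resampled (scope l) x) (potential k)
        potential-step k l x φ≡false = by-cases (k Fin.≟ l)
          where
          by-cases : (k≟l : Dec (k ≡ l)) → at (potential k) x ≈ (if does k≟l then 1# else 0#) + E (resampled (scope l) x) (potential k)
          by-cases (yes ≡.refl) = unit-difference (violated≈1 k x φ≡false) (trans (Solutions.local-self k x) (violated≈1 k x φ≡false))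
          by-cases (no k≢l)     = unit-difference (violated≈1 l x φ≡false) (Solutions.local-other k l k≢l x)

        potential-satisfied : ∀ k x → formula x ≡ true → at (potential k) x ≈ 0#
        potential-satisfied k x eq = trans (sym (*-identityˡ _)) (trans (*-congʳ (sym
          (trans (at-none-all (allFin m) x) (reflexive (≡.cong (λ b → if b then 1# else 0#) eq))))) (Solutions.satisfied k x))

        potential-mean : ∀ k → E M (none (allFin m)) * E M (potential k) ≈
          E M (violated k *ᵇ none (filter (λ l → ¬? (k Fin.≟ l)) (allFin m)))
        potential-mean k = sym (begin
          E M (Solutions.only k)                              ≈⟨ E-conditional-⊤ (Solutions.only k) ⟩
          E M (conditional ⊤ (Solutions.only k))
            ≈⟨ E-cong M (conditional ⊤ (none (allFin m)) *ᵇ conditional ⊤ (potential k)) (conditional ⊤ (Solutions.only k)) (Solutions.average k) ⟨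
          E M (conditional ⊤ (none (allFin m)) *ᵇ conditional ⊤ (potential k))
            ≈⟨ E-conditional-⊤-* (none (allFin m)) (potential k) ⟩
          E M (none (allFin m)) * E M (potential k)   ∎)
          where open import Relation.Binary.Reasoning.Setoid setoid

-- The law of a run under a rule.

module Process {c ℓ₁ ℓ₂} (ℝ : RealNumbers c ℓ₁ ℓ₂) {n m} (Φ : PartialRejectionSampling.Instance ℝ n m)
               (rule : PartialRejectionSampling.Rule ℝ Φ) where
  open RealNumbers ℝ hiding (zero)
  open OrderedField ℝ
  open Summation ℝ
  open Expectation ℝ
  open ProductMean ℝ
  open InstanceMean ℝ Φ using (_≟ᴰ_; values; M; resampled)
  open PartialRejectionSampling ℝ using (module Instance; module Rule; mass; weight; resamplings; current; start; resample; idle)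
  open Instance Φ
  open Rule rule renaming (nonNegative to 0≤choose; total to choose-total)

  History : ℕ → Set
  History = PartialRejectionSampling.History ℝ Φ

  previous : ∀ {t} → History (suc t) → History t
  previous (resample h k v) = h
  previous (idle h)         = h

  History-≟ : ∀ {t} → DecidableEquality (History t)
  History-≟ (start x) (start y) = map′ (≡.cong start) (λ { ≡.refl → ≡.refl }) (Values-≟ _≟ᴰ_ ⊤ x y)
  History-≟ (resample h k v) (idle h′) = no λ ()
  History-≟ (idle h) (resample h′ k v) = no λ ()
  History-≟ (idle h) (idle h′) = map′ (≡.cong idle) (λ { ≡.refl → ≡.refl }) (History-≟ h h′)
  History-≟ (resample h k v) (resample h′ k′ v′) with k Fin.≟ k′
  ... | no k≢k′    = no λ { ≡.refl → k≢k′ ≡.refl }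
  ... | yes ≡.refl = map′ (λ { (≡.refl , ≡.refl) → ≡.refl }) (λ { ≡.refl → ≡.refl , ≡.refl })
                       (History-≟ h h′ ×-dec Values-≟ _≟ᴰ_ (scope k) v v′)

  -- The truth value comes with its equation, so that proofs can split on `b` while `kernel`
  -- supplies `≡.refl`; the false branch needs the equation for `choose-total`.
  iterate : ∀ {t} (h : History t) b → formula (current Φ h) ≡ b → Mean (History (suc t))
  iterate h true  _  = dirac (idle h)
  iterate h false eq = mixture (allFin m) (choose h) (0≤choose h) (choose-total h eq)
                         (λ k → pushforward (resample h k) (values (scope k)))

  kernel : ∀ {t} → History t → Mean (History (suc t))
  kernel h = iterate h (formula (current Φ h)) ≡.refl

  trajectory : ∀ t → Mean (History t)
  trajectory zero    = pushforward start M
  trajectory (suc t) = bind (trajectory t) kernel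

  stepWeight : ∀ {t} → History (suc t) → Carrier
  stepWeight (resample h k v) = if formula (current Φ h) then 0# else choose h k * mass D 𝒟 (scope k) v
  stepWeight (idle h)         = if formula (current Φ h) then 1# else 0#

  -- The weight of the last iteration given that clause `k` is picked. Mixing over `k` by `choose`
  -- recovers `stepWeight` when the formula is false.
  drawWeight : ∀ {t} → Fin m → History (suc t) → Carrier
  drawWeight k (resample h l v) = Discrete.δ Fin._≟_ l k * mass D 𝒟 (scope l) v
  drawWeight k (idle h)         = 0#

  abstract
    0≤stepWeight : ∀ {t} (h : History (suc t)) → 0# ≤ stepWeight h
    0≤stepWeight (resample h k v) with formula (current Φ h)
    ... | true  = ≤-refl
    ... | false = 0≤* (0≤choose h k) (0≤mass 𝒟 (scope k) v)
    0≤stepWeight (idle h) with formula (current Φ h)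
    ... | true  = <⇒≤ 0<1
    ... | false = ≤-refl

    0≤drawWeight : ∀ {t} k (h : History (suc t)) → 0# ≤ drawWeight k h
    0≤drawWeight k (resample h l v) = 0≤* (Discrete.0≤δ Fin._≟_ l k) (0≤mass 𝒟 (scope l) v)
    0≤drawWeight k (idle h)         = ≤-refl

    weight-step : ∀ {t} (h : History (suc t)) → weight Φ rule (previous h) * stepWeight h ≈ weight Φ rule h
    weight-step (resample h k v) with formula (current Φ h)
    ... | true  = zeroʳ _
    ... | false = refl
    weight-step (idle h) with formula (current Φ h)
    ... | true  = *-identityʳ _
    ... | false = zeroʳ _

    0≤weight : ∀ {t} (h : History t) → 0# ≤ weight Φ rule h
    0≤weight (start x)          = 0≤mass 𝒟 ⊤ x
    0≤weight h@(resample h′ _ _) = ≤-respʳ (weight-step h) (0≤* (0≤weight h′) (0≤stepWeight h))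
    0≤weight h@(idle h′)         = ≤-respʳ (weight-step h) (0≤* (0≤weight h′) (0≤stepWeight h))

    represents-cong : ∀ {A : Set} {u w : A → Carrier} (N : Mean A) → (∀ a → u a ≈ w a) → Represents u N → Represents w N
    represents-cong N u≈w rep f 0≤f = HasSum-cong (λ a → *-congʳ (u≈w a)) refl (rep f 0≤f)

    represents-mixture : ∀ {A K : Set} → DecidableEquality A → (ks : List K) (p : K → Carrier) (0≤p : ∀ k → 0# ≤ p k) (total : ∑ ks p ≈ 1#)
      (N : K → Mean A) {w : K → A → Carrier} → (∀ k a → 0# ≤ w k a) → (∀ k → Represents (w k) (N k)) →
      Represents (λ a → ∑ ks (λ k → p k * w k a)) (mixture ks p 0≤p total N)
    represents-mixture _≟_ ks p 0≤p total N {w} 0≤w rep f 0≤f = HasSum-cong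
      (λ a → trans (∑-cong ks (λ k → solve 3 (λ p w f → p :* (w :* f) := f :* (p :* w)) refl (p k) (w k a) (at f a)))
               (trans (∑-* ks (at f a) _) (*-comm _ _)))
      refl
      (Discrete.HasSum-∑ _≟_ ks (λ k a → 0≤* (0≤p k) (0≤* (0≤w k a) (0≤f a))) (λ k → HasSum-* (0≤p k) (rep k f 0≤f)))

    -- The factor `δ (previous g) h` confines the weight to successors of `h`, the form in which
    -- `represents-bind` expects a conditional law.
    iterate-represents : ∀ {t} (h : History t) b (eq : formula (current Φ h) ≡ b) →
      Represents (λ g → Discrete.δ History-≟ (previous g) h * stepWeight g) (iterate h b eq)
    iterate-represents {t} h true eq = represents-dirac (idle h) _
      (trans (*-cong (δ-≡ {h} ≡.refl) (reflexive (≡.cong (λ b → if b then 1# else 0#) eq))) (*-identityˡ _)) support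
      where
      open Discrete (History-≟ {t})
      support : ∀ g → g ≡ idle h ⊎ δ (previous g) h * stepWeight g ≈ 0#
      support (idle h′) = by-cases (History-≟ h′ h)
        where
        by-cases : Dec (h′ ≡ h) → idle h′ ≡ idle h ⊎ δ h′ h * stepWeight (idle h′) ≈ 0#
        by-cases (yes ≡.refl) = inj₁ ≡.refl
        by-cases (no h′≢h)    = inj₂ (trans (*-congʳ (δ-≢ h′≢h)) (zeroˡ _))
      support (resample h′ k v) = inj₂ (by-cases (History-≟ h′ h))
        where
        by-cases : Dec (h′ ≡ h) → δ h′ h * stepWeight (resample h′ k v) ≈ 0#
        by-cases (yes ≡.refl) = trans (*-congˡ (reflexive (≡.cong (λ b → if b then 0# else choose h k * mass D 𝒟 (scope k) v) eq))) (zeroʳ _)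
        by-cases (no h′≢h)    = trans (*-congʳ (δ-≢ h′≢h)) (zeroˡ _)
    iterate-represents {t} h false eq = represents-cong (iterate h false eq) merge
      (represents-mixture History-≟ (allFin m) (choose h) (0≤choose h) (choose-total h eq)
        (λ k → pushforward (resample h k) (values (scope k)))
        {w = λ k g → δ (previous g) h * drawWeight k g}
        (λ k g → 0≤* (0≤δ (previous g) h) (0≤drawWeight k g))
        (λ k → represents-pushforward (resample h k) (λ { ≡.refl → ≡.refl }) {w = mass D 𝒟 (scope k)} {M = values (scope k)}
          (valuesMean-represents _≟ᴰ_ 𝒟 (scope k)) (λ g → δ (previous g) h * drawWeight k g)
          (λ v → trans (*-cong (δ-≡ {h} ≡.refl) (trans (*-congʳ (δᶠ-≡ {k} ≡.refl)) (*-identityˡ _))) (*-identityˡ _))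
          (support k)))
      where
      open Discrete (History-≟ {t})
      open Discrete (Fin._≟_ {m}) using () renaming (δ to δᶠ; δ-≡ to δᶠ-≡; δ-≢ to δᶠ-≢; δ-subst to δᶠ-subst; count-∈ to countᶠ-∈)
      support : ∀ k g → (∃[ v ] g ≡ resample h k v) ⊎ δ (previous g) h * drawWeight k g ≈ 0#
      support k (idle h′) = inj₂ (zeroʳ _)
      support k (resample h′ l v) = by-cases (History-≟ h′ h) (l Fin.≟ k)
        where
        by-cases : Dec (h′ ≡ h) → Dec (l ≡ k) →
          (∃[ v′ ] resample h′ l v ≡ resample h k v′) ⊎ δ h′ h * (δᶠ l k * mass D 𝒟 (scope l) v) ≈ 0#
        by-cases (yes ≡.refl) (yes ≡.refl) = inj₁ (v , ≡.refl)
        by-cases (no h′≢h)    _            = inj₂ (trans (*-congʳ (δ-≢ h′≢h)) (zeroˡ _))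
        by-cases (yes _)      (no l≢k)     = inj₂ (trans (*-congˡ (trans (*-congʳ (δᶠ-≢ l≢k)) (zeroˡ _))) (zeroʳ _))
      merge : ∀ g → ∑ (allFin m) (λ k → choose h k * (δ (previous g) h * drawWeight k g)) ≈ δ (previous g) h * stepWeight g
      merge (idle h′) = by-cases (History-≟ h′ h)
        where
        zero-sum : ∑ (allFin m) (λ k → choose h k * (δ h′ h * 0#)) ≈ 0#
        zero-sum = trans (∑-cong (allFin m) (λ k → solve 2 (λ a b → a :* (b :* con (+ 0)) := con (+ 0)) refl (choose h k) (δ h′ h))) (∑-0 (allFin m))
        by-cases : Dec (h′ ≡ h) → ∑ (allFin m) (λ k → choose h k * (δ h′ h * 0#)) ≈ δ h′ h * stepWeight (idle h′)
        by-cases (yes ≡.refl) = trans zero-sum (sym (trans (*-congˡ (reflexive (≡.cong (λ b → if b then 1# else 0#) eq))) (zeroʳ _)))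
        by-cases (no h′≢h)    = trans zero-sum (sym (trans (*-congʳ (δ-≢ h′≢h)) (zeroˡ _)))
      merge (resample h′ l v) = by-cases (History-≟ h′ h)
        where
        w : Carrier
        w = mass D 𝒟 (scope l) v
        collapse : ∑ (allFin m) (λ k → choose h k * (δ h′ h * (δᶠ l k * w))) ≈ δ h′ h * (choose h l * w)
        collapse = trans
          (∑-cong (allFin m) (λ k → trans
            (solve 4 (λ c d e w → c :* (d :* (e :* w)) := d :* w :* (e :* c)) refl (choose h k) (δ h′ h) (δᶠ l k) w)
            (trans (*-congˡ (sym (δᶠ-subst (choose h) l k)))
              (solve 4 (λ d w e c → d :* w :* (e :* c) := d :* (c :* w) :* e) refl (δ h′ h) w (δᶠ l k) (choose h l)))))
          (trans (∑-* (allFin m) (δ h′ h * (choose h l * w)) (δᶠ l))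
            (trans (*-congˡ (countᶠ-∈ (allFin m) (Unique.allFin⁺ m) (∈-allFin l))) (*-identityʳ _)))
        by-cases : Dec (h′ ≡ h) → ∑ (allFin m) (λ k → choose h k * (δ h′ h * (δᶠ l k * w))) ≈ δ h′ h * stepWeight (resample h′ l v)
        by-cases (yes ≡.refl) = trans collapse (*-congˡ (reflexive (≡.cong (λ b → if b then 0# else choose h l * w) (≡.sym eq))))
        by-cases (no h′≢h)    = trans collapse (trans (*-congʳ (δ-≢ h′≢h)) (trans (zeroˡ _) (sym (trans (*-congʳ (δ-≢ h′≢h)) (zeroˡ _)))))

    -- Identifies the law built step by step with `weight`, so expectations along the trajectory are
    -- the sums that the theorem speaks of.
    trajectory-represents : ∀ t → Represents (weight Φ rule) (trajectory t)
    trajectory-represents zero = represents-pushforward start (λ { ≡.refl → ≡.refl }) {w = mass D 𝒟 ⊤} {M = M}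
      (valuesMean-represents _≟ᴰ_ 𝒟 ⊤) (weight Φ rule) (λ _ → refl) (λ { (start x) → inj₁ (x , ≡.refl) })
    trajectory-represents (suc t) = represents-cong (trajectory (suc t)) weight-step
      (represents-bind History-≟ History-≟ previous {u = weight Φ rule} {M = trajectory t} {w = stepWeight} {K = kernel}
        0≤weight 0≤stepWeight (trajectory-represents t) (λ h → iterate-represents h _ ≡.refl))

    kernel-idle : ∀ {t} (h : History t) g → formula (current Φ h) ≡ true → E (kernel h) g ≈ at g (idle h)
    kernel-idle h g halted = by-cases (formula (current Φ h)) ≡.refl halted
      where
      by-cases : ∀ b eq → b ≡ true → E (iterate h b eq) g ≈ at g (idle h)
      by-cases true eq _ = refl

    -- The point where the rule drops out: it puts its whole mass on violated clauses, and a value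
    -- common to all of them is therefore the mean.
    kernel-resample : ∀ {t} (h : History t) g {x} → formula (current Φ h) ≡ false →
      (∀ l → φ l (current Φ h) ≡ false → E (values (scope l)) (g ∘ᵇ resample h l) ≈ x) → E (kernel h) g ≈ x
    kernel-resample h g {x} running each = by-cases (formula (current Φ h)) ≡.refl running
      where
      term : ∀ l b → φ l (current Φ h) ≡ b → choose h l * E (values (scope l)) (g ∘ᵇ resample h l) ≈ x * choose h l
      term l false eq = trans (*-congˡ (each l eq)) (*-comm _ _)
      term l true  eq = trans (*-congʳ (picksFalse h running l eq)) (trans (zeroˡ _)
        (sym (trans (*-congˡ (picksFalse h running l eq)) (zeroʳ _))))
      by-cases : ∀ b eq → b ≡ false → E (iterate h b eq) g ≈ x
      by-cases false eq _ = trans (∑-cong (allFin m) (λ l → term l _ ≡.refl))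
        (trans (∑-* (allFin m) x (choose h)) (trans (*-congˡ (choose-total h eq)) (*-identityʳ _)))

  resamplingCount : Fin m → ∀ t → Bounded (History t)
  resamplingCount k t = record
    { at      = λ h → resamplings Φ k h · 1#
    ; bound   = t · 1#
    ; 0≤bound = 0≤n·1 t
    ; upper   = λ h → n·1-mono (count≤t h)
    ; lower   = λ h → ≤-trans (≤-respʳ (solve 0 (:- con (+ 0) := con (+ 0)) refl) (neg-≤ (0≤n·1 t))) (0≤n·1 (resamplings Φ k h))
    }
    where
    count≤t : ∀ {t} (h : History t) → resamplings Φ k h ℕ.≤ t
    count≤t (start x) = ℕ.z≤n
    count≤t (idle h)  = ℕ.m≤n⇒m≤1+n (count≤t h)
    count≤t (resample h l v) with does (k Fin.≟ l)
    ... | true  = ℕ.s≤s (count≤t h)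
    ... | false = ℕ.m≤n⇒m≤1+n (count≤t h)

  unsatisfied : Bounded (Assignment D)
  unsatisfied = indicator (not ∘ formula)

  expectedCount : Fin m → ℕ → Carrier
  expectedCount k t = E (trajectory t) (resamplingCount k t)

  along : Bounded (Assignment D) → ∀ t → Bounded (History t)
  along f t = f ∘ᵇ current Φ

  abstract
    expectedCount-sum : ∀ k t → HasSum (λ (h : History t) → weight Φ rule h * (resamplings Φ k h · 1#)) (expectedCount k t)
    expectedCount-sum k t = trajectory-represents t (resamplingCount k t) (λ h → 0≤n·1 (resamplings Φ k h))

    resamplings-step : ∀ {t} k (h : History t) l v →
      resamplings Φ k (resample h l v) · 1# ≈ (if does (k Fin.≟ l) then 1# else 0#) + resamplings Φ k h · 1#
    resamplings-step k h l v with does (k Fin.≟ l)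
    ... | true  = refl
    ... | false = sym (+-identityˡ _)

  module _ (k : Fin m) (F : Bounded (Assignment D))
           (F-step : ∀ l x → φ l x ≡ false → at F x ≈ (if does (k Fin.≟ l) then 1# else 0#) + E (resampled (scope l) x) F) where

    abstract
      conserved : ∀ t → expectedCount k t + E (trajectory t) (along F t) ≈ E M F
      conserved t = trans (sym (E-+ (trajectory t) (resamplingCount k t) (along F t) (resamplingCount k t +ᵇ along F t) (λ _ → refl))) (total-constant t)
        where
        total : ∀ t → Bounded (History t)
        total t = resamplingCount k t +ᵇ along F t
        step : ∀ {t} (h : History t) b → formula (current Φ h) ≡ b → E (kernel h) (total (suc t)) ≈ at (total t) h
        step {t} h true  eq = kernel-idle h (total (suc t)) eq
        step {t} h false eq = kernel-resample h (total (suc t)) eq λ l φ≡false → trans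
          (E-+ (values (scope l)) (constᵇ ((if does (k Fin.≟ l) then 1# else 0#) + resamplings Φ k h · 1#))
            (F ∘ᵇ overwrite D (scope l) (current Φ h)) (total (suc t) ∘ᵇ resample h l)
            (λ v → +-congʳ (resamplings-step k h l v)))
          (trans (+-congʳ (E-const (values (scope l)) _ (constᵇ ((if does (k Fin.≟ l) then 1# else 0#) + resamplings Φ k h · 1#)) (λ _ → refl)))
            (trans (solve 3 (λ a b c → a :+ b :+ c := b :+ (a :+ c)) refl _ _ _) (+-congˡ (sym (F-step l (current Φ h) φ≡false)))))
        total-constant : ∀ t → E (trajectory t) (total t) ≈ E M F
        total-constant zero    = E-cong M (total zero ∘ᵇ start) F (λ x → +-identityˡ _)
        total-constant (suc t) = trans
          (E-cong (trajectory t) (marginal kernel (total (suc t))) (total t) (λ h → step h _ ≡.refl)) (total-constant t)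

  module Termination (T : Bounded (Assignment D))
                     (T-step : ∀ l x → φ l x ≡ false → at T x ≈ 1# + E (resampled (scope l) x) T) where

    running : ℕ → Carrier
    running t = E (trajectory t) (along unsatisfied t)

    abstract
      at-unsatisfied : ∀ {x b} → formula x ≡ b → at unsatisfied x ≈ (if not b then 1# else 0#)
      at-unsatisfied eq = reflexive (≡.cong (λ b → if not b then 1# else 0#) eq)

      drift : ∀ t → E (trajectory (suc t)) (along T (suc t)) + running t ≈ E (trajectory t) (along T t)
      drift t = sym (E-+ (trajectory t) (marginal kernel (along T (suc t))) (along unsatisfied t) (along T t) (λ h → step h _ ≡.refl))
        where
        step : ∀ (h : History t) b → formula (current Φ h) ≡ b →
               at T (current Φ h) ≈ E (kernel h) (along T (suc t)) + at unsatisfied (current Φ h)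
        step h true  eq = sym (trans (+-cong (kernel-idle h (along T (suc t)) eq) (at-unsatisfied eq)) (+-identityʳ _))
        step h false eq = trans (solve 1 (λ x → x := x :- con (+ 1) :+ con (+ 1)) refl (at T (current Φ h)))
          (+-cong (sym (kernel-resample h (along T (suc t)) eq λ l φ≡false → trans
              (solve 1 (λ x → x := con (+ 1) :+ x :- con (+ 1)) refl (E (resampled (scope l) (current Φ h)) T))
              (+-congʳ (sym (T-step l (current Φ h) φ≡false)))))
            (sym (at-unsatisfied eq)))

      running-decreasing : ∀ t → running (suc t) ≤ running t
      running-decreasing t = E-mono (trajectory t) (marginal kernel (along unsatisfied (suc t))) (along unsatisfied t) (λ h → step h _ ≡.refl)
        where
        step : ∀ (h : History t) b → formula (current Φ h) ≡ b → E (kernel h) (along unsatisfied (suc t)) ≤ at unsatisfied (current Φ h)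
        step h true  eq = ≤-reflexive (kernel-idle h (along unsatisfied (suc t)) eq)
        step h false eq = ≤-respʳ (sym (at-unsatisfied eq)) (E-upper (kernel h) (along unsatisfied (suc t)) (upper (along unsatisfied (suc t))))

      -- The drifts telescope: the sum of `running s` over `s < t` is the total loss of `T`. As
      -- `running` decreases, that sum is at least `t` times `running t`.
      running-budget : ∀ t → t · 1# * running t + E (trajectory t) (along T t) ≤ E (trajectory 0) (along T 0)
      running-budget zero    = ≤-reflexive (trans (+-congʳ (zeroˡ _)) (+-identityˡ _))
      running-budget (suc t) = ≤-trans
        (+-mono-≤ (*-monoˡ-≤ (0≤n·1 (suc t)) (running-decreasing t)) ≤-refl)
        (≤-respˡ (trans (+-congˡ (sym (drift t)))
          (solve 3 (λ k r s → k :* r :+ (s :+ r) := (con (+ 1) :+ k) :* r :+ s) refl (t · 1#) (running t) (E (trajectory (suc t)) (along T (suc t)))))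
          (running-budget t))

      -- `T` is known to be bounded but not to be non-negative, so the loss from start to time `t`
      -- is bounded by twice `bound T`.
      running-bound : ∀ t → t · 1# * running t ≤ bound T + bound T
      running-bound t = ≤-respˡ (solve 2 (λ x y → x :+ y :- y := x) refl _ _)
        (+-mono-≤ (≤-trans (running-budget t) (E-upper (trajectory 0) (along T 0) (upper (along T 0))))
          (≤-respʳ (solve 1 (λ x → :- :- x := x) refl (bound T)) (neg-≤ (E-lower (trajectory t) (along T t) (lower (along T t))))))

    abstract
      halting-average : ∀ F → (∀ x → formula x ≡ true → at F x ≈ 0#) → ∀ t →
        E (trajectory t) (along F t) ≤ bound F * running t × - (bound F * running t) ≤ E (trajectory t) (along F t)
      halting-average F F-sat t =
        ≤-respʳ (E-* (trajectory t) (bound F) (along unsatisfied t) (along scaled t) (λ _ → refl))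
          (E-mono (trajectory t) (along F t) (along scaled t) (λ h → above (current Φ h) _ ≡.refl)) ,
        ≤-respˡ (trans (E-* (trajectory t) (- bound F) (along unsatisfied t) (along scaled⁻ t) (λ _ → refl))
                  (solve 2 (λ b r → (:- b) :* r := :- (b :* r)) refl (bound F) (running t)))
          (E-mono (trajectory t) (along scaled⁻ t) (along F t) (λ h → below (current Φ h) _ ≡.refl))
        where
        scaled scaled⁻ : Bounded (Assignment D)
        scaled  = constᵇ (bound F) *ᵇ unsatisfied
        scaled⁻ = constᵇ (- bound F) *ᵇ unsatisfied
        above : ∀ x b → formula x ≡ b → at F x ≤ bound F * at unsatisfied x
        above x true  eq = ≤-reflexive (trans (F-sat x eq) (sym (trans (*-congˡ (at-unsatisfied eq)) (zeroʳ _))))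
        above x false eq = ≤-respʳ (sym (trans (*-congˡ (at-unsatisfied eq)) (*-identityʳ _))) (upper F x)
        below : ∀ x b → formula x ≡ b → - bound F * at unsatisfied x ≤ at F x
        below x true  eq = ≤-reflexive (trans (trans (*-congˡ (at-unsatisfied eq)) (zeroʳ _)) (sym (F-sat x eq)))
        below x false eq = ≤-respˡ (sym (trans (*-congˡ (at-unsatisfied eq)) (*-identityʳ _))) (lower F x)

      vanishes : ∀ b → 0# ≤ b → ∀ ε → 0# < ε → ∃[ N ] (∀ t → N ℕ.≤ t → b * running t < ε)
      vanishes b 0≤b ε 0<ε =
        let N , large = archimedean-ratio (b * (bound T + bound T)) 0<ε
        -- Starting at `suc N` keeps `t` positive, so that the factor `t` can be cancelled.
        in  suc N , λ t N<t → *-cancelˡ-< (<-≤-trans (0<suc N) (n·1-mono N<t))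
              (≤-<-trans (≤-respˡ (solve 3 (λ b t r → b :* (t :* r) := t :* (b :* r)) refl b (t · 1#) (running t))
                                  (*-monoˡ-≤ 0≤b (running-bound t)))
                         (large t (ℕ.≤-trans (ℕ.n≤1+n N) N<t)))

    expectedCount-converges : ∀ k F →
      (∀ l x → φ l x ≡ false → at F x ≈ (if does (k Fin.≟ l) then 1# else 0#) + E (resampled (scope l) x) F) →
      (∀ x → formula x ≡ true → at F x ≈ 0#) → expectedCount k ⟶ E M F
    expectedCount-converges k F F-step F-sat ε 0<ε =
      let N , small = vanishes (bound F) (0≤bound F) ε 0<ε
      in  N , λ t N≤t → close (conserved k F F-step t) (proj₁ (halting-average F F-sat t)) (proj₂ (halting-average F F-sat t)) (small t N≤t)
      where
      close : ∀ {e r s d} → e + r ≈ s → r ≤ d → - d ≤ r → d < ε → e < s + ε × s < e + ε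
      close {e} {r} {s} {d} eq r≤d -d≤r d<ε =
        by-< (0<+ (x<y⇒0<y-x d<ε) (x≤y⇒0≤y-x -d≤r))
          (trans (+-congʳ (+-congʳ (sym eq))) (solve 4 (λ e r d E → e :+ r :+ E :- e := E :- d :+ (r :- :- d)) refl e r d ε)) ,
        by-< (0<+ (x<y⇒0<y-x d<ε) (x≤y⇒0≤y-x r≤d))
          (trans (+-congˡ (-‿cong (sym eq))) (solve 4 (λ e r d E → e :+ E :- (e :+ r) := E :- d :+ (d :- r)) refl e r d ε))

-- The total potential and the limiting quotient.

module Conclusion {c ℓ₁ ℓ₂} (ℝ : RealNumbers c ℓ₁ ℓ₂) {n m} (Φ : PartialRejectionSampling.Instance ℝ n m) where
  open RealNumbers ℝ hiding (zero)
  open OrderedField ℝ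
  open Summation ℝ
  open Expectation ℝ
  open PartialRejectionSampling ℝ using (module Instance; HasProbability; Extremal; q; Rule; ExpectedResamplings)
  open Instance Φ

  module _ (extremal : Extremal Φ) {P} (hasP : HasProbability Φ formula P) (0<P : 0# < P) where
    open InstanceMean ℝ Φ

    F : Fin m → Bounded (Assignment D)
    F = potential extremal hasP 0<P

    sumOf : List (Fin m) → Bounded (Assignment D)
    sumOf []       = constᵇ 0#
    sumOf (k ∷ ks) = F k +ᵇ sumOf ks

    abstract
      sumOf-step : ∀ ks l x → φ l x ≡ false →
        at (sumOf ks) x ≈ ∑ ks (λ k → if does (k Fin.≟ l) then 1# else 0#) + E (resampled (scope l) x) (sumOf ks)
      sumOf-step []       l x eq = sym (trans (+-identityˡ _) (E-const (resampled (scope l) x) 0# (constᵇ 0#) (λ _ → refl)))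
      sumOf-step (k ∷ ks) l x eq = trans (+-cong (potential-step extremal hasP 0<P k l x eq) (sumOf-step ks l x eq))
        (trans (solve 4 (λ a b c d → a :+ b :+ (c :+ d) := a :+ c :+ (b :+ d)) refl _ _ _ _)
          (+-congˡ (sym (E-+ (resampled (scope l) x) (F k) (sumOf ks) (F k +ᵇ sumOf ks) (λ _ → refl)))))

      -- Each iteration resamples the scope of exactly one chosen clause, so among the unit terms of
      -- all the potentials exactly one is present.
      total-step : ∀ l x → φ l x ≡ false → at (sumOf (allFin m)) x ≈ 1# + E (resampled (scope l) x) (sumOf (allFin m))
      total-step l x eq = trans (sumOf-step (allFin m) l x eq) (+-congʳ
        (trans (∑-cong (allFin m) (λ k → δ-sym k l)) (count-∈ (allFin m) (Unique.allFin⁺ m) (∈-allFin l))))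
        where open Discrete (Fin._≟_ {m})

    module _ (p : Fin m → Carrier) (hasp : ∀ k → HasProbability Φ (not ∘ φ k) (p k)) where

      abstract
        q∅-positive : 0# < q Φ p ⊥
        q∅-positive = <-respʳ (sym (q-∅ extremal p hasp)) (none-positive extremal hasP 0<P (allFin m))

        q∅*mean : ∀ k → q Φ p ⊥ * E M (F k) ≈ q Φ p ⁅ k ⁆
        q∅*mean k = trans (*-congʳ (q-∅ extremal p hasp))
          (trans (potential-mean extremal hasP 0<P k) (sym (q-singleton extremal p hasp k)))

        quotient : ∀ {x y z} (x#0 : x # 0#) → x * y ≈ z → z / x [ x#0 ] ≈ y
        quotient {x} {y} {z} x#0 xy≈z = trans (*-congʳ (sym xy≈z)) (trans
          (solve 3 (λ x y i → x :* y :* i := y :* (i :* (x :- con (+ 0)))) refl x y (proj₁ (#⇒invertible x#0)))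
          (trans (*-congˡ (proj₁ (proj₂ (#⇒invertible x#0)))) (*-identityʳ y)))

        ⟶-resp : ∀ {s x y} → x ≈ y → s ⟶ x → s ⟶ y
        ⟶-resp x≈y s⟶x ε 0<ε =
          let N , near = s⟶x ε 0<ε
          in  N , λ i N≤i → <-respʳ (+-congʳ x≈y) (proj₁ (near i N≤i)) , <-respˡ x≈y (proj₂ (near i N≤i))

      conclusion : (rule : Rule Φ) (k : Fin m) →
        Σ[ q∅#0 ∈ q Φ p ⊥ # 0# ] ExpectedResamplings Φ rule k (q Φ p ⁅ k ⁆ / q Φ p ⊥ [ q∅#0 ])
      conclusion rule k = q∅#0 , expectedCount k , expectedCount-sum k ,
        ⟶-resp (sym (quotient q∅#0 (q∅*mean k)))
          (Termination.expectedCount-converges (sumOf (allFin m)) total-step k (F k)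
            (potential-step extremal hasP 0<P k) (potential-satisfied extremal hasP 0<P k))
        where
        open Process ℝ Φ rule
        q∅#0 : q Φ p ⊥ # 0#
        q∅#0 = #-sym (<⇒# q∅-positive)

theorem3 : ∀ {c ℓ₁ ℓ₂} (ℝ : RealNumbers c ℓ₁ ℓ₂) →
           let open RealNumbers ℝ
               open PartialRejectionSampling ℝ
           in
           {n m : ℕ} (Φ : Instance n m) →
           Extremal Φ →
           (P : Carrier) → HasProbability Φ (Instance.formula Φ) P → 0# < P →
           (p : Fin m → Carrier) →
           (∀ k → HasProbability Φ (not ∘ Instance.φ Φ k) (p k)) →
           (rule : Rule Φ) (k : Fin m) →
           Σ[ q∅#0 ∈ q Φ p ⊥ # 0# ]
             ExpectedResamplings Φ rule k (q Φ p ⁅ k ⁆ / q Φ p ⊥ [ q∅#0 ])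
theorem3 ℝ Φ extremal P hasP 0<P p hasp rule k =
  Conclusion.conclusion ℝ Φ extremal hasP 0<P p hasp rule k
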